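{- Let $m\ge 0$ and $r\ge 1$ be integers, and write $m=a\binom{r+1}{2}+b$ with $a\ge 0$ an integer and $0\le b<\binom{r+1}{2}$. If $G$ is a graph with exactly $m$ edges and maximum degree $\Delta(G)\le r$, then \[ \kappa(G)\le \kappa\bigl(aK_{r+1}\cup \mathcal{C}(b)\bigr), \] with equality if and only if, disregarding isolated vertices, $G$ is isomorphic to $aK_{r+1}\cup \mathcal{C}(b)$, or $b=\binom{c}{2}+1$ for some integer $c\ge 2$ and $G$ is isomorphic to $aK_{r+1}\cup K_c\cup K_2$.
   Context: All graphs are finite and simple. For a graph $G$ and $t\ge 2$, $k_t(G)$ denotes the number of cliques (complete subgraphs) of $G$ on exactly $t$ vertices, and $\kappa(G)=\sum_{t\ge 2}k_t(G)$ is the number of cliques of size at least $2$. The colexicographic (colex) order on $2$-element subsets of the positive integers is: $\{i<j\}$ precedes $\{i'<j'\}$ iff $j<j'$, or $j=j'$ and $i<i'$. The colex graph $\mathcal{C}(m)$ is the graph on vertex set the positive integers whose edges are the first $m$ pairs in colex order (equivalently, up to isolated vertices, if $m=\binom{c}{2}+d$ with $0\le d<c$, it is a clique on $c$ vertices together with one more vertex adjacent to exactly $d$ vertices of that clique). $\cup$ denotes disjoint union and $aK_{r+1}$ denotes $a$ disjoint copies of the complete graph $K_{r+1}$. -}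

module Defs where

open import Data.Bool using (Bool; true; false; _∧_; _∨_; not; if_then_else_)
open import Data.Nat using (ℕ; zero; suc; _+_; _*_; _≤_; _<ᵇ_; _≡ᵇ_)
open import Data.Nat.Combinatorics using (_C_)
open import Data.Fin using (Fin; toℕ; splitAt)
open import Data.Fin.Subset using (Subset; ∣_∣)
open import Data.List using (List; []; _∷_; map; _++_; allFin; filterᵇ; length)
open import Data.Bool.ListAction using (and)
open import Data.Vec using (Vec; []; _∷_; lookup)
open import Data.Sum using (_⊎_; inj₁; inj₂)
open import Data.Product using (Σ; ∃; ∃-syntax)
open import Function.Bundles using (_↔_; Inverse)
open import Relation.Binary.PropositionalEquality using (_≡_)

record Graph : Set where
  constructor graph
  field
    size : ℕ
    adj  : Fin size → Fin size → Bool
open Graph public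

record IsSimple (G : Graph) : Set where
  field
    symmetric   : ∀ i j → adj G i j ≡ adj G j i
    irreflexive : ∀ i → adj G i i ≡ false

_==_ : ∀ {n} → Fin n → Fin n → Bool
i == j = toℕ i ≡ᵇ toℕ j

subsets : (n : ℕ) → List (Subset n)
subsets zero    = [] ∷ []
subsets (suc n) = map (false ∷_) (subsets n) ++ map (true ∷_) (subsets n)

isClique : (G : Graph) → Subset (size G) → Bool
isClique G s =
  and (map (λ i → and (map (λ j →
      not (lookup s i ∧ lookup s j ∧ not (i == j)) ∨ adj G i j)
    (allFin (size G)))) (allFin (size G)))

k : ℕ → Graph → ℕ
k t G = length (filterᵇ (λ s → isClique G s ∧ (∣ s ∣ ≡ᵇ t)) (subsets (size G)))

κ : Graph → ℕ
κ G = length (filterᵇ (λ s → isClique G s ∧ (1 <ᵇ ∣ s ∣)) (subsets (size G)))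

edges : Graph → ℕ
edges G = k 2 G

degree : (G : Graph) → Fin (size G) → ℕ
degree G v = length (filterᵇ (λ u → adj G v u) (allFin (size G)))

MaxDegree≤ : Graph → ℕ → Set
MaxDegree≤ G r = ∀ v → degree G v ≤ r

_∪_ : Graph → Graph → Graph
G ∪ H = graph (size G + size H) a
  where
  a : Fin (size G + size H) → Fin (size G + size H) → Bool
  a i j with splitAt (size G) i | splitAt (size G) j
  ... | inj₁ x | inj₁ y = adj G x y
  ... | inj₂ x | inj₂ y = adj H x y
  ... | _      | _      = false
infixl 5 _∪_

emptyGraph : ℕ → Graph
emptyGraph p = graph p (λ _ _ → false)

K : ℕ → Graph
K n = graph n (λ i j → not (i == j))

copies : ℕ → Graph → Graph
copies zero    H = emptyGraph 0
copies (suc a) H = H ∪ copies a H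

-- colex graph C(b), on vertices 1..b+1 (represented by Fin (suc b), vertex
-- i ↦ toℕ i + 1; all further vertices of ℕ⁺ are isolated and omitted).
-- For 0-indexed i < j the pair {i+1 < j+1} is the (C(j,2)+i)-th pair
-- (0-indexed) in colex order, so it is an edge iff C(j,2)+i < b.
colexAdj : ℕ → ℕ → ℕ → Bool
colexAdj b i j =
  if i <ᵇ j then (j C 2) + i <ᵇ b
  else if j <ᵇ i then (i C 2) + j <ᵇ b
  else false

colex : ℕ → Graph
colex b = graph (suc b) (λ i j → colexAdj b (toℕ i) (toℕ j))

_≅_ : Graph → Graph → Set
G ≅ H = Σ (Fin (size G) ↔ Fin (size H)) λ f →
          ∀ i j → adj G i j ≡ adj H (Inverse.to f i) (Inverse.to f j)

-- isomorphic disregarding isolated vertices: isomorphic after adding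
-- suitably many isolated vertices to each side
_≅*_ : Graph → Graph → Set
G ≅* H = ∃[ p ] ∃[ q ] ((G ∪ emptyGraph p) ≅ (H ∪ emptyGraph q))

{-# OPTIONS --safe #-}
module Submission where

-- Let N = C(r+1,2) and let g(b) be the number of cliques of size at least two of C(b).  As b grows, g increases by
-- 1; 1, 2; 1, 2, 4; … (row c being the edges of a new vertex to a clique on c vertices).
--
-- Without a degree bound κ ≤ g: deleting a vertex of minimum positive degree δ destroys at most 2^δ - 1 cliques, and
-- g loses at least as much, since the graph has at least C(δ+1,2) edges.  Tracing equality gives the case a = 0.
--
-- With Δ ≤ r a clique on r+1 vertices is a component and splits off.  If there is none and there are at least N edges,
-- the bound is strict.  Let Q be a maximum clique, q = |Q| ≤ r.  For q ≥ r-1, deleting Q destroys at most g(x) cliques,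
-- x being the number of edges it meets, and g is superadditive, also when counted modulo N.  For q ≤ r-3 each
-- neighbourhood has at most (3/4)^4 2^r cliques by Turán's theorem; averaging over all orders of deletion of the
-- vertices gives κ < (m/N) g(N)/2.  For q = r-2 one of the two arguments applies, depending on m.

open import Defs
open import Data.Bool using (Bool; true; false; _∧_; _∨_; not; if_then_else_; T)
open import Data.Bool.ListAction using (and)
open import Data.Bool.Properties using (∧-assoc; ∧-comm; ∧-identityʳ; ∧-zeroʳ; T?)
open import Data.Empty using (⊥; ⊥-elim)
open import Data.Fin using (Fin; zero; suc; toℕ; fromℕ<; _↑ˡ_; _↑ʳ_; splitAt)
open import Data.Fin.Properties using (toℕ-injective; toℕ-fromℕ<; splitAt-↑ˡ; splitAt-↑ʳ) renaming (suc-injective to Fin-suc-injective)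
open import Data.Fin.Subset using (Subset; ∣_∣)
open import Data.List using (List; []; _∷_; _++_; map; length; filterᵇ; allFin; tabulate)
open import Data.List.Membership.Propositional using (_∈_)
open import Data.List.Membership.Propositional.Properties using (∈-++⁺ʳ; ∈-allFin; ∈-map⁺; ∈-map⁻; ∈-filter⁺)
open import Data.List.Membership.Propositional.Properties.WithK using (unique∧set⇒bag)
open import Data.List.Properties using (length-++; ++-assoc; ++-identityʳ; length-map; map-++; map-∘; map-tabulate; length-tabulate)
open import Data.List.Relation.Binary.BagAndSetEquality using (∼bag⇒↭)
open import Data.List.Relation.Binary.Permutation.Propositional as Perm using (_↭_; ↭-refl; ↭-sym; ↭-trans; prep; swap)
open import Data.List.Relation.Binary.Permutation.Propositional.Properties using (All-resp-↭; ↭-length; shift; ++⁺ˡ; ++⁺ʳ; ∈-resp-↭; filter-↭; map⁺; ++-comm)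
open import Data.List.Relation.Unary.All as All using (All; []; _∷_)
open import Data.List.Relation.Unary.All.Properties as All using (++⁺; ++⁻ˡ; ++⁻ʳ)
open import Data.List.Relation.Unary.AllPairs as AllPairs using (AllPairs; []; _∷_)
open import Data.List.Relation.Unary.Any using (here; there)
open import Data.List.Relation.Unary.Unique.Propositional using (Unique)
open import Data.List.Relation.Unary.Unique.Propositional.Properties as Unique using (allFin⁺; filter⁺)
open import Data.Nat
open import Data.Nat.Combinatorics using (_C_; nC1≡n; nCk+nC[k+1]≡[n+1]C[k+1])
open import Data.Nat.Divisibility using (∣-trans; m∣m*n; m≤n⇒m!∣n!)
open import Data.Nat.DivMod using (m/n*n≡m)
open import Data.Nat.ListAction using (sum)
open import Data.Nat.Properties
open import Data.Nat.Tactic.RingSolver using (solve-∀)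
open import Data.Product using (∃-syntax; _×_; _,_; proj₁; proj₂)
open import Data.Sum using (_⊎_; inj₁; inj₂)
open import Data.Unit using (tt)
open import Data.Vec using ([]; _∷_; lookup)
open import Function using (_∘_; id; case_of_)
open import Function.Bundles using (_⇔_; Inverse; mk↔ₛ′; mk⇔)
open import Relation.Binary.Definitions using (tri<; tri≈; tri>)
open import Relation.Binary.PropositionalEquality
open import Relation.Nullary using (¬_; yes; no)

-- The target a g(N) + g(b) is far from linear in m: for large r a remainder b near N can still have
-- g(b) negligible beside g(N). An averaged bound c (m/N) g(N) is therefore used with m/N replaced
-- by a + 1, and at a = 1 this succeeds unconditionally only for c below 1/2. This separates the
-- cases. If q ≤ r-3, c is about 227/512. If q = r-2, c is about 73/128, which is enough for a ≥ 2,
-- or for a = 1 and b ≥ C(r-1,2); in the remaining range a maximum clique, whose vertices have at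
-- most three neighbours outside, is deleted instead. If q ≥ r-1 there are at most two such
-- neighbours, and deletion always works. Deletion may carry m past a multiple of N, which is why
-- the gains of g over windows of consecutive edges are compared with the topmost window below N.
-- Strictness in the absence of a component on r+1 vertices reduces equality to a = 0, where the
-- place of the last attached vertex tells C(b) from K_c with a separate edge.

by≤ : ∀ {x y a b} s → x ≤ y → a + y + s ≡ b + x → a ≤ b
-- An inequality is thus reduced to a polynomial identity for the ring solver; `s` is the slack.
by≤ {x} {y} {a} {b} s x≤y eq = +-cancelʳ-≤ y a b (begin
  a + y ≤⟨ m≤m+n (a + y) s ⟩
  a + y + s ≡⟨ eq ⟩
  b + x ≤⟨ +-monoʳ-≤ b x≤y ⟩
  b + y ∎)
  where open ≤-Reasoning

infixr 5 _⊞_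
_⊞_ : ∀ {a b c d} → a ≤ b → c ≤ d → a + c ≤ b + d
_⊞_ = +-mono-≤

scale : ∀ {a b} k → a ≤ b → k * a ≤ k * b
scale k = *-monoʳ-≤ k

1≤2^ : ∀ n → 1 ≤ 2 ^ n
1≤2^ n = m^n>0 2 n

n<2^n : ∀ n → n < 2 ^ n
n<2^n zero    = s≤s z≤n
n<2^n (suc n) = by≤ 0 (+-mono-≤ (n<2^n n) (1≤2^ n)) (eq n (2 ^ n))
  where
  eq : ∀ n u → suc (suc n) + (u + u) + 0 ≡ 2 * u + (suc n + 1)
  eq = solve-∀

-- The clique numbers g of the colex graphs

-- The binomial coefficient C(n,2), which is also the position where row n of the colex order
-- starts. `tri (suc r)` is the N of the overview.
tri : ℕ → ℕ
tri zero    = 0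
tri (suc n) = tri n + n

tri-mono : ∀ {m n} → m ≤ n → tri m ≤ tri n
tri-mono z≤n             = z≤n
tri-mono (s≤s {m} {n} le) = +-mono-≤ (tri-mono le) le

tri-double : ∀ n → tri (suc n) + tri (suc n) ≡ suc n * n
tri-double zero    = refl
tri-double (suc n) = trans (eq (tri (suc n)) n) (trans (cong (_+ (2 * suc n)) (tri-double n)) (eq′ n))
  where
  eq : ∀ t n → t + suc n + (t + suc n) ≡ t + t + 2 * suc n
  eq = solve-∀
  eq′ : ∀ n → suc n * n + 2 * suc n ≡ suc (suc n) * suc n
  eq′ = solve-∀

n≤tri : ∀ n → n ≤ suc (tri n)
n≤tri zero          = z≤n
n≤tri (suc zero)    = s≤s z≤n
n≤tri (suc (suc n)) = s≤s (m≤n+m (suc n) (tri (suc n)))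

-- The strict bound `d < c` makes the decomposition unique; no edges at all count as row 1, position
-- 0.
decompose : ∀ b → ∃[ c ] ∃[ d ] (d < c × b ≡ tri c + d)
decompose zero = 1 , 0 , s≤s z≤n , refl
decompose (suc b) with decompose b
... | c , d , d<c , refl with suc d ≟ c
...   | yes refl = suc (suc d) , 0 , s≤s z≤n , trans (sym (+-suc _ d)) (sym (+-identityʳ _))
...   | no  d≢c  = c , suc d , ≤∧≢⇒< d<c d≢c , sym (+-suc _ d)

tri-< : ∀ {c d c′ d′} → d < c → tri c + d ≡ tri c′ + d′ → ¬ c < c′
tri-< {c} {d} {c′} {d′} d<c eq c<c′ = <-irrefl eq (begin-strict
  tri c + d <⟨ +-monoʳ-< (tri c) d<c ⟩
  tri (suc c) ≤⟨ tri-mono c<c′ ⟩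
  tri c′ ≤⟨ m≤m+n (tri c′) d′ ⟩
  tri c′ + d′ ∎)
  where open ≤-Reasoning

tri-unique : ∀ {c d c′ d′} → d < c → d′ < c′ → tri c + d ≡ tri c′ + d′ → c ≡ c′ × d ≡ d′
tri-unique {c} {d} {c′} {d′} d<c d′<c′ eq
  with ≤-antisym (≮⇒≥ (tri-< {c = c′} d′<c′ (sym eq))) (≮⇒≥ (tri-< {c = c} d<c eq))
... | refl = refl , +-cancelˡ-≡ (tri c) d d′ eq

c+2≤ : ∀ c d → c + 2 ≤ 2 ^ c + 2 ^ d
c+2≤ c d = by≤ 0 (+-mono-≤ (n<2^n c) (1≤2^ d)) (eq c (2 ^ c) (2 ^ d))
  where
  eq : ∀ c u v → c + 2 + (u + v) + 0 ≡ u + v + (suc c + 1)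
  eq = solve-∀

-- The number of cliques of size at least two of the colex graph with b edges.
abstract
  g : ℕ → ℕ
  g b = let (c , d , _) = decompose b in (2 ^ c + 2 ^ d) ∸ (c + 2)

  -- There are 2^c - c - 1 cliques on the first c vertices and 2^d - 1 through the last one. Outside
  -- the `abstract` block `g` is known by this equation only, so that `decompose` is never unfolded.
  g-row< : ∀ c d → d < c → g (tri c + d) + (c + 2) ≡ 2 ^ c + 2 ^ d
  g-row< c d d<c with decompose (tri c + d)
  ... | c′ , d′ , d′<c′ , eq with tri-unique {c} {d} {c′} {d′} d<c d′<c′ eq
  ... | refl , refl = m∸n+n≡m (c+2≤ c d)

-- A full row, d = c, is position 0 of the next one, and both formulas give the same value there.
-- Admitting it spares later case distinctions.
g-row : ∀ c d → 1 ≤ c → d ≤ c → g (tri c + d) + (c + 2) ≡ 2 ^ c + 2 ^ d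
g-row c d 1≤c d≤c with m≤n⇒m<n∨m≡n d≤c
... | inj₁ d<c  = g-row< c d d<c
... | inj₂ refl = +-cancelʳ-≡ 1 _ _ (begin
  g (tri (suc d)) + (d + 2) + 1 ≡⟨ +-assoc (g (tri (suc d))) (d + 2) 1 ⟩
  g (tri (suc d)) + (d + 2 + 1) ≡⟨ cong₂ (λ i j → g i + j) (sym (+-identityʳ _)) (+-comm (d + 2) 1) ⟩
  g (tri (suc d) + 0) + (suc d + 2) ≡⟨ g-row< (suc d) 0 (s≤s z≤n) ⟩
  2 * 2 ^ d + 1 ≡⟨ cong (_+ 1) (cong (2 ^ d +_) (+-identityʳ _)) ⟩
  2 ^ d + 2 ^ d + 1 ∎)
  where open ≡-Reasoning

g-0 : g 0 ≡ 0
g-0 = +-cancelʳ-≡ 3 _ _ (g-row< 1 0 (s≤s z≤n))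

g-tri : ∀ c → g (tri c) + (c + 1) ≡ 2 ^ c
g-tri zero    = cong (_+ 1) g-0
g-tri (suc c) = +-cancelʳ-≡ 1 _ _ (trans (eq (g (tri (suc c))) c)
  (trans (cong (λ i → g i + (suc c + 2)) (sym (+-identityʳ _))) (g-row< (suc c) 0 (s≤s z≤n))))
  where
  eq : ∀ u c → u + (suc c + 1) + 1 ≡ u + (suc c + 2)
  eq = solve-∀

pow-mono : ∀ {m n} → m ≤ n → 2 ^ m ≤ 2 ^ n
pow-mono = ^-monoʳ-≤ 2

-- This is (Y - X)(Z - 1) ≥ 0 multiplied out. For powers of two it expresses convexity of the
-- exponential, as in `pow-convex`.
cross≤ : ∀ {X Y Z} → X ≤ Y → 1 ≤ Z → Y + X * Z ≤ Y * Z + X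
cross≤ {X} {Y} {suc k} X≤Y _ = by≤ 0 (*-monoˡ-≤ k X≤Y) (eq X Y k)
  where
  eq : ∀ X Y k → Y + X * suc k + Y * k + 0 ≡ Y * suc k + X + X * k
  eq = solve-∀

cross< : ∀ {X Y Z} → X < Y → 2 ≤ Z → Y + X * Z < Y * Z + X
cross< {X} {Y} {suc (suc k)} X<Y _ = by≤ k (*-monoˡ-≤ (suc k) X<Y) (eq X Y k)
  where
  eq : ∀ X Y k → suc (Y + X * suc (suc k)) + Y * suc k + k ≡ Y * suc (suc k) + X + suc X * suc k
  eq = solve-∀
cross< {X} {Y} {suc zero} X<Y (s≤s ())

pow-convex : ∀ w δ i → w ≤ δ → 2 ^ δ + 2 ^ (w + i) ≤ 2 ^ (δ + i) + 2 ^ w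
pow-convex w δ i le rewrite ^-distribˡ-+-* 2 w i | ^-distribˡ-+-* 2 δ i = cross≤ (pow-mono le) (1≤2^ i)

pow-convex< : ∀ w δ i → w < δ → 1 ≤ i → 2 ^ δ + 2 ^ (w + i) < 2 ^ (δ + i) + 2 ^ w
pow-convex< w δ i lt 1≤i rewrite ^-distribˡ-+-* 2 w i | ^-distribˡ-+-* 2 δ i =
  cross< (^-monoʳ-< 2 (s≤s (s≤s z≤n)) lt) (≤-trans (s≤s (s≤s z≤n)) (pow-mono {1} {i} 1≤i))

tri-cancel-≤ : ∀ {c d δ} → d < c → tri δ ≤ tri c + d → δ ≤ c
tri-cancel-≤ {c} {d} {δ} d<c le = ≮⇒≥ λ c<δ → <-irrefl refl (begin-strict
  tri δ ≤⟨ le ⟩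
  tri c + d <⟨ +-monoʳ-< (tri c) d<c ⟩
  tri (suc c) ≤⟨ tri-mono c<δ ⟩
  tri δ ∎)
  where open ≤-Reasoning

-- Whether δ further edges stay in the row of z or reach position suc w of the next row.
data Window (z δ : ℕ) : Set where
  within-row  : ∀ c d → d < c → δ ≤ c → d + δ ≤ c → z ≡ tri c + d → Window z δ
  next-row : ∀ c w i → z ≡ tri c + (suc w + i) → suc w + i < c → δ + i ≡ c → Window z δ

window : ∀ δ z → tri δ ≤ z → Window z δ
window δ z le with decompose z
... | c , d , d<c , refl with d + δ ≤? c
...   | yes p = within-row c d d<c (tri-cancel-≤ {c} {d} d<c le) p refl
...   | no ¬p = next-row c w i (cong (tri c +_) d≡) (subst (_< c) d≡ d<c) δi
  where
  δ≤c = tri-cancel-≤ {c} {d} {δ} d<c le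
  -- `i` is the last position in row c from which δ edges still fit. Beyond it they end at position
  -- d - i = suc w of the next row.
  i = c ∸ δ
  δi : δ + i ≡ c
  δi = m+[n∸m]≡n δ≤c
  i<d : i < d
  i<d = +-cancelˡ-< δ i d (subst₂ _<_ (sym δi) (+-comm d δ) (≰⇒> ¬p))
  w = d ∸ suc i
  d≡ : d ≡ suc w + i
  d≡ = trans (sym (m∸n+n≡m i<d)) (+-suc w i)

module _ where
  private
    stay-val : ∀ c d δ → d < c → d + δ ≤ c →
      g (tri c + d) + 2 ^ (d + δ) ≡ g (tri c + d + δ) + 2 ^ d
    stay-val c d δ d<c le = +-cancelʳ-≡ (c + 2) _ _ (begin
      g (tri c + d) + 2 ^ (d + δ) + (c + 2) ≡⟨ eq (g (tri c + d)) (2 ^ (d + δ)) (c + 2) ⟩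
      g (tri c + d) + (c + 2) + 2 ^ (d + δ) ≡⟨ cong (_+ 2 ^ (d + δ)) (g-row c d 1≤c (<⇒≤ d<c)) ⟩
      2 ^ c + 2 ^ d + 2 ^ (d + δ) ≡⟨ eq (2 ^ c) (2 ^ d) (2 ^ (d + δ)) ⟩
      2 ^ c + 2 ^ (d + δ) + 2 ^ d ≡⟨ cong (_+ 2 ^ d) (sym (g-row c (d + δ) 1≤c le)) ⟩
      g (tri c + (d + δ)) + (c + 2) + 2 ^ d ≡⟨ cong (λ u → g u + (c + 2) + 2 ^ d) (sym (+-assoc (tri c) d δ)) ⟩
      g (tri c + d + δ) + (c + 2) + 2 ^ d ≡⟨ eq (g (tri c + d + δ)) (c + 2) (2 ^ d) ⟩
      g (tri c + d + δ) + 2 ^ d + (c + 2) ∎)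
      where
      open ≡-Reasoning
      1≤c = ≤-trans (s≤s z≤n) d<c
      eq : ∀ a b c → a + b + c ≡ a + c + b
      eq = solve-∀

    -- The gain consists of 2^c - 2^d for the rest of row c, where d = suc w + i, and 2^(suc w) - 1
    -- for the beginning of the next row.
    cross-val : ∀ δ w i → suc w + i < δ + i →
      g (tri (δ + i) + (suc w + i)) + (2 ^ (δ + i) + 2 ^ suc w) ≡ g (tri (δ + i) + (suc w + i) + δ) + 1 + 2 ^ (suc w + i)
    cross-val δ w i lt = +-cancelʳ-≡ (c + 2 + (suc c + 2)) _ _ (begin
      g z + (2 ^ c + 2 ^ suc w) + (c + 2 + (suc c + 2)) ≡⟨ eq₁ (g z) (2 ^ c) (2 ^ suc w) c ⟩
      g z + (c + 2) + (2 ^ c + 2 ^ suc w) + (c + 3) ≡⟨ cong (λ u → u + (2 ^ c + 2 ^ suc w) + (c + 3)) (g-row c d 1≤c (<⇒≤ lt)) ⟩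
      2 ^ c + 2 ^ d + (2 ^ c + 2 ^ suc w) + (c + 3) ≡⟨ eq₂ (2 ^ c) (2 ^ d) (2 ^ suc w) c ⟩
      2 ^ suc c + 2 ^ suc w + 2 ^ d + (c + 3) ≡⟨ cong (λ u → u + 2 ^ d + (c + 3)) (sym (g-row (suc c) (suc w) (s≤s z≤n) w≤)) ⟩
      g (tri (suc c) + suc w) + (suc c + 2) + 2 ^ d + (c + 3) ≡⟨ cong (λ u → g u + (suc c + 2) + 2 ^ d + (c + 3)) eq₃ ⟩
      g (z + δ) + (suc c + 2) + 2 ^ d + (c + 3) ≡⟨ eq₄ (g (z + δ)) c (2 ^ d) ⟩
      g (z + δ) + 1 + 2 ^ d + (c + 2 + (suc c + 2)) ∎)
      where
      open ≡-Reasoning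
      c = δ + i
      d = suc w + i
      z = tri c + d
      1≤c = ≤-trans (s≤s z≤n) lt
      w≤ : suc w ≤ suc c
      w≤ = ≤-trans (m≤m+n (suc w) i) (≤-trans (<⇒≤ lt) (n≤1+n c))
      eq₁ : ∀ a b e c → a + (b + e) + (c + 2 + (suc c + 2)) ≡ a + (c + 2) + (b + e) + (c + 3)
      eq₁ = solve-∀
      eq₂ : ∀ a b e c → a + b + (a + e) + (c + 3) ≡ 2 * a + e + b + (c + 3)
      eq₂ = solve-∀
      eq₃ : tri c + c + suc w ≡ tri c + d + δ
      eq₃ = eq₅ (tri c) δ i w
        where
        eq₅ : ∀ t δ i w → t + (δ + i) + suc w ≡ t + (suc w + i) + δ
        eq₅ = solve-∀
      eq₄ : ∀ a c b → a + (suc c + 2) + b + (c + 3) ≡ a + 1 + b + (c + 2 + (suc c + 2))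
      eq₄ = solve-∀

  -- Deleting a vertex of degree δ with complete neighbourhood never beats the colex graph.
  g-gain : ∀ δ z → tri δ ≤ z → g z + 2 ^ δ ≤ g (z + δ) + 1
  g-gain δ z le with window δ z le
  ... | within-row c d d<c δ≤c p refl = by≤ 0
        (+-mono-≤ (≤-reflexive (stay-val c d δ d<c p)) (pow-convex 0 d δ z≤n))
        (eq (g z) (2 ^ δ) (g (z + δ)) (2 ^ (d + δ)) (2 ^ d))
    where
    eq : ∀ a b e u v → a + b + (e + v + (u + 1)) + 0 ≡ e + 1 + (a + u + (v + b))
    eq = solve-∀
  ... | next-row c w i refl lt refl = by≤ 0
        (+-mono-≤ (≤-reflexive (cross-val δ w i lt)) (pow-convex (suc w) δ i (<⇒≤ (+-cancelʳ-< i (suc w) δ lt))))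
        (eq (g z) (2 ^ δ) (g (z + δ)) (2 ^ c) (2 ^ suc w) (2 ^ (suc w + i)))
    where
    eq : ∀ a b e u v w → a + b + (e + 1 + w + (u + v)) + 0 ≡ e + 1 + (a + (u + v) + (b + w))
    eq = solve-∀

  -- Convexity is strict unless the window starts with a row, or starts inside row δ itself, where i
  -- = 0. For graphs the second possibility is refuted by `no-overflow`.
  g-gain-tight : ∀ δ z → 1 ≤ δ → tri δ ≤ z → g z + 2 ^ δ ≡ g (z + δ) + 1 →
    (∃[ c ] (z ≡ tri c × δ ≤ c × 1 ≤ c)) ⊎ (∃[ d ] (z ≡ tri δ + d × 1 ≤ d × d < δ))
  g-gain-tight δ z 1≤δ le tight with window δ z le
  ... | within-row c zero d<c δ≤c p refl = inj₁ (c , +-identityʳ _ , δ≤c , d<c)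
  ... | within-row c (suc d) d<c δ≤c p refl = ⊥-elim (<-irrefl tight (by≤ 0
        (+-mono-≤ (≤-reflexive (stay-val c (suc d) δ d<c p)) (pow-convex< 0 (suc d) δ (s≤s z≤n) 1≤δ))
        (eq (g z) (2 ^ δ) (g (z + δ)) (2 ^ (suc d + δ)) (2 ^ suc d))))
    where
    eq : ∀ a b e u v → suc (a + b) + (e + v + (u + 1)) + 0 ≡ e + 1 + (a + u + suc (v + b))
    eq = solve-∀
  ... | next-row c w zero refl lt refl rewrite +-identityʳ δ | +-identityʳ w = inj₂ (suc w , refl , s≤s z≤n , lt)
  ... | next-row c w (suc i) refl lt refl = ⊥-elim (<-irrefl tight (by≤ 0
        (+-mono-≤ (≤-reflexive (cross-val δ w (suc i) lt))
                  (pow-convex< (suc w) δ (suc i) (+-cancelʳ-< (suc i) (suc w) δ lt) (s≤s z≤n)))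
        (eq (g z) (2 ^ δ) (g (z + δ)) (2 ^ c) (2 ^ suc w) (2 ^ (suc w + suc i)))))
    where
    eq : ∀ a b e u v w → suc (a + b) + (e + 1 + w + (u + v)) + 0 ≡ e + 1 + (a + (u + v) + suc (b + w))
    eq = solve-∀

g-tri-suc : ∀ c → g (tri (suc c)) + 1 ≡ g (tri c) + 2 ^ c
g-tri-suc c = +-cancelʳ-≡ (c + 1) _ _ (begin
  g (tri (suc c)) + 1 + (c + 1) ≡⟨ eq (g (tri (suc c))) c ⟩
  g (tri (suc c)) + (suc c + 1) ≡⟨ g-tri (suc c) ⟩
  2 * 2 ^ c ≡⟨ cong (2 ^ c +_) (+-identityʳ _) ⟩
  2 ^ c + 2 ^ c ≡⟨ cong (_+ 2 ^ c) (sym (g-tri c)) ⟩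
  g (tri c) + (c + 1) + 2 ^ c ≡⟨ eq′ (g (tri c)) (c + 1) (2 ^ c) ⟩
  g (tri c) + 2 ^ c + (c + 1) ∎)
  where
  open ≡-Reasoning
  eq : ∀ u c → u + 1 + (c + 1) ≡ u + (suc c + 1)
  eq = solve-∀
  eq′ : ∀ u v w → u + v + w ≡ u + w + v
  eq′ = solve-∀

g-tri+ : ∀ c d → d ≤ c → g (tri c + d) + 1 ≡ g (tri c) + 2 ^ d
g-tri+ zero    zero z≤n = refl
g-tri+ (suc c) d le = +-cancelʳ-≡ (suc c + 1) _ _ (begin
  g (tri (suc c) + d) + 1 + (suc c + 1) ≡⟨ eq (g (tri (suc c) + d)) c ⟩
  g (tri (suc c) + d) + (suc c + 2) ≡⟨ g-row (suc c) d (s≤s z≤n) le ⟩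
  2 ^ suc c + 2 ^ d ≡⟨ cong (_+ 2 ^ d) (sym (g-tri (suc c))) ⟩
  g (tri (suc c)) + (suc c + 1) + 2 ^ d ≡⟨ eq′ (g (tri (suc c))) (suc c + 1) (2 ^ d) ⟩
  g (tri (suc c)) + 2 ^ d + (suc c + 1) ∎)
  where
  open ≡-Reasoning
  eq : ∀ u c → u + 1 + (suc c + 1) ≡ u + (suc c + 2)
  eq = solve-∀
  eq′ : ∀ u v w → u + v + w ≡ u + w + v
  eq′ = solve-∀

-- Build y up row by row. Adding d edges from the start of a row raises `g y` by exactly 2^d - 1,
-- and by `g-gain` adding them after x further edges raises the right side by at least as much.
g-super : ∀ x y → g x + g y ≤ g (x + y)
g-super x y with decompose y
... | c , d , d<c , refl = step (tri c) d (g-tri+ c d (<⇒≤ d<c)) (tri-mono (<⇒≤ d<c)) (rows c)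
  where
  step : ∀ u δ → g (u + δ) + 1 ≡ g u + 2 ^ δ → tri δ ≤ u →
         g x + g u ≤ g (x + u) → g x + g (u + δ) ≤ g (x + (u + δ))
  step u δ eq le ih = subst (λ i → g x + g (u + δ) ≤ g i) (+-assoc x u δ) (by≤ 0
      (+-mono-≤ (+-mono-≤ ih (≤-reflexive eq)) (g-gain δ (x + u) (≤-trans le (m≤n+m u x))))
      (lem (g x) (g (u + δ)) (g u) (g (x + u)) (g (x + u + δ)) (2 ^ δ)))
    where
    lem : ∀ a b c d e p → a + b + (d + (c + p) + (e + 1)) + 0 ≡ e + (a + c + (b + 1) + (d + p))
    lem = solve-∀
  rows : ∀ c → g x + g (tri c) ≤ g (x + tri c)
  rows zero    rewrite g-0 | +-identityʳ x = ≤-reflexive (+-identityʳ (g x))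
  rows (suc c) = step (tri c) c (g-tri-suc c) ≤-refl (rows c)

g-mono : ∀ {x y} → x ≤ y → g x ≤ g y
g-mono {x} {y} le = begin
  g x ≤⟨ m≤m+n (g x) (g (y ∸ x)) ⟩
  g x + g (y ∸ x) ≤⟨ g-super x (y ∸ x) ⟩
  g (x + (y ∸ x)) ≡⟨ cong g (m+[n∸m]≡n le) ⟩
  g y ∎
  where open ≤-Reasoning

-- Gains over windows of consecutive edges below `tri (suc r)`

top-window : ∀ r k j z → k + j ≡ r → z + k ≡ tri (suc r) → g (tri (suc r)) + 2 ^ j ≡ g z + 2 ^ r
top-window r k j z refl eq = +-cancelʳ-≡ 1 _ _ (begin
  g (tri (suc r)) + 2 ^ j + 1 ≡⟨ lem (g (tri (suc r))) (2 ^ j) ⟩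
  g (tri (suc r)) + 1 + 2 ^ j ≡⟨ cong (_+ 2 ^ j) (g-tri-suc r) ⟩
  g (tri r) + 2 ^ r + 2 ^ j ≡⟨ lem′ (g (tri r)) (2 ^ r) (2 ^ j) ⟩
  g (tri r) + 2 ^ j + 2 ^ r ≡⟨ cong (_+ 2 ^ r) (sym (g-tri+ r j (m≤n+m j k))) ⟩
  g (tri r + j) + 1 + 2 ^ r ≡⟨ lem (g (tri r + j)) (2 ^ r) ⟨
  g (tri r + j) + 2 ^ r + 1 ≡⟨ cong (λ i → g i + 2 ^ r + 1) z≡ ⟩
  g z + 2 ^ r + 1 ∎)
  where
  open ≡-Reasoning
  lem : ∀ u v → u + v + 1 ≡ u + 1 + v
  lem = solve-∀
  lem′ : ∀ u v w → u + v + w ≡ u + w + v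
  lem′ = solve-∀
  z≡ : tri r + j ≡ z
  z≡ = +-cancelʳ-≡ k _ _ (trans (lem″ (tri r) j k) (sym eq))
    where
    lem″ : ∀ t j k → t + j + k ≡ t + (k + j)
    lem″ = solve-∀

-- Among the windows of k ≤ r consecutive edges below tri (suc r), the top one gains most.
window<top : ∀ r k j z → k + j ≡ r → 1 ≤ k → z + k < tri (suc r) → g (z + k) + 2 ^ j < g z + 2 ^ r
window≤top : ∀ r k j z → k + j ≡ r → z + k ≤ tri (suc r) → g (z + k) + 2 ^ j ≤ g z + 2 ^ r

window≤top r zero j z refl le = ≤-reflexive (cong (λ i → g i + 2 ^ j) (+-identityʳ z))
window≤top r (suc k) j z eq le with m≤n⇒m<n∨m≡n le
... | inj₁ lt = <⇒≤ (window<top r (suc k) j z eq (s≤s z≤n) lt)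
... | inj₂ e  = ≤-reflexive (trans (cong (λ i → g i + 2 ^ j) e) (top-window r (suc k) j z eq e))

window<top zero (suc k) j z () 1≤k lt
window<top (suc r) k j z k+j 1≤k lt with z + k ≤? tri (suc r)
-- The last row is not reached. With r and j both one smaller the gain is at most 2^r - 2^j, which
-- is less than its double because j < r.
window<top (suc r) k (suc j) z k+j 1≤k lt | yes le = by≤ 0
  (+-mono-≤ (window≤top r k j z k+j′ le) (^-monoʳ-< 2 (s≤s (s≤s z≤n)) j<r))
  (lem (g (z + k)) (g z) (2 ^ j) (2 ^ r))
  where
  k+j′ : k + j ≡ r
  k+j′ = suc-injective (trans (sym (+-suc k j)) k+j)
  j<r : j < r
  j<r = subst (j <_) k+j′ (+-monoˡ-≤ j 1≤k)
  lem : ∀ a b u v → suc (a + 2 * u) + (b + v + v) + 0 ≡ b + 2 * v + (a + u + suc u)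
  lem = solve-∀
window<top (suc r) k zero z k+j 1≤k lt | yes le rewrite +-identityʳ k with k+j
window<top (suc zero) .1 zero z k+j 1≤k lt | yes le | refl = ⊥-elim (1+n≰n (≤-trans (m≤n+m 1 z) le))
-- The window is as long as the last row but does not reach it. Cut after its first edge, it gains
-- at most 2^r and 2^(r+1) - 1 on the two parts.
window<top (suc (suc r)) .(suc (suc r)) zero z k+j 1≤k lt | yes le | refl = by≤ 0
  (+-mono-≤ (+-mono-≤ (window≤top (suc r) (suc r) 0 (z + 1) (+-identityʳ _) (≤-trans (≤-reflexive eq) le))
                      (window≤top (suc r) 1 r z refl z+1≤))
            (1≤2^ r))
  (subst (λ i → suc (g i + 1) + (g (z + 1) + 2 ^ suc r + (g z + 2 ^ suc r) + 2 ^ r) + 0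
                ≡ g z + 2 ^ suc (suc r) + (g (z + 1 + suc r) + 1 + (g (z + 1) + 2 ^ r) + 1)) eq
    (lem (g (z + 1 + suc r)) (g (z + 1)) (g z) (2 ^ r)))
  where
  eq : z + 1 + suc r ≡ z + suc (suc r)
  eq = +-assoc z 1 (suc r)
  z+1≤ : z + 1 ≤ tri (suc (suc r))
  z+1≤ = ≤-trans (+-monoʳ-≤ z (s≤s z≤n)) le
  lem : ∀ a b c u → suc (a + 1) + (b + 2 * u + (c + 2 * u) + u) + 0 ≡ c + 2 * (2 * u) + (a + 1 + (b + u) + 1)
  lem = solve-∀
window<top (suc r) k j z k+j 1≤k lt | no ¬le = go (tri (suc r)) refl
  where
  d = z + k ∸ tri (suc r)
  z+k : tri (suc r) + d ≡ z + k
  z+k = m+[n∸m]≡n (<⇒≤ (≰⇒> ¬le))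
  1≤d : 1 ≤ d
  1≤d = m<n⇒0<n∸m (≰⇒> ¬le)
  d<r : d < suc r
  d<r = +-cancelˡ-< (tri (suc r)) d (suc r) (subst (_< tri (suc r) + suc r) (sym z+k) lt)
  -- The window lies within the last row, from position w < j, so `pow-convex<` compares it with the
  -- one ending the row.
  inside : ∀ w → w + k ≡ d → g (z + k) + 2 ^ j < g z + 2 ^ suc r
  inside w w+k = by≤ 0
    (+-mono-≤ (≤-reflexive val) (pow-convex< w j k w<j 1≤k))
    (subst₂ (λ A B → suc (g (z + k) + 2 ^ j) + (g z + 2 ^ (w + k) + (A + 2 ^ w)) + 0
                    ≡ g z + B + (g (z + k) + 2 ^ w + suc (2 ^ j + 2 ^ (w + k))))
            refl (cong (2 ^_) (trans (+-comm j k) k+j))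
            (lem (g (z + k)) (g z) (2 ^ j) (2 ^ (w + k)) (2 ^ (j + k)) (2 ^ w)))
    where
    w<j : w < j
    w<j = +-cancelʳ-< k w j (subst₂ _<_ (sym w+k) (trans (sym k+j) (+-comm k j)) d<r)
    z≡ : tri (suc r) + w ≡ z
    z≡ = +-cancelʳ-≡ k _ _ (trans (+-assoc (tri (suc r)) w k) (trans (cong (tri (suc r) +_) w+k) z+k))
    val : g (z + k) + 2 ^ w ≡ g z + 2 ^ (w + k)
    val = +-cancelʳ-≡ 1 _ _ (begin
      g (z + k) + 2 ^ w + 1 ≡⟨ lem₁ (g (z + k)) (2 ^ w) ⟩
      g (z + k) + 1 + 2 ^ w ≡⟨ cong (λ i → g i + 1 + 2 ^ w) (sym z+k) ⟩
      g (tri (suc r) + d) + 1 + 2 ^ w ≡⟨ cong (_+ 2 ^ w) (g-tri+ (suc r) d (<⇒≤ d<r)) ⟩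
      g (tri (suc r)) + 2 ^ d + 2 ^ w ≡⟨ lem₂ (g (tri (suc r))) (2 ^ d) (2 ^ w) ⟩
      g (tri (suc r)) + 2 ^ w + 2 ^ d ≡⟨ cong (_+ 2 ^ d) (sym (g-tri+ (suc r) w (≤-trans (m≤m+n w k) (≤-trans (≤-reflexive w+k) (<⇒≤ d<r))))) ⟩
      g (tri (suc r) + w) + 1 + 2 ^ d ≡⟨ cong₂ (λ i j → g i + 1 + 2 ^ j) z≡ (sym w+k) ⟩
      g z + 1 + 2 ^ (w + k) ≡⟨ lem₁ (g z) (2 ^ (w + k)) ⟨
      g z + 2 ^ (w + k) + 1 ∎)
      where
      open ≡-Reasoning
      lem₁ : ∀ u v → u + v + 1 ≡ u + 1 + v
      lem₁ = solve-∀
      lem₂ : ∀ u v w → u + v + w ≡ u + w + v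
      lem₂ = solve-∀
    lem : ∀ a b u v s t → suc (a + u) + (b + v + (s + t)) + 0 ≡ b + s + (a + t + suc (u + v))
    lem = solve-∀
  -- The window takes the last k′ edges of the previous row and the first d of the last one; with d
  -- = suc d′ it gains (2^r - 2^(d′+j)) + (2^d - 1).
  outside : ∀ k′ → k′ + d ≡ k → g (z + k) + 2 ^ j < g z + 2 ^ suc r
  outside k′ k′+d with d | 1≤d | z+k | d<r | k′+d
  ... | suc d′ | _ | z+k₁ | s≤s d′<r | refl = by≤ 0
    (+-mono-≤ (+-mono-≤ (≤-reflexive val₁) (≤-reflexive val₂))
      (+-mono-≤ (cross≤ {1} {2 ^ d′} {2 ^ j} (1≤2^ d′) (1≤2^ j)) (^-monoʳ-< 2 (s≤s (s≤s z≤n)) d′<r)))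
    (subst (λ i → suc (g (z + k) + 2 ^ j) + (g (tri (suc r)) + 2 ^ suc d′ + (g z + 2 ^ r) + (2 ^ d′ * 2 ^ j + 1 + 2 ^ r)) + 0
                ≡ g z + 2 ^ suc r + (g (z + k) + 1 + (g (tri (suc r)) + i) + (2 ^ d′ + 1 * 2 ^ j + suc (2 ^ d′))))
       (sym (^-distribˡ-+-* 2 d′ j))
       (lem (g (z + k)) (g z) (g (tri (suc r))) (2 ^ j) (2 ^ r) (2 ^ d′)))
    where
    val₁ : g (z + k) + 1 ≡ g (tri (suc r)) + 2 ^ suc d′
    val₁ = trans (cong (λ i → g i + 1) (sym z+k₁)) (g-tri+ (suc r) (suc d′) (s≤s (<⇒≤ d′<r)))
    k′+ : k′ + (d′ + j) ≡ r
    k′+ = suc-injective (trans (lem₁ k′ d′ j) k+j)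
      where
      lem₁ : ∀ k d j → suc (k + (d + j)) ≡ k + suc d + j
      lem₁ = solve-∀
    z+k′ : z + k′ ≡ tri (suc r)
    z+k′ = +-cancelʳ-≡ (suc d′) _ _ (trans (+-assoc z k′ (suc d′)) (sym z+k₁))
    val₂ : g (tri (suc r)) + 2 ^ (d′ + j) ≡ g z + 2 ^ r
    val₂ = top-window r k′ (d′ + j) z k′+ z+k′
    lem : ∀ a b c u v w → suc (a + u) + (c + 2 * w + (b + v) + (w * u + 1 + v)) + 0
                        ≡ b + 2 * v + (a + 1 + (c + w * u) + (w + 1 * u + suc w))
    lem = solve-∀
  go : ∀ t → t ≡ tri (suc r) → g (z + k) + 2 ^ j < g z + 2 ^ suc r
  go t _ with k ≤? d
  ... | yes k≤d = inside (d ∸ k) (m∸n+n≡m k≤d)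
  ... | no  k≰d = outside (k ∸ d) (m∸n+n≡m (<⇒≤ (≰⇒> k≰d)))

-- Among all windows of k edges below N the top one gains most, now for k of any size: a long window
-- has its last r edges compared with the last row by `window≤top`, and what remains is treated one
-- row lower.
wrap≤ : ∀ r k z y → z + k ≤ tri (suc r) → y + k ≡ tri (suc r) → g (z + k) + g y ≤ g z + g (tri (suc r))
wrap< : ∀ r k z y → 1 ≤ k → z + k < tri (suc r) → y + k ≡ tri (suc r) → g (z + k) + g y < g z + g (tri (suc r))

private
  split-rows : ∀ r k z y → ¬ k ≤ suc r → z + k ≤ tri (suc (suc r)) → y + k ≡ tri (suc (suc r)) →
    ∃[ k′ ] (k ≡ k′ + suc r × z + k′ ≤ tri (suc r) × y + k′ ≡ tri (suc r))
  split-rows r k z y k≰ le eq = k′ , k≡ ,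
      +-cancelʳ-≤ (suc r) _ _ (≤-trans (≤-reflexive (trans (+-assoc z k′ (suc r)) (cong (z +_) (sym k≡)))) le) ,
      +-cancelʳ-≡ (suc r) _ _ (trans (+-assoc y k′ (suc r)) (trans (cong (y +_) (sym k≡)) eq))
    where
    k′ = k ∸ suc r
    k≡ : k ≡ k′ + suc r
    k≡ = sym (m∸n+n≡m (<⇒≤ (≰⇒> k≰)))

wrap≤ r k z y le eq with k ≤? r
wrap≤ r k z y le eq | yes k≤r = by≤ 0
    (+-mono-≤ (window≤top r k (r ∸ k) z (m+[n∸m]≡n k≤r) le)
              (≤-reflexive (sym (top-window r k (r ∸ k) y (m+[n∸m]≡n k≤r) eq))))
    (lem (g (z + k)) (g y) (g z) (g (tri (suc r))) (2 ^ r) (2 ^ (r ∸ k)))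
  where
  lem : ∀ a b c d u v → a + b + (c + u + (d + v)) + 0 ≡ c + d + (a + v + (b + u))
  lem = solve-∀
wrap≤ zero k z y le eq | no k≰r = ⊥-elim (k≰r (≤-trans (m≤n+m k y) (≤-reflexive eq)))
wrap≤ (suc r) k z y le eq | no k≰r with split-rows r k z y k≰r le eq
... | k′ , refl , le′ , eq′ = by≤ 0
    (+-mono-≤ (+-mono-≤ (window≤top (suc r) (suc r) 0 (z + k′) (+-identityʳ _)
                (≤-trans (≤-reflexive (+-assoc z k′ (suc r))) le)) (wrap≤ r k′ z y le′ eq′))
              (≤-reflexive (sym (g-tri-suc (suc r)))))
    (subst (λ i → g i + g y + (g (z + k′) + 2 ^ suc r + (g z + g (tri (suc r))) + (g (tri (suc (suc r))) + 1)) + 0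
            ≡ g z + g (tri (suc (suc r))) + (g (z + k′ + suc r) + 1 + (g (z + k′) + g y) + (g (tri (suc r)) + 2 ^ suc r)))
      (+-assoc z k′ (suc r))
      (lem (g (z + k′ + suc r)) (g y) (g (z + k′)) (g z) (g (tri (suc r))) (g (tri (suc (suc r)))) (2 ^ suc r)))
  where
  lem : ∀ a b c d e f u → a + b + (c + u + (d + e) + (f + 1)) + 0 ≡ d + f + (a + 1 + (c + b) + (e + u))
  lem = solve-∀

wrap< r k z y 1≤k lt eq with k ≤? r
wrap< r k z y 1≤k lt eq | yes k≤r = by≤ 0
    (+-mono-≤ (window<top r k (r ∸ k) z (m+[n∸m]≡n k≤r) 1≤k lt)
              (≤-reflexive (sym (top-window r k (r ∸ k) y (m+[n∸m]≡n k≤r) eq))))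
    (lem (g (z + k)) (g y) (g z) (g (tri (suc r))) (2 ^ r) (2 ^ (r ∸ k)))
  where
  lem : ∀ a b c d u v → suc (a + b) + (c + u + (d + v)) + 0 ≡ c + d + (suc (a + v) + (b + u))
  lem = solve-∀
wrap< zero k z y 1≤k lt eq | no k≰r = ⊥-elim (k≰r (≤-trans (m≤n+m k y) (≤-reflexive eq)))
wrap< (suc r) k z y 1≤k lt eq | no k≰r with split-rows r k z y k≰r (<⇒≤ lt) eq
... | k′ , refl , le′ , eq′ = by≤ 0
    (+-mono-≤ (+-mono-≤ (window<top (suc r) (suc r) 0 (z + k′) (+-identityʳ _) (s≤s z≤n)
                (≤-trans (≤-reflexive (cong suc (+-assoc z k′ (suc r)))) lt)) (wrap≤ r k′ z y le′ eq′))
              (≤-reflexive (sym (g-tri-suc (suc r)))))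
    (subst (λ i → suc (g i + g y) + (g (z + k′) + 2 ^ suc r + (g z + g (tri (suc r))) + (g (tri (suc (suc r))) + 1)) + 0
            ≡ g z + g (tri (suc (suc r))) + (suc (g (z + k′ + suc r) + 1) + (g (z + k′) + g y) + (g (tri (suc r)) + 2 ^ suc r)))
      (+-assoc z k′ (suc r))
      (lem (g (z + k′ + suc r)) (g y) (g (z + k′)) (g z) (g (tri (suc r))) (g (tri (suc (suc r)))) (2 ^ suc r)))
  where
  lem : ∀ a b c d e f u → suc (a + b) + (c + u + (d + e) + (f + 1)) + 0 ≡ d + f + (suc (a + 1) + (c + b) + (e + u))
  lem = solve-∀

-- Superadditivity of the bound when edges are counted modulo N

divide : ∀ N → 1 ≤ N → ∀ m → ∃[ a ] ∃[ b ] (m ≡ a * N + b × b < N)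
divide N 1≤N zero = 0 , 0 , refl , 1≤N
divide N 1≤N (suc m) with divide N 1≤N m
... | a , b , refl , b<N with suc b ≟ N
...   | yes refl = suc a , 0 , lem a b , s≤s z≤n
  where
  lem : ∀ a b → suc (a * suc b + b) ≡ suc a * suc b + 0
  lem = solve-∀
...   | no b≢ = a , suc b , sym (+-suc (a * N) b) , ≤∧≢⇒< b<N b≢

divide-unique : ∀ N a b a′ b′ → b < N → b′ < N → a * N + b ≡ a′ * N + b′ → a ≡ a′ × b ≡ b′
divide-unique N zero b zero b′ b<N b′<N eq = refl , eq
divide-unique N zero b (suc a′) b′ b<N b′<N refl =
  ⊥-elim (<-irrefl refl (≤-trans b<N (≤-trans (m≤m+n N (a′ * N)) (m≤m+n _ b′))))
divide-unique N (suc a) b zero b′ b<N b′<N refl =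
  ⊥-elim (<-irrefl refl (≤-trans b′<N (≤-trans (m≤m+n N (a * N)) (m≤m+n _ b))))
divide-unique N (suc a) b (suc a′) b′ b<N b′<N eq
  with divide-unique N a b a′ b′ b<N b′<N
         (+-cancelˡ-≡ N _ _ (trans (sym (+-assoc N (a * N) b)) (trans eq (+-assoc N (a′ * N) b′))))
... | refl , refl = refl , refl

module _ (r : ℕ) where
  private N = tri (suc r)

  -- If b′ + e reaches N, then b = b′ + e - N. The window from b to b′ and the top window from e to
  -- N both have N - e edges, so `wrap≤` gives g b′ + g e ≤ g b + g N.
  extremal-super : ∀ a b a′ b′ e → b < N → b′ < N → e ≤ N → a′ * N + b′ + e ≡ a * N + b →
    a′ * g N + g b′ + g e ≤ a * g N + g b
  extremal-super a b a′ b′ e b<N b′<N e≤N eq with b′ + e <? N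
  ... | yes lt with divide-unique N a′ (b′ + e) a b lt b<N (trans (sym (+-assoc _ b′ e)) eq)
  ...   | refl , refl = ≤-trans (≤-reflexive (+-assoc (a * g N) (g b′) (g e))) (+-monoʳ-≤ (a * g N) (g-super b′ e))
  extremal-super a b a′ b′ e b<N b′<N e≤N eq | no ge
    with divide-unique N (suc a′) s a b s<N b<N (trans lem (trans (sym (+-assoc (a′ * N) b′ e)) eq))
    where
    s = b′ + e ∸ N
    s+N : N + s ≡ b′ + e
    s+N = m+[n∸m]≡n (≮⇒≥ ge)
    s<N : s < N
    s<N = +-cancelˡ-< N s N (subst (_< N + N) (sym s+N) (+-mono-<-≤ b′<N e≤N))
    lem : N + a′ * N + s ≡ a′ * N + (b′ + e)
    lem = trans (cong (_+ s) (+-comm N (a′ * N))) (trans (+-assoc (a′ * N) N s) (cong (a′ * N +_) s+N))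
  ... | refl , refl = by≤ 0
        (subst₂ (λ i j → i ≤ j) (cong (λ i → g i + g e) b+k) refl (wrap≤ r (N ∸ e) b e b+k≤ (m+[n∸m]≡n e≤N)))
        (lem (a′ * g N) (g b′) (g e) (g b) (g N))
    where
    b+k : b + (N ∸ e) ≡ b′
    b+k = +-cancelʳ-≡ e _ _ (trans (+-assoc b (N ∸ e) e) (trans (cong (b +_) (m∸n+n≡m e≤N))
          (trans (+-comm b N) (m+[n∸m]≡n (≮⇒≥ ge)))))
    b+k≤ : b + (N ∸ e) ≤ N
    b+k≤ = ≤-trans (≤-reflexive b+k) (<⇒≤ b′<N)
    lem : ∀ a b e s n → a + b + e + (s + n) + 0 ≡ n + a + s + (b + e)
    lem = solve-∀

  -- As m and e are below N, the quotient is 1; the window from b to m ends below N, hence is not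
  -- the top one.
  extremal-super< : ∀ a b m e → b < N → m < N → e < N → 1 ≤ a → m + e ≡ a * N + b →
    g m + g e < a * g N + g b
  extremal-super< (suc a) b m e b<N m<N e<N 1≤a eq with a
  ... | suc a′ = ⊥-elim (<-irrefl eq (≤-trans (+-mono-< m<N e<N)
                  (≤-trans (+-monoʳ-≤ N (m≤m+n N (a′ * N))) (m≤m+n _ b))))
  ... | zero = by≤ 0 (subst (λ i → g i + g e < g b + g N) b+k
                 (wrap< r (N ∸ e) b e (m<n⇒0<n∸m e<N) (subst (_< N) (sym b+k) m<N) (m+[n∸m]≡n (<⇒≤ e<N))))
                 (lem (g m) (g e) (g b) (g N))
    where
    eq′ : m + e ≡ N + b
    eq′ = trans eq (cong (_+ b) (+-identityʳ N))
    b+k : b + (N ∸ e) ≡ m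
    b+k = +-cancelʳ-≡ e _ _ (trans (+-assoc b (N ∸ e) e) (trans (cong (b +_) (m∸n+n≡m (<⇒≤ e<N)))
          (trans (+-comm b N) (sym eq′))))
    lem : ∀ m e b n → suc (m + e) + (b + n) + 0 ≡ n + 0 + b + suc (m + e)
    lem = solve-∀

-- Sums and lists

b2n : Bool → ℕ
b2n true  = 1
b2n false = 0

∑ : {A : Set} → (A → ℕ) → List A → ℕ
∑ f []      = 0
∑ f (v ∷ L) = f v + ∑ f L

module _ {A : Set} where
  ∑-cong : ∀ {f h : A → ℕ} L → (∀ v → f v ≡ h v) → ∑ f L ≡ ∑ h L
  ∑-cong []      eq = refl
  ∑-cong (v ∷ L) eq = cong₂ _+_ (eq v) (∑-cong L eq)

  ∑-mono : ∀ {f h : A → ℕ} L → All (λ v → f v ≤ h v) L → ∑ f L ≤ ∑ h L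
  ∑-mono []      []         = z≤n
  ∑-mono (v ∷ L) (le ∷ les) = +-mono-≤ le (∑-mono L les)

  ∑-+ : ∀ (f h : A → ℕ) L → ∑ (λ v → f v + h v) L ≡ ∑ f L + ∑ h L
  ∑-+ f h []      = refl
  ∑-+ f h (v ∷ L) = trans (cong (f v + h v +_) (∑-+ f h L)) (eq (f v) (h v) (∑ f L) (∑ h L))
    where
    eq : ∀ a b c d → a + b + (c + d) ≡ a + c + (b + d)
    eq = solve-∀

  ∑-*ˡ : ∀ k (f : A → ℕ) L → ∑ (λ v → k * f v) L ≡ k * ∑ f L
  ∑-*ˡ k f []      = sym (*-zeroʳ k)
  ∑-*ˡ k f (v ∷ L) = trans (cong (k * f v +_) (∑-*ˡ k f L)) (sym (*-distribˡ-+ k (f v) (∑ f L)))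

  ∑-0 : ∀ L → ∑ (λ (_ : A) → 0) L ≡ 0
  ∑-0 []      = refl
  ∑-0 (_ ∷ L) = ∑-0 L

  ∑-const : ∀ k (L : List A) → ∑ (λ _ → k) L ≡ length L * k
  ∑-const k []      = refl
  ∑-const k (_ ∷ L) = cong (k +_) (∑-const k L)

  ∑-++ : ∀ (f : A → ℕ) L M → ∑ f (L ++ M) ≡ ∑ f L + ∑ f M
  ∑-++ f []      M = refl
  ∑-++ f (v ∷ L) M = trans (cong (f v +_) (∑-++ f L M)) (sym (+-assoc (f v) _ _))

  ∑-exchange : ∀ (F : A → A → ℕ) L M → ∑ (λ v → ∑ (F v) M) L ≡ ∑ (λ u → ∑ (λ v → F v u) L) M
  ∑-exchange F []      M = sym (∑-0 M)
  ∑-exchange F (v ∷ L) M = trans (cong (∑ (F v) M +_) (∑-exchange F L M)) (sym (∑-+ (F v) (λ u → ∑ (λ v → F v u) L) M))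

  ∑-↭ : ∀ (f : A → ℕ) {L M} → L ↭ M → ∑ f L ≡ ∑ f M
  ∑-↭ f Perm.refl = refl
  ∑-↭ f (prep x p) = cong (f x +_) (∑-↭ f p)
  ∑-↭ f (swap x y p) = trans (cong (λ s → f x + (f y + s)) (∑-↭ f p)) (eq (f x) (f y) _)
    where
    eq : ∀ a b c → a + (b + c) ≡ b + (a + c)
    eq = solve-∀
  ∑-↭ f (Perm.trans p q) = trans (∑-↭ f p) (∑-↭ f q)

  ∈-split : ∀ {x : A} {L} → x ∈ L → ∃[ M ] (L ↭ x ∷ M)
  ∈-split {L = _ ∷ L} (here refl) = L , ↭-refl
  ∈-split {L = y ∷ L} (there p) with ∈-split p
  ... | M , q = y ∷ M , ↭-trans (prep y q) (swap y _ ↭-refl)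

  pigeonhole : ∀ (f h : A → ℕ) v L → ∑ f (v ∷ L) ≤ ∑ h (v ∷ L) → ∃[ u ] (u ∈ v ∷ L × f u ≤ h u)
  pigeonhole f h v L le with f v ≤? h v
  ... | yes p = v , here refl , p
  pigeonhole f h v [] le | no ¬p = ⊥-elim (¬p (subst₂ _≤_ (+-identityʳ _) (+-identityʳ _) le))
  pigeonhole f h v (w ∷ L) le | no ¬p with pigeonhole f h w L (+-cancelˡ-≤ (h v) _ _
      (≤-trans (+-monoˡ-≤ (∑ f (w ∷ L)) (<⇒≤ (≰⇒> ¬p))) le))
  ... | u , u∈ , fu = u , there u∈ , fu

  filterᵇ-filterᵇ : ∀ (p q : A → Bool) L → filterᵇ p (filterᵇ q L) ≡ filterᵇ (λ u → q u ∧ p u) L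
  filterᵇ-filterᵇ p q [] = refl
  filterᵇ-filterᵇ p q (v ∷ L) with q v
  ... | false = filterᵇ-filterᵇ p q L
  ... | true with p v
  ...   | true  = cong (v ∷_) (filterᵇ-filterᵇ p q L)
  ...   | false = filterᵇ-filterᵇ p q L

  filterᵇ-++ : ∀ (p : A → Bool) L M → filterᵇ p (L ++ M) ≡ filterᵇ p L ++ filterᵇ p M
  filterᵇ-++ p [] M = refl
  filterᵇ-++ p (v ∷ L) M with p v
  ... | true  = cong (v ∷_) (filterᵇ-++ p L M)
  ... | false = filterᵇ-++ p L M

  filterᵇ-all : ∀ (p : A → Bool) {L} → All (λ v → p v ≡ true) L → filterᵇ p L ≡ L
  filterᵇ-all p [] = refl
  filterᵇ-all p (_∷_ {x = v} eq eqs) rewrite eq = cong (v ∷_) (filterᵇ-all p eqs)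

  filterᵇ-none : ∀ (p : A → Bool) {L} → All (λ v → p v ≡ false) L → filterᵇ p L ≡ []
  filterᵇ-none p [] = refl
  filterᵇ-none p (eq ∷ eqs) rewrite eq = filterᵇ-none p eqs

  filterᵇ-true : ∀ (p : A → Bool) L → All (λ v → p v ≡ true) (filterᵇ p L)
  filterᵇ-true p [] = []
  filterᵇ-true p (v ∷ L) with p v in eq
  ... | true  = eq ∷ filterᵇ-true p L
  ... | false = filterᵇ-true p L

  filterᵇ-split : ∀ (p : A → Bool) L → L ↭ filterᵇ p L ++ filterᵇ (not ∘ p) L
  filterᵇ-split p [] = ↭-refl
  filterᵇ-split p (v ∷ L) with p v
  ... | true  = prep v (filterᵇ-split p L)
  ... | false = ↭-trans (prep v (filterᵇ-split p L)) (↭-sym (shift v (filterᵇ p L) _))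

  length-filterᵇ : ∀ (p : A → Bool) L → length (filterᵇ p L) ≤ length L
  length-filterᵇ p [] = z≤n
  length-filterᵇ p (v ∷ L) with p v
  ... | true  = s≤s (length-filterᵇ p L)
  ... | false = m≤n⇒m≤1+n (length-filterᵇ p L)

  All-filterᵇ : ∀ {P : A → Set} (p : A → Bool) {L} → All P L → All P (filterᵇ p L)
  All-filterᵇ p [] = []
  All-filterᵇ p (_∷_ {x = v} pv ps) with p v
  ... | true  = pv ∷ All-filterᵇ p ps
  ... | false = All-filterᵇ p ps

module _ {A : Set} where
  AllPairs-↭ : ∀ {R : A → A → Set} → (∀ {u v} → R u v → R v u) → ∀ {L M} → L ↭ M → AllPairs R L → AllPairs R M
  AllPairs-↭ s Perm.refl ap = ap
  AllPairs-↭ s (prep x q) (px ∷ ap) = All-resp-↭ q px ∷ AllPairs-↭ s q ap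
  AllPairs-↭ s (swap x y q) ((xy ∷ px) ∷ (py ∷ ap)) =
    (s xy ∷ All-resp-↭ q py) ∷ (All-resp-↭ q px ∷ AllPairs-↭ s q ap)
  AllPairs-↭ s (Perm.trans q q′) ap = AllPairs-↭ s q′ (AllPairs-↭ s q ap)

  AllPairs-++⁻ : ∀ {R : A → A → Set} L {M} → AllPairs R (L ++ M) →
    AllPairs R L × AllPairs R M × All (λ u → All (R u) M) L
  AllPairs-++⁻ [] ap = [] , ap , []
  AllPairs-++⁻ (x ∷ L) (px ∷ ap) with AllPairs-++⁻ L ap
  ... | l , m , c = ++⁻ˡ L px ∷ l , m , ++⁻ʳ L px ∷ c

  AllPairs-++⁺ : ∀ {R : A → A → Set} {L M} → AllPairs R L → AllPairs R M → All (λ u → All (R u) M) L →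
    AllPairs R (L ++ M)
  AllPairs-++⁺ [] m [] = m
  AllPairs-++⁺ (px ∷ l) m (c ∷ cs) = ++⁺ px c ∷ AllPairs-++⁺ l m cs

  module _ (f : A → ℕ) where
    Ascending : List A → Set
    Ascending = AllPairs (λ u v → f u ≤ f v)

    insert : ∀ x L → Ascending L → ∃[ M ] (x ∷ L ↭ M × Ascending M)
    insert x [] [] = x ∷ [] , ↭-refl , [] ∷ []
    insert x (y ∷ L) (py ∷ ap) with f x ≤? f y
    ... | yes le = x ∷ y ∷ L , ↭-refl , (le ∷ All.map (≤-trans le) py) ∷ py ∷ ap
    ... | no ¬le with insert x L ap
    ...   | M , q , am = y ∷ M , ↭-trans (swap x y ↭-refl) (prep y q) ,
              All-resp-↭ q (<⇒≤ (≰⇒> ¬le) ∷ py) ∷ am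

    sort : ∀ L → ∃[ M ] (L ↭ M × Ascending M)
    sort [] = [] , ↭-refl , []
    sort (x ∷ L) with sort L
    ... | M , q , am with insert x M am
    ...   | M′ , q′ , am′ = M′ , ↭-trans (prep x q) q′ , am′

  filterᵇ-full : ∀ (p : A → Bool) L → length L ≤ length (filterᵇ p L) → All (λ v → p v ≡ true) L
  filterᵇ-full p [] le = []
  filterᵇ-full p (v ∷ L) le with p v in eq
  ... | true  = eq ∷ filterᵇ-full p L (s≤s⁻¹ le)
  ... | false = ⊥-elim (1+n≰n (≤-trans le (length-filterᵇ p L)))

module _ {A : Set} where
  filterᵇ-false : ∀ (p : A → Bool) L → All (λ v → p v ≡ false) (filterᵇ (not ∘ p) L)
  filterᵇ-false p [] = []
  filterᵇ-false p (v ∷ L) with p v in eq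
  ... | true  = filterᵇ-false p L
  ... | false = eq ∷ filterᵇ-false p L

  filterᵇ-↭ : ∀ (p : A → Bool) {L M} → L ↭ M → filterᵇ p L ↭ filterᵇ p M
  filterᵇ-↭ p = filter-↭ (T? ∘ p)

  -- Graphs may have isolated vertices, so the minimum is taken over the positive values only.
  min-positive : ∀ (f : A → ℕ) L → All (λ v → f v ≡ 0) L ⊎
    (∃[ v ] (v ∈ L × 1 ≤ f v × All (λ u → f u ≡ 0 ⊎ f v ≤ f u) L))
  min-positive f [] = inj₁ []
  min-positive f (x ∷ L) with f x in eq | min-positive f L
  ... | zero  | inj₁ all = inj₁ (eq ∷ all)
  ... | suc m | inj₁ all = inj₂ (x , here refl , subst (1 ≤_) (sym eq) (s≤s z≤n) , inj₂ ≤-refl ∷ All.map inj₁ all)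
  ... | zero  | inj₂ (v , v∈ , 1≤ , all) = inj₂ (v , there v∈ , 1≤ , inj₁ eq ∷ all)
  ... | suc m | inj₂ (v , v∈ , 1≤ , all) with f v ≤? f x
  ...   | yes le = inj₂ (v , there v∈ , 1≤ , inj₂ le ∷ all)
  ...   | no ¬le = inj₂ (x , here refl , subst (1 ≤_) (sym eq) (s≤s z≤n) , inj₂ ≤-refl ∷ All.map lower all)
    where
    lower : ∀ {u} → f u ≡ 0 ⊎ f v ≤ f u → f u ≡ 0 ⊎ f x ≤ f u
    lower (inj₁ e)  = inj₁ e
    lower (inj₂ le) = inj₂ (≤-trans (<⇒≤ (≰⇒> ¬le)) le)

  ∑-All≥ : ∀ (f : A → ℕ) k L → All (λ v → k ≤ f v) L → length L * k ≤ ∑ f L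
  ∑-All≥ f k L all = ≤-trans (≤-reflexive (sym (∑-const k L))) (∑-mono L all)

  ∑-All≡0 : ∀ {f : A → ℕ} {L} → All (λ v → f v ≡ 0) L → ∑ f L ≡ 0
  ∑-All≡0 [] = refl
  ∑-All≡0 (e ∷ es) = cong₂ _+_ e (∑-All≡0 es)

  ∑-∈ : ∀ (f : A → ℕ) {v L} → v ∈ L → f v ≤ ∑ f L
  ∑-∈ f (here refl) = m≤m+n _ _
  ∑-∈ f {L = x ∷ L} (there p) = ≤-trans (∑-∈ f p) (m≤n+m _ (f x))

  length-0 : ∀ {L : List A} → length L ≡ 0 → L ≡ []
  length-0 {[]} _ = refl

  length-1 : ∀ {L : List A} → length L ≡ 1 → ∃[ w ] (L ≡ w ∷ [])
  length-1 {w ∷ []} _ = w , refl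

tri-injective : ∀ {c c′} → 1 ≤ c → 1 ≤ c′ → tri c ≡ tri c′ → c ≡ c′
tri-injective p p′ eq = proj₁ (tri-unique p p′ (trans (+-identityʳ _) (trans eq (sym (+-identityʳ _)))))

2≤⇒1≤tri : ∀ {c} → 2 ≤ c → 1 ≤ tri c
2≤⇒1≤tri = tri-mono

-- Arithmetic of deleting a maximum clique

private
  -- In the two-digit names the digits are the outside degrees of the two vertices deleted first. P
  -- is 2^t for the t other vertices of the clique, S bounds what these contribute, and c₁ and c₂
  -- count the cliques in the neighbourhoods of the first two, mostly controlled by Turán bounds
  -- such as 2P·9/4 and 2P·3/2.
  case-22 : ∀ S c₁ c₂ P → S + 4 ≤ 4 * P → 4 * c₁ ≤ 2 * P * 9 → 2 * c₂ ≤ 2 * P * 3 → S + c₂ + c₁ + 4 ≤ 8 * P + 2 * (2 * P)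
  case-22 S c₁ c₂ P h₁ h₂ h₃ = *-cancelˡ-≤ 4 (by≤ (2 * P) (scale 4 h₁ ⊞ h₂ ⊞ scale 2 h₃) (eq S c₁ c₂ P))
    where
    eq : ∀ S c₁ c₂ P → (4 * (S + c₂ + c₁ + 4)) + ((4 * (4 * P)) + ((2 * P * 9) + (2 * (2 * P * 3)))) + (2 * P) ≡ (4 * (8 * P + 2 * (2 * P))) + ((4 * (S + 4)) + ((4 * c₁) + (2 * (2 * c₂))))
    eq = solve-∀

  case-12 : ∀ S c₁ c₂ P → S + 4 ≤ 4 * P → 2 * c₁ ≤ 2 * P * 3 → 2 * c₂ ≤ 2 * P * 3 → S + c₂ + c₁ + 4 ≤ 8 * P + 2 * P
  case-12 S c₁ c₂ P h₁ h₂ h₃ = *-cancelˡ-≤ 2 (by≤ 0 (scale 2 h₁ ⊞ h₂ ⊞ h₃) (eq S c₁ c₂ P))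
    where
    eq : ∀ S c₁ c₂ P → (2 * (S + c₂ + c₁ + 4)) + ((2 * (4 * P)) + ((2 * P * 3) + (2 * P * 3))) + 0 ≡ (2 * (8 * P + 2 * P)) + ((2 * (S + 4)) + ((2 * c₁) + (2 * c₂)))
    eq = solve-∀

  case-02 : ∀ S c₁ c₂ P → S + 4 ≤ 4 * P → 1 * c₁ ≤ 2 * P * 1 → 2 * c₂ ≤ 2 * P * 3 → S + c₂ + c₁ + 4 ≤ 8 * P + P
  case-02 S c₁ c₂ P h₁ h₂ h₃ = *-cancelˡ-≤ 2 (by≤ 0 (scale 2 h₁ ⊞ scale 2 h₂ ⊞ h₃) (eq S c₁ c₂ P))
    where
    eq : ∀ S c₁ c₂ P → (2 * (S + c₂ + c₁ + 4)) + ((2 * (4 * P)) + ((2 * (2 * P * 1)) + (2 * P * 3))) + 0 ≡ (2 * (8 * P + P)) + ((2 * (S + 4)) + ((2 * (1 * c₁)) + (2 * c₂)))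
    eq = solve-∀

  case-11 : ∀ S c₁ c₂ P Y → S + 4 ≡ 2 * P + 2 * Y → Y ≤ P → 2 * c₁ ≤ 2 * P * 3 → 1 * c₂ ≤ 2 * P * 1 → S + c₂ + c₁ + 4 ≤ 8 * P + Y
  case-11 S c₁ c₂ P Y h₁ h₂ h₃ h₄ = *-cancelˡ-≤ 2 (by≤ 0 (scale 2 (≤-reflexive h₁) ⊞ scale 2 h₂ ⊞ h₃ ⊞ scale 2 h₄) (eq S c₁ c₂ P Y))
    where
    eq : ∀ S c₁ c₂ P Y → (2 * (S + c₂ + c₁ + 4)) + ((2 * (2 * P + 2 * Y)) + ((2 * P) + ((2 * P * 3) + (2 * (2 * P * 1))))) + 0 ≡ (2 * (8 * P + Y)) + ((2 * (S + 4)) + ((2 * Y) + ((2 * c₁) + (2 * (1 * c₂)))))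
    eq = solve-∀

  case-01 : ∀ S c₁ c₂ P Y → S + 4 ≡ 2 * P + 2 * (2 * Y) → 2 * Y ≤ P → 1 * c₁ ≤ 2 * P * 1 → 1 * c₂ ≤ 2 * P * 1 → S + c₂ + c₁ + 4 ≤ 8 * P + Y
  case-01 S c₁ c₂ P Y h₁ h₂ h₃ h₄ = by≤ Y (≤-reflexive h₁ ⊞ scale 2 h₂ ⊞ h₃ ⊞ h₄) (eq S c₁ c₂ P Y)
    where
    eq : ∀ S c₁ c₂ P Y → (S + c₂ + c₁ + 4) + ((2 * P + 2 * (2 * Y)) + ((2 * P) + ((2 * P * 1) + (2 * P * 1)))) + Y ≡ (8 * P + Y) + ((S + 4) + ((2 * (2 * Y)) + ((1 * c₁) + (1 * c₂))))
    eq = solve-∀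

  case-00 : ∀ S c₁ c₂ P Y → S + 4 ≤ 4 * P → 1 * c₁ ≤ 2 * P * 1 → c₂ ≤ P → S + c₂ + c₁ + 4 ≤ 8 * P + Y
  case-00 S c₁ c₂ P Y h₁ h₂ h₃ = by≤ (P + Y) (h₁ ⊞ h₂ ⊞ h₃) (eq S c₁ c₂ P Y)
    where
    eq : ∀ S c₁ c₂ P Y → (S + c₂ + c₁ + 4) + ((4 * P) + ((2 * P * 1) + P)) + (P + Y) ≡ (8 * P + Y) + ((S + 4) + ((1 * c₁) + c₂))
    eq = solve-∀

  case-3 : ∀ S c₁ c₂ P → S + 8 ≤ 8 * P → 4 * c₁ ≤ 2 * P * 9 → 4 * c₂ ≤ 2 * P * 9 → 4 * (S + c₂ + c₁) + 32 ≤ 68 * P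
  case-3 S c₁ c₂ P h₁ h₂ h₃ = by≤ 0 (scale 4 h₁ ⊞ h₂ ⊞ h₃) (eq S c₁ c₂ P)
    where
    eq : ∀ S c₁ c₂ P → (4 * (S + c₂ + c₁) + 32) + ((4 * (8 * P)) + ((2 * P * 9) + (2 * P * 9))) + 0 ≡ (68 * P) + ((4 * (S + 8)) + ((4 * c₁) + (4 * c₂)))
    eq = solve-∀

  case-33 : ∀ S c₁ c₂ P → S + 8 ≤ 8 * P → 8 * c₁ ≤ 2 * P * 27 → 4 * c₂ ≤ 2 * P * 9 → 8 * (S + c₂ + c₁) + 64 ≤ 154 * P
  case-33 S c₁ c₂ P h₁ h₂ h₃ = by≤ 0 (scale 8 h₁ ⊞ h₂ ⊞ scale 2 h₃) (eq S c₁ c₂ P)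
    where
    eq : ∀ S c₁ c₂ P → (8 * (S + c₂ + c₁) + 64) + ((8 * (8 * P)) + ((2 * P * 27) + (2 * (2 * P * 9)))) + 0 ≡ (154 * P) + ((8 * (S + 8)) + ((8 * c₁) + (2 * (4 * c₂))))
    eq = solve-∀

-- ψ d is M times the mean of ε over 0 … d; M clears the denominators up to r.
module Potential (r : ℕ) (ε : ℕ → ℕ) (ε-0 : ε 0 ≡ 0) (ε-ratio : ∀ i → suc i ≤ r → suc i * ε i ≤ i * ε (suc i)) where
  E : ℕ → ℕ
  E zero    = 0
  E (suc d) = E d + ε (suc d)

  M : ℕ
  M = suc r !

  1≤M : 1 ≤ M
  1≤M = 1≤n! (suc r)

  ψ ∇ : ℕ → ℕ
  ψ d = (M / suc d) * E d
  ∇ zero    = 0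
  ∇ (suc d) = ψ (suc d) ∸ ψ d

  ψ-mean : ∀ d → d ≤ r → ψ d * suc d ≡ M * E d
  ψ-mean d le = trans (lem (M / suc d) (E d) (suc d)) (cong (_* E d) (m/n*n≡m (∣-trans (m∣m*n (d !)) (m≤n⇒m!∣n! (s≤s le)))))
    where
    lem : ∀ a b c → a * b * c ≡ a * c * b
    lem = solve-∀

  -- The hypothesis says that ε i / i is nondecreasing. Hence ε i ≤ (i/(d+1)) ε (d+1), and this is
  -- summed over i ≤ d.
  E-bound : ∀ d → suc d ≤ r → 2 * E d ≤ d * ε (suc d)
  E-bound zero le = z≤n
  E-bound (suc d) le = begin
    2 * (E d + ε (suc d)) ≡⟨ *-distribˡ-+ 2 (E d) (ε (suc d)) ⟩
    2 * E d + 2 * ε (suc d) ≤⟨ +-monoˡ-≤ (2 * ε (suc d)) (E-bound d (<⇒≤ le)) ⟩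
    d * ε (suc d) + 2 * ε (suc d) ≡⟨ *-distribʳ-+ (ε (suc d)) d 2 ⟨
    (d + 2) * ε (suc d) ≡⟨ cong (_* ε (suc d)) (+-comm d 2) ⟩
    suc (suc d) * ε (suc d) ≤⟨ ε-ratio (suc d) le ⟩
    suc d * ε (suc (suc d)) ∎
    where open ≤-Reasoning

  ψ-mono : ∀ d → suc d ≤ r → ψ d ≤ ψ (suc d)
  ψ-mono d le = *-cancelʳ-≤ _ _ (suc d * suc (suc d)) (begin
    ψ d * (suc d * suc (suc d)) ≡⟨ *-assoc (ψ d) (suc d) (suc (suc d)) ⟨
    ψ d * suc d * suc (suc d) ≡⟨ cong (_* suc (suc d)) (ψ-mean d (<⇒≤ le)) ⟩
    M * E d * suc (suc d) ≡⟨ lem₁ M (E d) d ⟩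
    M * (d * E d + 2 * E d) ≤⟨ scale M (+-monoʳ-≤ (d * E d) (E-bound d le)) ⟩
    M * (d * E d + d * ε (suc d)) ≤⟨ scale M (+-mono-≤ (*-monoˡ-≤ (E d) (n≤1+n d)) (*-monoˡ-≤ (ε (suc d)) (n≤1+n d))) ⟩
    M * (suc d * E d + suc d * ε (suc d)) ≡⟨ lem₂ M (E d) (ε (suc d)) d ⟩
    M * E (suc d) * suc d ≡⟨ cong (_* suc d) (ψ-mean (suc d) le) ⟨
    ψ (suc d) * suc (suc d) * suc d ≡⟨ *-assoc (ψ (suc d)) (suc (suc d)) (suc d) ⟩
    ψ (suc d) * (suc (suc d) * suc d) ≡⟨ cong (ψ (suc d) *_) (*-comm (suc (suc d)) (suc d)) ⟩
    ψ (suc d) * (suc d * suc (suc d)) ∎)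
    where
    open ≤-Reasoning
    lem₁ : ∀ m e d → m * e * suc (suc d) ≡ m * (d * e + 2 * e)
    lem₁ = solve-∀
    lem₂ : ∀ m e f d → m * (suc d * e + suc d * f) ≡ m * (e + f) * suc d
    lem₂ = solve-∀

  ψ-suc : ∀ d → suc d ≤ r → ψ (suc d) ≡ ψ d + ∇ (suc d)
  ψ-suc d le = sym (m+[n∸m]≡n (ψ-mono d le))

  -- Take the difference of `ψ-mean` at d and at d - 1. In `cheap-vertex` the summand `d * ∇ d` is
  -- shared out among the d neighbours.
  key : ∀ d → d ≤ r → M * ε d ≡ ψ d + d * ∇ d
  key zero le = trans (cong (M *_) ε-0) (trans (*-zeroʳ M) (sym (trans (+-identityʳ _) (*-zeroʳ (M / 1)))))
  key (suc d) le = +-cancelˡ-≡ (suc d * ψ d) _ _ (begin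
    suc d * ψ d + M * ε (suc d) ≡⟨ cong (_+ M * ε (suc d)) (trans (*-comm (suc d) (ψ d)) (ψ-mean d (<⇒≤ le))) ⟩
    M * E d + M * ε (suc d) ≡⟨ *-distribˡ-+ M (E d) (ε (suc d)) ⟨
    M * E (suc d) ≡⟨ ψ-mean (suc d) le ⟨
    ψ (suc d) * suc (suc d) ≡⟨ lem₁ (ψ (suc d)) d ⟩
    ψ (suc d) + suc d * ψ (suc d) ≡⟨ cong (λ s → ψ (suc d) + suc d * s) (ψ-suc d le) ⟩
    ψ (suc d) + suc d * (ψ d + ∇ (suc d)) ≡⟨ lem₂ (ψ (suc d)) (ψ d) (∇ (suc d)) d ⟩
    suc d * ψ d + (ψ (suc d) + suc d * ∇ (suc d)) ∎)
    where
    open ≡-Reasoning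
    lem₁ : ∀ a d → a * suc (suc d) ≡ a + suc d * a
    lem₁ = solve-∀
    lem₂ : ∀ a b c d → a + suc d * (b + c) ≡ suc d * b + (a + suc d * c)
    lem₂ = solve-∀

  E-step : ∀ d → suc d ≤ r → E d * (suc (suc d) * suc d) ≤ E (suc d) * (suc d * d)
  E-step d le = begin
    E d * (suc (suc d) * suc d) ≡⟨ lem₁ (E d) d ⟩
    suc d * (d * E d + 2 * E d) ≤⟨ scale (suc d) (+-monoʳ-≤ (d * E d) (E-bound d le)) ⟩
    suc d * (d * E d + d * ε (suc d)) ≡⟨ lem₂ (E d) (ε (suc d)) d ⟩
    E (suc d) * (suc d * d) ∎
    where
    open ≤-Reasoning
    lem₁ : ∀ e d → e * (suc (suc d) * suc d) ≡ suc d * (d * e + 2 * e)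
    lem₁ = solve-∀
    lem₂ : ∀ e f d → suc d * (d * e + d * f) ≡ (e + f) * (suc d * d)
    lem₂ = solve-∀

  -- E d / (d (d+1)) is nondecreasing, cross-multiplied to include d = 0. In terms of the mean, ψ d
  -- / d grows with d, which is what `ψ-linear` extracts.
  E-convex : ∀ d s → d ≤ s → s ≤ r → E d * (suc s * s) ≤ E s * (suc d * d)
  E-convex d zero z≤n s≤r = ≤-refl
  E-convex d (suc s) d≤s s≤r with m≤n⇒m<n∨m≡n d≤s
  ... | inj₂ refl = ≤-refl
  E-convex d (suc zero) d≤s s≤r | inj₁ (s≤s z≤n) = z≤n
  E-convex d (suc (suc s)) d≤s s≤r | inj₁ (s≤s d≤s′) = *-cancelʳ-≤ _ _ (suc (suc s) * suc s) (begin
    E d * (b * a) * (a * c) ≡⟨ lem₁ (E d) (b * a) (a * c) ⟩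
    E d * (a * c) * (b * a) ≤⟨ *-monoˡ-≤ (b * a) (E-convex d (suc s) d≤s′ (<⇒≤ s≤r)) ⟩
    E (suc s) * (suc d * d) * (b * a) ≡⟨ lem₁ (E (suc s)) (suc d * d) (b * a) ⟩
    E (suc s) * (b * a) * (suc d * d) ≤⟨ *-monoˡ-≤ (suc d * d) (E-step (suc s) s≤r) ⟩
    E (suc (suc s)) * (a * c) * (suc d * d) ≡⟨ lem₁ (E (suc (suc s))) (a * c) (suc d * d) ⟩
    E (suc (suc s)) * (suc d * d) * (a * c) ∎)
    where
    open ≤-Reasoning
    a = suc (suc s)
    b = suc (suc (suc s))
    c = suc s
    lem₁ : ∀ e x y → e * x * y ≡ e * y * x
    lem₁ = solve-∀

  ψ-linear : ∀ d → d ≤ r → (suc r * r) * ψ d ≤ d * (M * E r)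
  ψ-linear d le = *-cancelʳ-≤ _ _ (suc d) (begin
    (suc r * r) * ψ d * suc d ≡⟨ *-assoc (suc r * r) (ψ d) (suc d) ⟩
    (suc r * r) * (ψ d * suc d) ≡⟨ cong ((suc r * r) *_) (ψ-mean d le) ⟩
    (suc r * r) * (M * E d) ≡⟨ lem₁ (suc r * r) M (E d) ⟩
    M * (E d * (suc r * r)) ≤⟨ scale M (E-convex d r le ≤-refl) ⟩
    M * (E r * (suc d * d)) ≡⟨ lem₂ M (E r) d ⟩
    d * (M * E r) * suc d ∎)
    where
    open ≤-Reasoning
    lem₁ : ∀ a m e → a * (m * e) ≡ m * (e * a)
    lem₁ = solve-∀
    lem₂ : ∀ m e d → m * (e * (suc d * d)) ≡ d * (m * e) * suc d
    lem₂ = solve-∀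

-- Scaled by 2 ^ j, the Turán bound for graphs on i ≤ j + p vertices without a clique of p + 1 vertices.
module TuránScale (p j : ℕ) (1≤p : 1 ≤ p) where
  Γ : ℕ
  Γ = 2 ^ j

  σ : ℕ → ℕ
  -- At i = p + s with s ≤ j this is 2^j · 2^(p-s) · 3^s, for s parts of two vertices and p - s
  -- singletons. For i ≤ p the truncated subtraction leaves 2^j · 2^i.
  σ i = 2 ^ (j + i ∸ 2 * (i ∸ p)) * 3 ^ (i ∸ p)

  σ-low : ∀ i → i ≤ p → σ i ≡ Γ * 2 ^ i
  σ-low i le rewrite m≤n⇒m∸n≡0 le = trans (*-identityʳ _) (^-distribˡ-+-* 2 j i)

  private
    regroup : ∀ s j p → s + j + (s + p) ≡ p + j + 2 * s
    regroup = solve-∀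

  σ-high : ∀ s j′ → s + j′ ≡ j → σ (s + p) ≡ 2 ^ p * (2 ^ j′ * 3 ^ s)
  σ-high s j′ refl rewrite m+n∸n≡m s p | regroup s j′ p | m+n∸n≡m (p + j′) (2 * s) =
    trans (cong (_* 3 ^ s) (^-distribˡ-+-* 2 p j′)) (*-assoc (2 ^ p) (2 ^ j′) (3 ^ s))

  σ-ratio : ∀ i → suc i ≤ j + p → 3 * σ i ≤ 2 * σ (suc i)
  σ-ratio i le with suc i ≤? p
  ... | yes i<p rewrite σ-low i (<⇒≤ i<p) | σ-low (suc i) i<p = by≤ (Γ * 2 ^ i) (≤-refl {0}) (lem Γ (2 ^ i))
    where
    lem : ∀ c x → 3 * (c * x) + 0 + c * x ≡ 2 * (c * (2 * x)) + 0
    lem = solve-∀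
  ... | no i≮p = subst (λ k → 3 * σ k ≤ 2 * σ (suc k)) s+p (≤-reflexive (trans (cong (3 *_) (σ-high s (suc j′) s+j))
                  (trans (lem (2 ^ p) (2 ^ j′) (3 ^ s)) (cong (2 *_) (sym (σ-high (suc s) j′ (trans (sym (+-suc s j′)) s+j)))))))
    where
    s = i ∸ p
    s+p : s + p ≡ i
    s+p = m∸n+n≡m (≮⇒≥ i≮p)
    s<j : s < j
    s<j = +-cancelʳ-< p s j (subst (_< j + p) (sym s+p) le)
    j′ = j ∸ suc s
    s+j : s + suc j′ ≡ j
    s+j = trans (+-suc s j′) (m+[n∸m]≡n s<j)
    lem : ∀ a b c → 3 * (a * (2 * b * c)) ≡ 2 * (a * (b * (3 * c)))
    lem = solve-∀

  Γ≤σ : ∀ i → i ≤ j + p → Γ ≤ σ i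
  Γ≤σ zero le = ≤-reflexive (sym (trans (σ-low 0 z≤n) (*-identityʳ Γ)))
  Γ≤σ (suc i) le = *-cancelˡ-≤ 2 (≤-trans (scale 2 (Γ≤σ i (<⇒≤ le)))
    (≤-trans (*-monoˡ-≤ (σ i) (n≤1+n 2)) (σ-ratio i le)))

  -- Deleting a vertex destroys one clique for each nonempty clique of its neighbourhood; the empty
  -- one counts Γ at this scale.
  ε : ℕ → ℕ
  ε i = σ i ∸ Γ

  ε+Γ : ∀ i → i ≤ j + p → ε i + Γ ≡ σ i
  ε+Γ i le = m∸n+n≡m (Γ≤σ i le)

  ε-0 : ε 0 ≡ 0
  ε-0 = trans (cong (_∸ Γ) (trans (σ-low 0 z≤n) (*-identityʳ Γ))) (n∸n≡0 Γ)

  ε-1 : ε 1 ≤ Γ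
  ε-1 = ≤-reflexive (trans (cong (_∸ Γ) (σ-low 1 1≤p)) (trans (cong (_∸ Γ) (lem Γ)) (m+n∸m≡n Γ Γ)))
    where
    lem : ∀ c → c * 2 ≡ c + c
    lem = solve-∀

  -- The factor 3/2 between consecutive values of `σ` is enough; only the step from 1 to 2 uses the
  -- value of `ε 1`.
  ε-ratio : ∀ i → suc i ≤ j + p → suc i * ε i ≤ i * ε (suc i)
  ε-ratio zero le = ≤-reflexive (trans (+-identityʳ (ε 0)) ε-0)
  ε-ratio (suc i) le = *-cancelˡ-≤ 2 (by≤ 0 (scale (suc i) step ⊞ edge i) (lem (ε (suc i)) (ε (suc (suc i))) Γ i))
    where
    step : 3 * (ε (suc i) + Γ) ≤ 2 * (ε (suc (suc i)) + Γ)
    step = subst₂ (λ a b → 3 * a ≤ 2 * b) (sym (ε+Γ (suc i) (<⇒≤ le))) (sym (ε+Γ (suc (suc i)) le)) (σ-ratio (suc i) le)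
    edge : ∀ i → ε (suc i) ≤ i * ε (suc i) + suc i * Γ
    edge zero    = ≤-trans ε-1 (≤-reflexive (sym (+-identityʳ Γ)))
    edge (suc i) = ≤-trans (m≤m+n _ (i * ε (suc (suc i)))) (m≤m+n _ _)
    lem : ∀ e f c i → 2 * (suc (suc i) * e) + (suc i * (2 * (f + c)) + (i * e + suc i * c)) + 0
                    ≡ 2 * (suc i * f) + (suc i * (3 * (e + c)) + e)
    lem = solve-∀

  open Potential (j + p) ε ε-0 ε-ratio using (E) public

  E-low : ∀ i → i ≤ p → E i + (i + 2) * Γ ≡ 2 * 2 ^ i * Γ
  E-low zero le = refl
  E-low (suc i) le = trans (lem₁ (E i) (ε (suc i)) i Γ) (trans (cong₂ _+_ (E-low i (<⇒≤ le))
    (trans (ε+Γ (suc i) (≤-trans le (m≤n+m p j))) (σ-low (suc i) le))) (lem₂ (2 ^ i) Γ))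
    where
    lem₁ : ∀ a e i c → a + e + (suc i + 2) * c ≡ a + (i + 2) * c + (e + c)
    lem₁ = solve-∀
    lem₂ : ∀ x c → 2 * x * c + c * (2 * x) ≡ 2 * (2 * x) * c
    lem₂ = solve-∀

  E-high : ∀ s j′ → suc s + j′ ≡ j → E (suc s + p) + Γ ≡ E (s + p) + 2 ^ p * (2 ^ j′ * 3 ^ suc s)
  E-high s j′ eq = trans (+-assoc (E (s + p)) _ Γ) (cong (E (s + p) +_) (trans
    (ε+Γ (suc s + p) (+-monoˡ-≤ p (≤-trans (m≤m+n (suc s) j′) (≤-reflexive eq)))) (σ-high (suc s) j′ eq)))

-- 73 = 16 + 12 + 18 + 27: the degrees up to p contribute 2·8, and `σ` at p+1, p+2, p+3 is 12, 18,
-- 27 times 2^p.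
E₃ : ∀ p 1≤p → TuránScale.E p 3 1≤p (3 + p) + 8 * (p + 5) ≡ 73 * 2 ^ p
E₃ p 1≤p = +-cancelʳ-≡ (E p + E (1 + p) + E (2 + p)) _ _ (begin
  E (3 + p) + 8 * (p + 5) + (E p + E (1 + p) + E (2 + p)) ≡⟨ lem₁ (E p) (E (1 + p)) (E (2 + p)) (E (3 + p)) p ⟩
  (E p + (p + 2) * 8) + (E (1 + p) + 8) + (E (2 + p) + 8) + (E (3 + p) + 8)
    ≡⟨ cong₂ _+_ (cong₂ _+_ (cong₂ _+_ (E-low p ≤-refl) (E-high 0 2 refl)) (E-high 1 1 refl)) (E-high 2 0 refl) ⟩
  2 * 2 ^ p * 8 + (E p + 2 ^ p * 12) + (E (1 + p) + 2 ^ p * 18) + (E (2 + p) + 2 ^ p * 27)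
    ≡⟨ lem₂ (E p) (E (1 + p)) (E (2 + p)) (2 ^ p) ⟩
  73 * 2 ^ p + (E p + E (1 + p) + E (2 + p)) ∎)
  where
  open ≡-Reasoning
  open TuránScale p 3 1≤p
  lem₁ : ∀ a b c d p → d + 8 * (p + 5) + (a + b + c) ≡ (a + (p + 2) * 8) + (b + 8) + (c + 8) + (d + 8)
  lem₁ = solve-∀
  lem₂ : ∀ a b c x → 2 * x * 8 + (a + x * 12) + (b + x * 18) + (c + x * 27) ≡ 73 * x + (a + b + c)
  lem₂ = solve-∀

-- In the same way 227 = 32 + 24 + 36 + 54 + 81.
E₄ : ∀ p 1≤p → TuránScale.E p 4 1≤p (4 + p) + 16 * (p + 6) ≡ 227 * 2 ^ p
E₄ p 1≤p = +-cancelʳ-≡ (E p + E (1 + p) + E (2 + p) + E (3 + p)) _ _ (begin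
  E (4 + p) + 16 * (p + 6) + (E p + E (1 + p) + E (2 + p) + E (3 + p))
    ≡⟨ lem₁ (E p) (E (1 + p)) (E (2 + p)) (E (3 + p)) (E (4 + p)) p ⟩
  (E p + (p + 2) * 16) + (E (1 + p) + 16) + (E (2 + p) + 16) + (E (3 + p) + 16) + (E (4 + p) + 16)
    ≡⟨ cong₂ _+_ (cong₂ _+_ (cong₂ _+_ (cong₂ _+_ (E-low p ≤-refl) (E-high 0 3 refl)) (E-high 1 2 refl)) (E-high 2 1 refl)) (E-high 3 0 refl) ⟩
  2 * 2 ^ p * 16 + (E p + 2 ^ p * 24) + (E (1 + p) + 2 ^ p * 36) + (E (2 + p) + 2 ^ p * 54) + (E (3 + p) + 2 ^ p * 81)
    ≡⟨ lem₂ (E p) (E (1 + p)) (E (2 + p)) (E (3 + p)) (2 ^ p) ⟩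
  227 * 2 ^ p + (E p + E (1 + p) + E (2 + p) + E (3 + p)) ∎)
  where
  open ≡-Reasoning
  open TuránScale p 4 1≤p
  lem₁ : ∀ a b c d e p → e + 16 * (p + 6) + (a + b + c + d) ≡ (a + (p + 2) * 16) + (b + 16) + (c + 16) + (d + 16) + (e + 16)
  lem₁ = solve-∀
  lem₂ : ∀ a b c d x → 2 * x * 16 + (a + x * 24) + (b + x * 36) + (c + x * 54) + (d + x * 81) ≡ 227 * x + (a + b + c + d)
  lem₂ = solve-∀

-- Arithmetic of the strict bound

private
  strict-two : ∀ k q k′ X G → k + q + 4 ≤ k′ + X → X ≡ G + (suc q + 2) → k < k′ + G
  strict-two k q k′ X G h₁ h₂ = by≤ 0 (h₁ ⊞ ≤-reflexive h₂) (eq k q k′ X G)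
    where
    eq : ∀ k q k′ X G → (suc k) + ((k′ + X) + (G + (suc q + 2))) + 0 ≡ (k′ + G) + ((k + q + 4) + X)
    eq = solve-∀

  sixteen : ∀ E A p P → E + 16 * (p + 6) ≡ 227 * P → 32 * P ≡ A + (5 + p + 1) → 2 * E + 16 ≤ 16 * A
  sixteen E A p P h₁ h₂ = by≤ (16 * p + 80 + 58 * P) (scale 2 (≤-reflexive h₁) ⊞ scale 16 (≤-reflexive h₂)) (eq E A p P)
    where
    eq : ∀ E A p P → (2 * E + 16) + ((2 * (227 * P)) + (16 * (A + (5 + p + 1)))) + (16 * p + 80 + 58 * P) ≡ (16 * A) + ((2 * (E + 16 * (p + 6))) + (16 * (32 * P)))
    eq = solve-∀

  eight-many : ∀ E A p P → E + 8 * (p + 5) ≡ 73 * P → 16 * P ≡ A + (4 + p + 1) → 3 * E + 16 ≤ 16 * A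
  eight-many E A p P h₁ h₂ = by≤ (8 * p + 24 + 37 * P) (scale 3 (≤-reflexive h₁) ⊞ scale 16 (≤-reflexive h₂)) (eq E A p P)
    where
    eq : ∀ E A p P → (3 * E + 16) + ((3 * (73 * P)) + (16 * (A + (4 + p + 1)))) + (8 * p + 24 + 37 * P) ≡ (16 * A) + ((3 * (E + 8 * (p + 5))) + (16 * (16 * P)))
    eq = solve-∀

  eight-one : ∀ E A B p P → E + 8 * (p + 5) ≡ 73 * P → 16 * P ≡ A + (4 + p + 1) → 4 * P ≤ B + (2 + p + 1) → 2 * E + 8 ≤ 8 * A + 8 * B
  eight-one E A B p P h₁ h₂ h₃ = by≤ (8 + 14 * P) (scale 2 (≤-reflexive h₁) ⊞ scale 8 (≤-reflexive h₂) ⊞ scale 8 h₃) (eq E A B p P)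
    where
    eq : ∀ E A B p P → (2 * E + 8) + ((2 * (73 * P)) + ((8 * (A + (4 + p + 1))) + (8 * (B + (2 + p + 1))))) + (8 + 14 * P) ≡ (8 * A + 8 * B) + ((2 * (E + 8 * (p + 5))) + ((8 * (16 * P)) + (8 * (4 * P))))
    eq = solve-∀

  three-lt : ∀ k k′ M A B t P → 4 * (k + suc (suc t)) + 32 ≤ 4 * k′ + 68 * P → k′ ≤ M → M ≤ 15 * P + 3 + B → 32 * P ≡ A + (5 + t + 1) → k < A + B
  three-lt k k′ M A B t P h₁ h₂ h₃ h₄ = *-cancelˡ-≤ 4 (by≤ 0 (h₁ ⊞ scale 4 h₂ ⊞ scale 4 h₃ ⊞ scale 4 (≤-reflexive h₄)) (eq k k′ M A B t P))
    where
    eq : ∀ k k′ M A B t P → (4 * (suc k)) + ((4 * k′ + 68 * P) + ((4 * M) + ((4 * (15 * P + 3 + B)) + (4 * (A + (5 + t + 1)))))) + 0 ≡ (4 * (A + B)) + ((4 * (k + suc (suc t)) + 32) + ((4 * (k′)) + ((4 * M) + (4 * (32 * P)))))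
    eq = solve-∀

  allthree-lt : ∀ k k′ M A B t P → 8 * (k + suc (suc t)) + 64 ≤ 8 * k′ + 154 * P → k′ ≤ M → M + (3 + t + 2) ≡ 8 * P + 4 → 32 * P ≡ A + (5 + t + 1) → k < A + B
  allthree-lt k k′ M A B t P h₁ h₂ h₃ h₄ = *-cancelˡ-≤ 8 (by≤ (8 * B + 38 * P + 8 * t + 32) (h₁ ⊞ scale 8 h₂ ⊞ scale 8 (≤-reflexive h₃) ⊞ scale 8 (≤-reflexive h₄)) (eq k k′ M A B t P))
    where
    eq : ∀ k k′ M A B t P → (8 * (suc k)) + ((8 * k′ + 154 * P) + ((8 * M) + ((8 * (8 * P + 4)) + (8 * (A + (5 + t + 1)))))) + (8 * B + 38 * P + 8 * t + 32) ≡ (8 * (A + B)) + ((8 * (k + suc (suc t)) + 64) + ((8 * (k′)) + ((8 * (M + (3 + t + 2))) + (8 * (32 * P)))))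
    eq = solve-∀

  below-row : ∀ M B t P → M + (3 + t + 2) ≡ 8 * P + 4 * P → M ≤ 15 * P + 3 + B
  below-row M B t P h₁ = by≤ (3 * P + 8 + B + t) (≤-reflexive h₁) (eq M B t P)
    where
    eq : ∀ M B t P → M + (8 * P + 4 * P) + (3 * P + 8 + B + t) ≡ (15 * P + 3 + B) + (M + (3 + t + 2))
    eq = solve-∀

  row-start : ∀ M B t P → M + (4 + t + 1) ≡ 16 * P → 2 * P ≤ B + (1 + t + 1) → M ≤ 15 * P + 3 + B
  row-start M B t P h₁ h₂ = by≤ (P + 6) (≤-reflexive h₁ ⊞ h₂) (eq M B t P)
    where
    eq : ∀ M B t P → M + ((16 * P) + (B + (1 + t + 1))) + (P + 6) ≡ (15 * P + 3 + B) + ((M + (4 + t + 1)) + (2 * P))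
    eq = solve-∀

  row-inner : ∀ M B t P W → M + (4 + t + 2) ≡ 16 * P + 2 * W → 4 * P + W ≤ B + (2 + t + 2) → W ≤ 2 * P → M ≤ 15 * P + 3 + B
  row-inner M B t P W h₁ h₂ h₃ = by≤ (P + 5) (≤-reflexive h₁ ⊞ h₂ ⊞ h₃) (eq M B t P W)
    where
    eq : ∀ M B t P W → M + ((16 * P + 2 * W) + ((B + (2 + t + 2)) + (2 * P))) + (P + 5) ≡ (15 * P + 3 + B) + ((M + (4 + t + 2)) + ((4 * P + W) + W))
    eq = solve-∀

  average-cancel : ∀ N a b c E → 1 ≤ N → b < N → N * c ≤ (a * N + b) * E → c ≤ suc a * E
  average-cancel N a b c E 1≤N b<N h = *-cancelˡ-≤ N {{>-nonZero 1≤N}} (begin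
    N * c ≤⟨ h ⟩
    (a * N + b) * E ≤⟨ *-monoˡ-≤ E (+-monoʳ-≤ (a * N) (<⇒≤ b<N)) ⟩
    (a * N + N) * E ≡⟨ lem a N E ⟩
    N * (suc a * E) ∎)
    where
    open ≤-Reasoning
    lem : ∀ a n e → (a * n + n) * e ≡ n * (suc a * e)
    lem = solve-∀

  average-finish : ∀ Γ k a A B E → 1 ≤ a → Γ * k ≤ a * E → E + Γ ≤ Γ * A → 1 ≤ Γ → k < a * A + B
  average-finish Γ k a A B E 1≤a h h′ 1≤Γ = *-cancelˡ-≤ Γ {{>-nonZero 1≤Γ}} (begin
    Γ * suc k ≡⟨ *-suc Γ k ⟩
    Γ + Γ * k ≤⟨ +-mono-≤ (m≤n*m Γ a {{>-nonZero 1≤a}}) h ⟩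
    a * Γ + a * E ≡⟨ lem a Γ E ⟩
    a * (E + Γ) ≤⟨ scale a h′ ⟩
    a * (Γ * A) ≤⟨ m≤m+n _ (Γ * B) ⟩
    a * (Γ * A) + Γ * B ≡⟨ lem′ a Γ A B ⟩
    Γ * (a * A + B) ∎)
    where
    open ≤-Reasoning
    lem : ∀ a c e → a * c + a * e ≡ a * (e + c)
    lem = solve-∀
    lem′ : ∀ a c x b → a * (c * x) + c * b ≡ c * (a * x + b)
    lem′ = solve-∀

  -- The constants come from `three-deletion`: of the 32·2^t in g(tri (5 + t)) the deletion uses
  -- 17·2^t, and 15·2^t + 3 is exactly what the linear terms then leave for the rest. Since b < tri
  -- (3 + t), m does not get beyond row 4 + t, which gives the three cases.
  colex-growth : ∀ t b m → b < tri (3 + t) → m ≤ b + (2 * t + 6) → g m ≤ 15 * 2 ^ t + 3 + g b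
  colex-growth t b m b< m≤ with m <? tri (4 + t)
  ... | yes m< = ≤-trans (g-mono (s≤s⁻¹ (≤-trans m< (≤-reflexive (+-suc (tri (3 + t)) (2 + t))))))
                   (below-row (g (tri (3 + t) + (2 + t))) (g b) t (2 ^ t) (trans (g-row< (3 + t) (2 + t) ≤-refl) (lem (2 ^ t))))
    where
    lem : ∀ x → 2 * (2 * (2 * x)) + 2 * (2 * x) ≡ 8 * x + 4 * x
    lem = solve-∀
  ... | no m≮ with m ∸ tri (4 + t) | m+[n∸m]≡n (≮⇒≥ m≮)
  ...   | zero | m≡ = row-start (g m) (g b) t (2 ^ t)
            (trans (cong (λ i → g i + (4 + t + 1)) (trans (sym m≡) (+-identityʳ _))) (trans (g-tri (4 + t)) (lem (2 ^ t))))
            (≤-trans (≤-reflexive (sym (g-tri (1 + t)))) (+-monoˡ-≤ (1 + t + 1) (g-mono b≥)))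
    where
    lem : ∀ x → 2 * (2 * (2 * (2 * x))) ≡ 16 * x
    lem = solve-∀
    b≥ : tri (1 + t) ≤ b
    b≥ = by≤ t (≤-trans (≤-reflexive (trans (sym (+-identityʳ _)) m≡)) m≤) (lem′ (tri t) t b)
      where
      lem′ : ∀ x t b → x + t + (b + (2 * t + 6)) + t ≡ b + (x + t + (1 + t) + (2 + t) + (3 + t))
      lem′ = solve-∀
  ...   | suc w | m≡ = row-inner (g m) (g b) t (2 ^ t) (2 ^ w)
            (trans (cong (λ i → g i + (4 + t + 2)) (sym m≡)) (trans (g-row (4 + t) (suc w) (s≤s z≤n) (≤-trans (s≤s w≤) (m≤n+m (2 + t) 2))) (lem (2 ^ t) (2 ^ w))))
            (≤-trans (≤-reflexive (trans (lem₂ (2 ^ t) (2 ^ w)) (sym (g-row (2 + t) w (s≤s z≤n) (≤-trans w≤ (n≤1+n _)))))) (+-monoˡ-≤ (2 + t + 2) (g-mono b≥)))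
            (pow-mono w≤)
    where
    lem : ∀ x w → 2 * (2 * (2 * (2 * x))) + 2 * w ≡ 16 * x + 2 * w
    lem = solve-∀
    lem₂ : ∀ x w → 4 * x + w ≡ 2 * (2 * x) + w
    lem₂ = solve-∀
    m≤′ : tri (4 + t) + suc w ≤ b + (2 * t + 6)
    m≤′ = ≤-trans (≤-reflexive m≡) m≤
    b≥ : tri (2 + t) + w ≤ b
    b≥ = by≤ 0 m≤′ (lem′ (tri (2 + t)) t b w)
      where
      lem′ : ∀ x t b w → x + w + (b + (2 * t + 6)) + 0 ≡ b + (x + (2 + t) + (3 + t) + suc w)
      lem′ = solve-∀
    w≤ : w ≤ 1 + t
    w≤ = by≤ 0 (m≤′ ⊞ b<) (lem′ (tri (2 + t)) t b w)
      where
      lem′ : ∀ x t b w → w + (b + (2 * t + 6) + (x + (2 + t))) + 0 ≡ 1 + t + (x + (2 + t) + (3 + t) + suc w + suc b)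
      lem′ = solve-∀

tri-+ : ∀ q o → tri (q + o) ≡ tri q + q * o + tri o
tri-+ q zero = trans (cong tri (+-identityʳ q)) (lem (tri q) q)
  where
  lem : ∀ x q → x ≡ x + q * 0 + 0
  lem = solve-∀
tri-+ q (suc o) = trans (cong tri (+-suc q o)) (trans (cong (_+ (q + o)) (tri-+ q o)) (lem (tri q) q o (tri o)))
  where
  lem : ∀ x q o y → x + q * o + y + (q + o) ≡ x + q * suc o + (y + o)
  lem = solve-∀

-- Graphs as lists of vertices

record Adjacency (V : Set) : Set where
  field
    _~_   : V → V → Bool
    ~-sym : ∀ u v → u ~ v ≡ v ~ u
    ~-irr : ∀ v → v ~ v ≡ false

-- A graph is given by its list of vertices; a repeated vertex would act as a non-adjacent twin.
module ListGraph {V : Set} (𝒢 : Adjacency V) where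
  open Adjacency 𝒢

  nbrs : V → List V → List V
  nbrs v = filterᵇ (v ~_)

  deg : V → List V → ℕ
  deg v = ∑ (λ u → b2n (v ~ u))

  #e : List V → ℕ
  #e []      = 0
  #e (v ∷ L) = #e L + deg v L

  -- The empty clique is counted.
  #cl-in : (V → Bool) → List V → ℕ
  #cl-in p []      = 1
  #cl-in p (v ∷ L) = #cl-in p L + (if p v then #cl-in (λ u → p u ∧ v ~ u) L else 0)

  #cl : List V → ℕ
  #cl = #cl-in (λ _ → true)

  #κ : List V → ℕ
  #κ []      = 0
  #κ (v ∷ L) = #κ L + (#cl (nbrs v L) ∸ 1)

  -- As in `#cl-in`, a predicate in place of a filtered list keeps the recursion structural; `ω-∷`
  -- restores the form with neighbourhoods.
  ω-in : (V → Bool) → List V → ℕ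
  ω-in p []      = 0
  ω-in p (v ∷ L) = ω-in p L ⊔ (if p v then suc (ω-in (λ u → p u ∧ v ~ u) L) else 0)

  ω : List V → ℕ
  ω = ω-in (λ _ → true)

  Clique : List V → Set
  Clique = AllPairs (λ u v → u ~ v ≡ true)

  Joined Avoids : V → List V → Set
  Joined v = All (λ u → v ~ u ≡ true)
  Avoids v = All (λ u → v ~ u ≡ false)

  Isolated : List V → List V → Set
  Isolated I L = All (λ v → Avoids v L) I

  length-nbrs : ∀ v L → length (nbrs v L) ≡ deg v L
  length-nbrs v [] = refl
  length-nbrs v (u ∷ L) with v ~ u
  ... | true  = cong suc (length-nbrs v L)
  ... | false = length-nbrs v L

  #cl-in-cong : ∀ {p q} L → (∀ u → p u ≡ q u) → #cl-in p L ≡ #cl-in q L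
  #cl-in-cong [] eq = refl
  #cl-in-cong {p} {q} (v ∷ L) eq = cong₂ _+_ (#cl-in-cong L eq) lem
    where
    lem : (if p v then #cl-in (λ u → p u ∧ v ~ u) L else 0) ≡ (if q v then #cl-in (λ u → q u ∧ v ~ u) L else 0)
    lem rewrite eq v with q v
    ... | true  = #cl-in-cong L (λ u → cong (_∧ v ~ u) (eq u))
    ... | false = refl

  #cl-in-filterᵇ : ∀ p q L → #cl-in (λ u → p u ∧ q u) L ≡ #cl-in q (filterᵇ p L)
  #cl-in-filterᵇ p q [] = refl
  #cl-in-filterᵇ p q (v ∷ L) with p v
  ... | false = trans (+-identityʳ _) (#cl-in-filterᵇ p q L)
  ... | true with q v
  ...   | false = cong (_+ 0) (#cl-in-filterᵇ p q L)
  ...   | true  = cong₂ _+_ (#cl-in-filterᵇ p q L)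
                    (trans (#cl-in-cong L (λ u → ∧-assoc (p u) (q u) (v ~ u))) (#cl-in-filterᵇ p _ L))

  #cl-in≡ : ∀ p L → #cl-in p L ≡ #cl (filterᵇ p L)
  #cl-in≡ p L = trans (#cl-in-cong L (λ u → sym (∧-identityʳ (p u)))) (#cl-in-filterᵇ p (λ _ → true) L)

  #cl-∷ : ∀ v L → #cl (v ∷ L) ≡ #cl L + #cl (nbrs v L)
  #cl-∷ v L = cong (#cl L +_) (#cl-in≡ (v ~_) L)

  private
    ∧-rotate : ∀ a b c → (a ∧ b) ∧ c ≡ (a ∧ c) ∧ b
    ∧-rotate true  b c = ∧-comm b c
    ∧-rotate false b c = refl

  #cl-in-↭ : ∀ p {L M} → L ↭ M → #cl-in p L ≡ #cl-in p M
  #cl-in-↭ p Perm.refl = refl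
  #cl-in-↭ p (prep x q) = cong₂ _+_ (#cl-in-↭ p q) (cong (λ s → if p x then s else 0) (#cl-in-↭ _ q))
  #cl-in-↭ p (Perm.trans q r) = trans (#cl-in-↭ p q) (#cl-in-↭ p r)
  #cl-in-↭ p (swap {xs = L} {ys = M} x y q)
    rewrite #cl-in-↭ p q | #cl-in-↭ (λ u → p u ∧ x ~ u) q | #cl-in-↭ (λ u → p u ∧ y ~ u) q
          | #cl-in-↭ (λ u → (p u ∧ x ~ u) ∧ y ~ u) q | ~-sym y x
          | #cl-in-cong {λ u → (p u ∧ y ~ u) ∧ x ~ u} {λ u → (p u ∧ x ~ u) ∧ y ~ u} M (λ u → ∧-rotate (p u) (y ~ u) (x ~ u))
    with p x | p y | x ~ y
  ... | true  | true  | true  = lem (#cl-in p M) (#cl-in (λ u → p u ∧ y ~ u) M) (#cl-in (λ u → p u ∧ x ~ u) M) (#cl-in (λ u → (p u ∧ x ~ u) ∧ y ~ u) M)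
    where
    lem : ∀ a b c d → a + b + (c + d) ≡ a + c + (b + d)
    lem = solve-∀
  ... | true  | true  | false = lem (#cl-in p M) (#cl-in (λ u → p u ∧ y ~ u) M) (#cl-in (λ u → p u ∧ x ~ u) M)
    where
    lem : ∀ a b c → a + b + (c + 0) ≡ a + c + (b + 0)
    lem = solve-∀
  ... | true  | false | _     = lem (#cl-in p M) (#cl-in (λ u → p u ∧ x ~ u) M)
    where
    lem : ∀ a c → a + 0 + (c + 0) ≡ a + c + 0
    lem = solve-∀
  ... | false | true  | _     = lem (#cl-in p M) (#cl-in (λ u → p u ∧ y ~ u) M)
    where
    lem : ∀ a c → a + c + 0 ≡ a + 0 + (c + 0)
    lem = solve-∀
  ... | false | false | _     = refl

  #cl-↭ : ∀ {L M} → L ↭ M → #cl L ≡ #cl M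
  #cl-↭ = #cl-in-↭ _

  1≤#cl : ∀ L → 1 ≤ #cl L
  1≤#cl []      = s≤s z≤n
  1≤#cl (v ∷ L) = ≤-trans (1≤#cl L) (m≤m+n (#cl L) _)

  #κ-∷ : ∀ v L → #κ (v ∷ L) + 1 ≡ #κ L + #cl (nbrs v L)
  #κ-∷ v L = trans (+-assoc (#κ L) _ 1) (cong (#κ L +_) (m∸n+n≡m (1≤#cl (nbrs v L))))

  -- Besides the cliques in `#κ` there are the singletons and the empty clique. The equation
  -- transfers invariance from `#cl` to `#κ`, for permutations and later for embeddings.
  #cl-#κ : ∀ L → #cl L ≡ #κ L + length L + 1
  #cl-#κ [] = refl
  #cl-#κ (v ∷ L) = trans (#cl-∷ v L) (trans (cong (_+ #cl (nbrs v L)) (#cl-#κ L))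
    (trans (eq₁ (#κ L) (length L) (#cl (nbrs v L))) (trans (cong (λ s → s + length L + 1) (sym (#κ-∷ v L)))
      (eq₂ (#κ (v ∷ L)) (length L)))))
    where
    eq₁ : ∀ a b c → a + b + 1 + c ≡ a + c + b + 1
    eq₁ = solve-∀
    eq₂ : ∀ a b → a + 1 + b + 1 ≡ a + suc b + 1
    eq₂ = solve-∀

  #κ-↭ : ∀ {L M} → L ↭ M → #κ L ≡ #κ M
  #κ-↭ {L} {M} p = +-cancelʳ-≡ (length L + 1) _ _ (begin
    #κ L + (length L + 1) ≡⟨ +-assoc (#κ L) (length L) 1 ⟨
    #κ L + length L + 1 ≡⟨ #cl-#κ L ⟨
    #cl L ≡⟨ #cl-↭ p ⟩
    #cl M ≡⟨ #cl-#κ M ⟩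
    #κ M + length M + 1 ≡⟨ cong (λ s → #κ M + s + 1) (sym (↭-length p)) ⟩
    #κ M + length L + 1 ≡⟨ +-assoc (#κ M) (length L) 1 ⟩
    #κ M + (length L + 1) ∎)
    where open ≡-Reasoning

  deg-↭ : ∀ v {L M} → L ↭ M → deg v L ≡ deg v M
  deg-↭ v = ∑-↭ _

  deg-++ : ∀ v L M → deg v (L ++ M) ≡ deg v L + deg v M
  deg-++ v = ∑-++ _

  #e-↭ : ∀ {L M} → L ↭ M → #e L ≡ #e M
  #e-↭ Perm.refl = refl
  #e-↭ (prep x q) = cong₂ _+_ (#e-↭ q) (deg-↭ x q)
  #e-↭ (Perm.trans q r) = trans (#e-↭ q) (#e-↭ r)
  #e-↭ (swap {xs = L} {ys = M} x y q) rewrite #e-↭ q | deg-↭ x q | deg-↭ y q | ~-sym y x =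
    eq (#e M) (deg y M) (b2n (x ~ y)) (deg x M)
    where
    eq : ∀ a b c d → a + b + (c + d) ≡ a + d + (c + b)
    eq = solve-∀

  handshake : ∀ L → ∑ (λ v → deg v L) L ≡ #e L + #e L
  handshake [] = refl
  handshake (v ∷ L) = begin
    b2n (v ~ v) + deg v L + ∑ (λ u → b2n (u ~ v) + deg u L) L
      ≡⟨ cong₂ _+_ (cong (λ b → b2n b + deg v L) (~-irr v)) (∑-+ (λ u → b2n (u ~ v)) (λ u → deg u L) L) ⟩
    deg v L + (∑ (λ u → b2n (u ~ v)) L + ∑ (λ u → deg u L) L)
      ≡⟨ cong₂ (λ s t → deg v L + (s + t)) (∑-cong L (λ u → cong b2n (~-sym u v))) (handshake L) ⟩
    deg v L + (deg v L + (#e L + #e L))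
      ≡⟨ eq (deg v L) (#e L) ⟩
    #e L + deg v L + (#e L + deg v L) ∎
    where
    open ≡-Reasoning
    eq : ∀ d e → d + (d + (e + e)) ≡ e + d + (e + d)
    eq = solve-∀

  ω-in-cong : ∀ {p q} L → (∀ u → p u ≡ q u) → ω-in p L ≡ ω-in q L
  ω-in-cong [] eq = refl
  ω-in-cong {p} {q} (v ∷ L) eq = cong₂ _⊔_ (ω-in-cong L eq) lem
    where
    lem : (if p v then suc (ω-in (λ u → p u ∧ v ~ u) L) else 0) ≡ (if q v then suc (ω-in (λ u → q u ∧ v ~ u) L) else 0)
    lem rewrite eq v with q v
    ... | true  = cong suc (ω-in-cong L (λ u → cong (_∧ v ~ u) (eq u)))
    ... | false = refl

  ω-in-filterᵇ : ∀ p q L → ω-in (λ u → p u ∧ q u) L ≡ ω-in q (filterᵇ p L)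
  ω-in-filterᵇ p q [] = refl
  ω-in-filterᵇ p q (v ∷ L) with p v
  ... | false = trans (⊔-identityʳ _) (ω-in-filterᵇ p q L)
  ... | true with q v
  ...   | false = cong (_⊔ 0) (ω-in-filterᵇ p q L)
  ...   | true  = cong₂ _⊔_ (ω-in-filterᵇ p q L)
                    (cong suc (trans (ω-in-cong L (λ u → ∧-assoc (p u) (q u) (v ~ u))) (ω-in-filterᵇ p _ L)))

  ω-∷ : ∀ v L → ω (v ∷ L) ≡ ω L ⊔ suc (ω (nbrs v L))
  ω-∷ v L = cong (λ s → ω L ⊔ suc s)
    (trans (ω-in-cong L (λ u → sym (∧-identityʳ (v ~ u)))) (ω-in-filterᵇ (v ~_) (λ _ → true) L))

  ω-tail : ∀ v L → ω L ≤ ω (v ∷ L)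
  ω-tail v L = m≤m⊔n (ω L) _

  ω-nbrs : ∀ v L → suc (ω (nbrs v L)) ≤ ω (v ∷ L)
  ω-nbrs v L = ≤-trans (m≤n⊔m (ω L) _) (≤-reflexive (sym (ω-∷ v L)))

  ω-in-↭ : ∀ p {L M} → L ↭ M → ω-in p L ≡ ω-in p M
  ω-in-↭ p Perm.refl = refl
  ω-in-↭ p (prep x q) = cong₂ _⊔_ (ω-in-↭ p q) (cong (λ s → if p x then suc s else 0) (ω-in-↭ _ q))
  ω-in-↭ p (Perm.trans q r) = trans (ω-in-↭ p q) (ω-in-↭ p r)
  ω-in-↭ p (swap {xs = L} {ys = M} x y q)
    rewrite ω-in-↭ p q | ω-in-↭ (λ u → p u ∧ x ~ u) q | ω-in-↭ (λ u → p u ∧ y ~ u) q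
          | ω-in-↭ (λ u → (p u ∧ x ~ u) ∧ y ~ u) q | ~-sym y x
          | ω-in-cong {λ u → (p u ∧ y ~ u) ∧ x ~ u} {λ u → (p u ∧ x ~ u) ∧ y ~ u} M (λ u → ∧-rotate (p u) (y ~ u) (x ~ u))
    with p x | p y | x ~ y
  ... | true  | true  | true  = lem _ _ _ _
    where
    lem : ∀ a b c d → (a ⊔ suc b) ⊔ suc (c ⊔ suc d) ≡ (a ⊔ suc c) ⊔ suc (b ⊔ suc d)
    lem a b c d = trans (⊔-assoc a (suc b) (suc c ⊔ suc (suc d))) (trans (cong (a ⊔_)
      (trans (sym (⊔-assoc (suc b) (suc c) (suc (suc d)))) (trans (cong (_⊔ suc (suc d)) (⊔-comm (suc b) (suc c)))
        (⊔-assoc (suc c) (suc b) (suc (suc d)))))) (sym (⊔-assoc a (suc c) (suc b ⊔ suc (suc d)))))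
  ... | true  | true  | false = lem _ _ _
    where
    lem : ∀ a b c → (a ⊔ suc b) ⊔ suc (c ⊔ 0) ≡ (a ⊔ suc c) ⊔ suc (b ⊔ 0)
    lem a b c rewrite ⊔-identityʳ c | ⊔-identityʳ b =
      trans (⊔-assoc a (suc b) (suc c)) (trans (cong (a ⊔_) (⊔-comm (suc b) (suc c))) (sym (⊔-assoc a (suc c) (suc b))))
  ... | true  | false | _     = lem _ _
    where
    lem : ∀ a c → (a ⊔ 0) ⊔ suc (c ⊔ 0) ≡ (a ⊔ suc c) ⊔ 0
    lem a c rewrite ⊔-identityʳ a | ⊔-identityʳ c = sym (⊔-identityʳ _)
  ... | false | true  | _     = lem _ _
    where
    lem : ∀ a c → (a ⊔ suc c) ⊔ 0 ≡ (a ⊔ 0) ⊔ suc (c ⊔ 0)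
    lem a c rewrite ⊔-identityʳ a | ⊔-identityʳ c = ⊔-identityʳ _
  ... | false | false | _     = refl

  ω-↭ : ∀ {L M} → L ↭ M → ω L ≡ ω M
  ω-↭ = ω-in-↭ _

  Clique-↭ : ∀ {L M} → L ↭ M → Clique L → Clique M
  Clique-↭ = AllPairs-↭ (λ {u} {v} eq → trans (~-sym v u) eq)

  #cl≤2^ : ∀ n L → length L ≤ n → #cl L ≤ 2 ^ length L
  #cl≤2^ n [] le = ≤-refl
  #cl≤2^ (suc n) (v ∷ L) (s≤s le) = begin
    #cl (v ∷ L) ≡⟨ #cl-∷ v L ⟩
    #cl L + #cl (nbrs v L) ≤⟨ +-mono-≤ (#cl≤2^ n L le) (#cl≤2^ n (nbrs v L) (≤-trans (length-filterᵇ _ L) le)) ⟩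
    2 ^ length L + 2 ^ length (nbrs v L) ≤⟨ +-monoʳ-≤ (2 ^ length L) (pow-mono (length-filterᵇ (v ~_) L)) ⟩
    2 ^ length L + 2 ^ length L ≡⟨ cong (2 ^ length L +_) (sym (+-identityʳ _)) ⟩
    2 ^ suc (length L) ∎
    where open ≤-Reasoning

  #cl≤ : ∀ {d} L → length L ≤ d → #cl L ≤ 2 ^ d
  #cl≤ L le = ≤-trans (#cl≤2^ _ L ≤-refl) (pow-mono le)

  #cl-full⇒Clique : ∀ L → 2 ^ length L ≤ #cl L → Clique L
  #cl-full⇒Clique [] le = []
  #cl-full⇒Clique (v ∷ L) le =
    filterᵇ-full (v ~_) L (≮⇒≥ λ lt → <-irrefl refl (begin-strict
      2 ^ length L ≤⟨ +-cancelˡ-≤ (2 ^ length L) _ _ (≤-trans le′ (+-monoˡ-≤ _ (#cl≤2^ _ L ≤-refl))) ⟩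
      #cl (nbrs v L) ≤⟨ #cl≤2^ _ (nbrs v L) ≤-refl ⟩
      2 ^ length (nbrs v L) <⟨ ^-monoʳ-< 2 (s≤s (s≤s z≤n)) lt ⟩
      2 ^ length L ∎))
    ∷ #cl-full⇒Clique L (+-cancelʳ-≤ (2 ^ length L) _ _
        (≤-trans le′ (+-monoʳ-≤ (#cl L) (#cl≤ (nbrs v L) (length-filterᵇ _ L)))))
    where
    open ≤-Reasoning
    le′ : 2 ^ length L + 2 ^ length L ≤ #cl L + #cl (nbrs v L)
    le′ = subst₂ _≤_ (cong (2 ^ length L +_) (+-identityʳ _)) (#cl-∷ v L) le

  nbrs-clique : ∀ {v Q} L → Joined v Q → nbrs v (Q ++ L) ≡ Q ++ nbrs v L
  nbrs-clique {v} {Q} L all = trans (filterᵇ-++ (v ~_) Q L) (cong (_++ nbrs v L) (filterᵇ-all (v ~_) all))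

  -- Attained by the Turán graph with j parts of size two and p - j singletons.
  turán : ∀ n L p j → length L ≤ n → length L ≤ p + j → ω L ≤ p → 2 ^ j * #cl L ≤ 2 ^ p * 3 ^ j
  turán n [] p j _ _ _ = begin
    2 ^ j * 1 ≡⟨ *-comm (2 ^ j) 1 ⟩
    1 * 2 ^ j ≤⟨ *-mono-≤ (1≤2^ p) (^-monoˡ-≤ j (s≤s (s≤s z≤n))) ⟩
    2 ^ p * 3 ^ j ∎
    where open ≤-Reasoning
  turán (suc n) (v ∷ L) zero j _ _ ω≤ = ⊥-elim (1+n≰n (≤-trans (s≤s z≤n) (≤-trans (ω-nbrs v L) ω≤)))
  turán (suc n) (v ∷ L) (suc p) j (s≤s le) len ω≤ with length L ≤? length (nbrs v L)
  -- A vertex joined to all of L doubles the count and leaves clique number at most p on L: p drops,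
  -- j stays.
  ... | yes full = subst₂ _≤_ (trans (lem (2 ^ j) (#cl L)) (cong (2 ^ j *_) (sym cl≡))) (lem′ (2 ^ p) (3 ^ j))
                     (*-monoʳ-≤ 2 (turán n L p j le (s≤s⁻¹ len) ωL≤))
    where
    nbrs≡ : nbrs v L ≡ L
    nbrs≡ = filterᵇ-all (v ~_) (filterᵇ-full (v ~_) L full)
    ωL≤ : ω L ≤ p
    ωL≤ = s≤s⁻¹ (≤-trans (subst (λ M → suc (ω M) ≤ ω (v ∷ L)) nbrs≡ (ω-nbrs v L)) ω≤)
    cl≡ : #cl (v ∷ L) ≡ #cl L + #cl L
    cl≡ = trans (#cl-∷ v L) (cong (λ M → #cl L + #cl M) nbrs≡)
    lem : ∀ a b → 2 * (a * b) ≡ a * (b + b)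
    lem = solve-∀
    lem′ : ∀ a b → 2 * (a * b) ≡ 2 * a * b
    lem′ = solve-∀
  turán (suc n) (v ∷ L) (suc p) zero (s≤s le) len ω≤ | no _ =
    subst₂ _≤_ (sym (+-identityʳ _)) (sym (*-identityʳ _)) (#cl≤ (v ∷ L) (≤-trans len (≤-reflexive (+-identityʳ _))))
  -- Now v misses some vertex of L, so its neighbourhood has at most p + j vertices and clique
  -- number at most p. The bounds for L and for the neighbourhood are in the ratio 2 : 1, and their
  -- sum gives the factor 3.
  turán (suc n) (v ∷ L) (suc p) (suc j) (s≤s le) len ω≤ | no ¬full =
    subst (_≤ 2 ^ suc p * 3 ^ suc j) (cong (2 ^ suc j *_) (sym (#cl-∷ v L))) (by≤ 0
      (+-mono-≤ (+-mono-≤ ihL ihL) (+-mono-≤ ihN ihN))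
      (lem (2 ^ j) (#cl L) (#cl (nbrs v L)) (2 ^ p) (3 ^ j)))
    where
    len′ : length L ≤ suc p + j
    len′ = ≤-trans (s≤s⁻¹ len) (≤-reflexive (+-suc p j))
    ihL = turán n L (suc p) j le len′ (≤-trans (ω-tail v L) ω≤)
    ihN = turán n (nbrs v L) p j (≤-trans (length-filterᵇ _ L) le) (s≤s⁻¹ (≤-trans (≰⇒> ¬full) len′))
            (s≤s⁻¹ (≤-trans (ω-nbrs v L) ω≤))
    lem : ∀ a b c u w → 2 * a * (b + c) + (2 * u * w + 2 * u * w + (u * w + u * w)) + 0
                      ≡ 2 * u * (3 * w) + (a * b + a * b + (a * c + a * c))
    lem = solve-∀

  max-clique : ∀ n L → length L ≤ n → ∃[ Q ] ∃[ R ] (L ↭ Q ++ R × Clique Q × length Q ≡ ω L)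
  max-clique n [] le = [] , [] , ↭-refl , [] , refl
  max-clique (suc n) (v ∷ L) (s≤s le) with suc (ω (nbrs v L)) ≤? ω L
  ... | yes p with max-clique n L le
  ...   | Q , R , q , cq , lq = Q , v ∷ R , ↭-trans (prep v q) (↭-sym (shift v Q R)) , cq ,
            trans lq (sym (trans (ω-∷ v L) (m≥n⇒m⊔n≡m p)))
  max-clique (suc n) (v ∷ L) (s≤s le) | no ¬p with max-clique n (nbrs v L) (≤-trans (length-filterᵇ _ L) le)
  ... | Q , R , q , cq , lq = v ∷ Q , R ++ filterᵇ (not ∘ (v ~_)) L ,
          prep v (↭-trans (filterᵇ-split (v ~_) L) (↭-trans (++⁺ʳ _ q) (Perm.↭-reflexive (++-assoc Q R _)))) ,
          ++⁻ˡ Q (All-resp-↭ q (filterᵇ-true (v ~_) L)) ∷ cq ,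
          trans (cong suc lq) (sym (trans (ω-∷ v L) (m≤n⇒m⊔n≡n (<⇒≤ (≰⇒> ¬p)))))

  clique≤ω : ∀ Q R → Clique Q → length Q ≤ ω (Q ++ R)
  clique≤ω [] R [] = z≤n
  clique≤ω (v ∷ Q) R (pv ∷ cq) = ≤-trans
    (s≤s (≤-trans (clique≤ω Q (nbrs v R) cq) (≤-reflexive (cong ω (sym (nbrs-clique R pv))))))
    (ω-nbrs v (Q ++ R))

  deg-clique : ∀ {v Q} → Joined v Q → deg v Q ≡ length Q
  deg-clique [] = refl
  deg-clique (eq ∷ all) rewrite eq = cong suc (deg-clique all)

  deg-none : ∀ {v L} → Avoids v L → deg v L ≡ 0
  deg-none [] = refl
  deg-none (eq ∷ all) rewrite eq = deg-none all

  deg≡0 : ∀ {v} L → deg v L ≡ 0 → Avoids v L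
  deg≡0 [] eq = []
  deg≡0 {v} (u ∷ L) eq with v ~ u in vu
  ... | false = vu ∷ deg≡0 L eq

  degs : List V → List V → ℕ
  degs Q R = ∑ (λ v → deg v R) Q

  Sorted : List V → List V → Set
  Sorted Q R = Ascending (λ v → deg v R) Q

  #e-++ : ∀ L M → #e (L ++ M) ≡ #e L + degs L M + #e M
  #e-++ [] M = refl
  #e-++ (v ∷ L) M rewrite #e-++ L M | deg-++ v L M = lem (#e L) (degs L M) (#e M) (deg v L) (deg v M)
    where
    lem : ∀ a b c d e → a + b + c + (d + e) ≡ a + d + (e + b) + c
    lem = solve-∀

  #e-clique : ∀ {Q} → Clique Q → #e Q ≡ tri (length Q)
  #e-clique [] = refl
  #e-clique (pv ∷ cq) = cong₂ _+_ (#e-clique cq) (deg-clique pv)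

  #cl-clique : ∀ {Q} → Clique Q → #cl Q ≡ 2 ^ length Q
  #cl-clique [] = refl
  #cl-clique {v ∷ Q} (pv ∷ cq) = trans (#cl-∷ v Q) (trans (cong (λ M → #cl Q + #cl M) (filterᵇ-all (v ~_) pv))
    (trans (cong (λ s → s + s) (#cl-clique cq)) (cong (2 ^ length Q +_) (sym (+-identityʳ _)))))

  #κ-clique : ∀ {Q} → Clique Q → #κ Q ≡ g (tri (length Q))
  #κ-clique {Q} cq = +-cancelʳ-≡ (length Q + 1) _ _
    (trans (sym (+-assoc (#κ Q) (length Q) 1)) (trans (sym (#cl-#κ Q)) (trans (#cl-clique cq) (sym (g-tri (length Q))))))

  pow-sum : List ℕ → ℕ
  pow-sum []       = 0
  pow-sum (o ∷ os) = 2 ^ (length os + o) + pow-sum os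

  outdegs : List V → List V → List ℕ
  outdegs Q R = map (λ v → deg v R) Q

  length-nbrs-clique : ∀ {v Q} R → Joined v Q → length (nbrs v (Q ++ R)) ≡ length Q + deg v R
  length-nbrs-clique {v} {Q} R pv = trans (cong length (nbrs-clique R pv))
    (trans (length-++ Q) (cong (length Q +_) (length-nbrs v R)))

  -- When the i-th vertex of Q is removed, |Q| - i vertices of Q and its outside neighbours form its neighbourhood.
  #κ-delete : ∀ {Q} R → Clique Q → #κ (Q ++ R) + length Q ≤ #κ R + pow-sum (outdegs Q R)
  #κ-delete R [] = ≤-refl
  #κ-delete {v ∷ Q} R (pv ∷ cq) = by≤ 0
    (+-mono-≤ (+-mono-≤ (#κ-delete R cq) (#cl≤ (nbrs v (Q ++ R)) (≤-reflexive len))) (≤-reflexive (#κ-∷ v (Q ++ R))))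
    (lem (#κ (v ∷ Q ++ R)) (length Q) (#κ R) (2 ^ (length (outdegs Q R) + deg v R)) (pow-sum (outdegs Q R))
         (#κ (Q ++ R)) (#cl (nbrs v (Q ++ R))))
    where
    len : length (nbrs v (Q ++ R)) ≡ length (outdegs Q R) + deg v R
    len = trans (length-nbrs-clique R pv) (cong (_+ deg v R) (sym (length-map _ Q)))
    lem : ∀ k q r s p k′ c → k + suc q + (r + p + s + (k′ + c)) + 0 ≡ r + (s + p) + (k′ + q + c + (k + 1))
    lem = solve-∀

  #κ-edgeless : ∀ L → #e L ≡ 0 → #κ L ≡ 0
  #κ-edgeless [] eq = refl
  #κ-edgeless (v ∷ L) eq = cong₂ (λ a M → a + (#cl M ∸ 1)) (#κ-edgeless L (m+n≡0⇒m≡0 (#e L) eq))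
    (length-0 {L = nbrs v L} (trans (length-nbrs v L) (m+n≡0⇒n≡0 (#e L) eq)))

  deg-self : ∀ v L → deg v (v ∷ L) ≡ deg v L
  deg-self v L = cong (λ b → b2n b + deg v L) (~-irr v)

  degs-sym : ∀ L M → degs L M ≡ degs M L
  degs-sym L M = trans (∑-exchange (λ v u → b2n (v ~ u)) L M)
    (∑-cong M (λ u → ∑-cong L (λ v → cong b2n (~-sym v u))))

  -- The bound without a degree condition

  MinDegree : V → List V → Set
  MinDegree v L = All (λ u → deg u (v ∷ L) ≡ 0 ⊎ deg v L ≤ deg u (v ∷ L)) (v ∷ L)

  data MinView (L : List V) : Set where
    edgeless : #e L ≡ 0 → MinView L
    minimum  : ∀ v M → L ↭ v ∷ M → 1 ≤ deg v M → tri (suc (deg v M)) ≤ #e (v ∷ M) → MinDegree v M → MinView L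

  -- The δ + 1 vertices of the closed neighbourhood of v all have degree at least δ, so twice the
  -- number of edges is at least (δ+1) δ. This provides the hypothesis of `g-gain`.
  min-view : ∀ L → MinView L
  min-view L with min-positive (λ v → deg v L) L
  ... | inj₁ all = edgeless (m+n≡0⇒m≡0 (#e L) (trans (sym (handshake L)) (∑-All≡0 all)))
  ... | inj₂ (v , v∈ , 1≤ , all) with ∈-split v∈
  ...   | M , q = minimum v M q (subst (1 ≤_) dv 1≤) (half (≤-trans big (≤-reflexive (handshake (v ∷ M))))) min
    where
    dv : deg v L ≡ deg v M
    dv = trans (deg-↭ v q) (deg-self v M)
    min : MinDegree v M
    min = All.map (λ {u} → subst₂ (λ a b → a ≡ 0 ⊎ b ≤ a) (deg-↭ u q) dv) (All-resp-↭ q all)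
    near : ∀ {u} → v ~ u ≡ true × (deg u (v ∷ M) ≡ 0 ⊎ deg v M ≤ deg u (v ∷ M)) → deg v M ≤ deg u (v ∷ M)
    near (eq , inj₂ le) = le
    near {u} (eq , inj₁ z) with trans (sym (cong b2n (trans (~-sym u v) eq))) (m+n≡0⇒m≡0 (b2n (u ~ v)) z)
    ... | ()
    N = nbrs v M
    big : suc (deg v M) * deg v M ≤ ∑ (λ u → deg u (v ∷ M)) (v ∷ M)
    big = begin
      suc (deg v M) * deg v M ≡⟨ cong (λ k → suc k * deg v M) (sym (length-nbrs v M)) ⟩
      length (v ∷ N) * deg v M ≤⟨ ∑-All≥ _ (deg v M) (v ∷ N) (≤-reflexive (sym (deg-self v M)) ∷
                                              All.map near (All.zip (filterᵇ-true (v ~_) M , All-filterᵇ (v ~_) (All.tail min)))) ⟩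
      ∑ f (v ∷ N) ≤⟨ m≤m+n _ _ ⟩
      ∑ f (v ∷ N) + ∑ f (filterᵇ (not ∘ (v ~_)) M) ≡⟨ ∑-++ f (v ∷ N) _ ⟨
      ∑ f (v ∷ N ++ filterᵇ (not ∘ (v ~_)) M) ≡⟨ ∑-↭ f (prep v (filterᵇ-split (v ~_) M)) ⟨
      ∑ f (v ∷ M) ∎
      where
      open ≤-Reasoning
      f : V → ℕ
      f u = deg u (v ∷ M)
    half : suc (deg v M) * deg v M ≤ #e (v ∷ M) + #e (v ∷ M) → tri (suc (deg v M)) ≤ #e (v ∷ M)
    half le = ≮⇒≥ λ lt → <-irrefl (sym (tri-double (deg v M))) (≤-trans (s≤s le) (+-mono-< lt lt))

  -- The Kruskal-Katona bound for graphs, summed over all clique sizes. The recursion is on `n`: v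
  -- has positive degree, so M has fewer edges.
  kruskal-katona : ∀ n L → #e L ≤ n → #κ L ≤ g (#e L)
  kruskal-katona n L le with min-view L
  ... | edgeless e≡0 = ≤-trans (≤-reflexive (#κ-edgeless L e≡0)) z≤n
  kruskal-katona zero L le | minimum v M q 1≤ t≤ _ =
    ⊥-elim (1+n≰n (≤-trans (≤-trans 1≤ (≤-trans (m≤n+m _ (tri (deg v M))) t≤)) (≤-trans (≤-reflexive (sym (#e-↭ q))) le)))
  kruskal-katona (suc n) L le | minimum v M q 1≤ t≤ _ rewrite #κ-↭ q | #e-↭ q =
    +-cancelʳ-≤ 1 _ _ (begin
      #κ (v ∷ M) + 1 ≡⟨ #κ-∷ v M ⟩
      #κ M + #cl (nbrs v M) ≤⟨ +-mono-≤ (kruskal-katona n M eM≤) (#cl≤ (nbrs v M) (≤-reflexive (length-nbrs v M))) ⟩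
      g (#e M) + 2 ^ deg v M ≤⟨ g-gain (deg v M) (#e M) (+-cancelʳ-≤ (deg v M) _ _ t≤) ⟩
      g (#e M + deg v M) + 1 ∎)
    where
    open ≤-Reasoning
    eM≤ : #e M ≤ n
    eM≤ = s≤s⁻¹ (≤-trans (≤-trans (≤-reflexive (+-comm 1 (#e M))) (+-monoʳ-≤ (#e M) 1≤)) le)

  -- The graphs attaining the bound without a degree condition

  Complete : ℕ → List V → Set
  Complete c L = ∃[ Q ] ∃[ I ] (L ↭ Q ++ I × Clique Q × length Q ≡ c × Isolated I (Q ++ I))

  Pendant : ℕ → ℕ → List V → Set
  Pendant c d L = ∃[ v ] ∃[ P ] ∃[ Q ] ∃[ I ] (L ↭ v ∷ (P ++ Q) ++ I × Clique (P ++ Q) × length P ≡ d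
    × length P + length Q ≡ c × Joined v P × Avoids v Q × Isolated I (v ∷ (P ++ Q) ++ I))

  Split : ℕ → List V → Set
  Split c L = ∃[ v ] ∃[ w ] ∃[ Q ] ∃[ I ] (L ↭ v ∷ w ∷ Q ++ I × v ~ w ≡ true × Clique Q × length Q ≡ c
    × Avoids v Q × Avoids w Q × Isolated I (v ∷ w ∷ Q ++ I))

  -- Both tri 0 and tri 1 vanish; `c ≢ 1` records an edgeless graph with c = 0.
  ColexLike : List V → Set
  ColexLike L = (∃[ c ] (c ≢ 1 × #e L ≡ tri c × Complete c L))
    ⊎ (∃[ c ] ∃[ d ] (1 ≤ d × d < c × #e L ≡ tri c + d × (Pendant c d L ⊎ (d ≡ 1 × Split c L))))

  private
    Isolated-∷ : ∀ {I L v} → Isolated I L → Avoids v I → Isolated I (v ∷ L)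
    Isolated-∷ [] [] = []
    Isolated-∷ {v = v} (is ∷ iso) (vu ∷ vs) = (trans (~-sym _ v) vu ∷ is) ∷ Isolated-∷ iso vs

    Isolated-↭ : ∀ {I L M} → L ↭ M → Isolated I L → Isolated I M
    Isolated-↭ q = All.map (All-resp-↭ q)

    edgeless⇒Isolated : ∀ L → #e L ≡ 0 → Isolated L L
    edgeless⇒Isolated [] eq = []
    edgeless⇒Isolated (v ∷ L) eq = (~-irr v ∷ vL) ∷ Isolated-∷ (edgeless⇒Isolated L (m+n≡0⇒m≡0 (#e L) eq)) vL
      where
      vL = deg≡0 L (m+n≡0⇒n≡0 (#e L) eq)

    deg≤#e : ∀ {u R} → u ∈ R → deg u R ≤ #e R
    deg≤#e {u} {R} u∈ with ∈-split u∈
    ... | M , q = begin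
      deg u R ≡⟨ trans (deg-↭ u q) (deg-self u M) ⟩
      deg u M ≤⟨ m≤n+m _ (#e M) ⟩
      #e (u ∷ M) ≡⟨ #e-↭ q ⟨
      #e R ∎
      where open ≤-Reasoning

    -- A complete closed neighbourhood of minimum degree δ leaves d < δ edges, too few for any other vertex.
    no-overflow : ∀ v M d → MinDegree v M → Clique (nbrs v M) → 1 ≤ d → d < deg v M → #e M ≢ tri (deg v M) + d
    no-overflow v M d min cl 1≤d d<δ eM = contra rest
      where
      δ = deg v M
      N = nbrs v M
      R = filterᵇ (not ∘ (v ~_)) M
      L↭ : v ∷ M ↭ (v ∷ N) ++ R
      L↭ = prep v (filterᵇ-split (v ~_) M)
      cK : Clique (v ∷ N)
      cK = filterᵇ-true (v ~_) M ∷ cl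
      total : #e (v ∷ N) + degs (v ∷ N) R + #e R ≡ #e (v ∷ N) + d
      total = begin
        #e (v ∷ N) + degs (v ∷ N) R + #e R ≡⟨ #e-++ (v ∷ N) R ⟨
        #e ((v ∷ N) ++ R) ≡⟨ #e-↭ L↭ ⟨
        #e M + δ ≡⟨ cong (_+ δ) eM ⟩
        tri δ + d + δ ≡⟨ lem (tri δ) d δ ⟩
        tri (suc δ) + d ≡⟨ cong (λ k → tri (suc k) + d) (length-nbrs v M) ⟨
        tri (length (v ∷ N)) + d ≡⟨ cong (_+ d) (#e-clique cK) ⟨
        #e (v ∷ N) + d ∎
        where
        open ≡-Reasoning
        lem : ∀ a b c → a + b + c ≡ a + c + b
        lem = solve-∀
      out : degs (v ∷ N) R + #e R ≡ d
      out = +-cancelˡ-≡ (#e (v ∷ N)) _ _ (trans (sym (+-assoc (#e (v ∷ N)) _ _)) total)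
      f : V → ℕ
      f u = deg u (v ∷ M)
      f-split : ∀ u → f u ≡ deg u (v ∷ N) + deg u R
      f-split u = trans (deg-↭ u L↭) (deg-++ u (v ∷ N) R)
      rest : All (λ u → f u ≡ 0 ⊎ δ ≤ f u) R
      rest = All-filterᵇ _ (All.tail min)
      small : ∀ {u} → u ∈ R → f u ≤ d
      small {u} u∈ = begin
        f u ≡⟨ f-split u ⟩
        deg u (v ∷ N) + deg u R ≤⟨ +-mono-≤ (∑-∈ (λ u → deg u (v ∷ N)) u∈) (deg≤#e u∈) ⟩
        degs R (v ∷ N) + #e R ≡⟨ cong (_+ #e R) (degs-sym R (v ∷ N)) ⟩
        degs (v ∷ N) R + #e R ≡⟨ out ⟩
        d ∎
        where open ≤-Reasoning
      zeros : ∀ S → (∀ {u} → u ∈ S → u ∈ R) → All (λ u → f u ≡ 0 ⊎ δ ≤ f u) S → All (λ u → f u ≡ 0) S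
      zeros [] _ [] = []
      zeros (u ∷ S) sub (inj₁ z ∷ all) = z ∷ zeros S (sub ∘ there) all
      zeros (u ∷ S) sub (inj₂ le ∷ all) = ⊥-elim (<-irrefl refl (≤-trans d<δ (≤-trans le (small (sub (here refl))))))
      contra : All (λ u → f u ≡ 0 ⊎ δ ≤ f u) R → ⊥
      contra all = <-irrefl (sym d≡0) 1≤d
        where
        z = zeros R id all
        z₁ : degs R (v ∷ N) ≡ 0
        z₁ = ∑-All≡0 (All.map (λ {u} e → m+n≡0⇒m≡0 (deg u (v ∷ N)) (trans (sym (f-split u)) e)) z)
        z₂ : #e R ≡ 0
        z₂ = m+n≡0⇒m≡0 (#e R) (trans (sym (handshake R))
               (∑-All≡0 (All.map (λ {u} e → m+n≡0⇒n≡0 (deg u (v ∷ N)) (trans (sym (f-split u)) e)) z)))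
        d≡0 : d ≡ 0
        d≡0 = trans (sym out) (cong₂ _+_ (trans (degs-sym (v ∷ N) R) z₁) z₂)

    -- The neighbours of v form a clique, and a vertex of I has no neighbour in Q or I. So either
    -- all of them lie in Q, giving `Pendant` or a larger `Complete`, or there is a single one and
    -- it lies in I, giving `Split`.
    attach : ∀ v M c → 2 ≤ c → Complete c M → Clique (nbrs v M) → #e M ≡ tri c → 1 ≤ deg v M → deg v M ≤ c → ColexLike (v ∷ M)
    attach v M c 2≤c (Q , I , q , cQ , lQ , iso) cN eM 1≤δ δ≤c = go (nbrs v Q) (nbrs v I) refl refl cN′ deg≡
      where
      δ = deg v M
      cN′ : Clique (nbrs v Q ++ nbrs v I)
      cN′ = subst Clique (filterᵇ-++ (v ~_) Q I) (Clique-↭ (filterᵇ-↭ (v ~_) q) cN)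
      deg≡ : length (nbrs v Q) + length (nbrs v I) ≡ δ
      deg≡ = trans (cong₂ _+_ (length-nbrs v Q) (length-nbrs v I)) (trans (sym (deg-++ v Q I)) (sym (deg-↭ v q)))
      isoQ : ∀ {w} → w ∈ I → Avoids w (Q ++ I)
      isoQ = All.lookup iso
      inI : ∀ {w W} → nbrs v I ≡ w ∷ W → w ∈ I
      inI eq = ∈-resp-↭ (↭-sym (filterᵇ-split (v ~_) I)) (subst (λ X → _ ∈ X ++ filterᵇ (not ∘ (v ~_)) I) (sym eq) (here refl))
      clash : ∀ {a b} → a ~ b ≡ true → b ~ a ≡ false → ⊥
      clash {a} {b} p p′ with trans (sym p) (trans (~-sym a b) p′)
      ... | ()
      R = filterᵇ (not ∘ (v ~_)) Q
      go : ∀ X Y → nbrs v Q ≡ X → nbrs v I ≡ Y → Clique (X ++ Y) → length X + length Y ≡ δ → ColexLike (v ∷ M)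
      go X [] eX eY c′ len with m≤n⇒m<n∨m≡n δ≤c
      ... | inj₁ δ<c = inj₂ (c , δ , 1≤δ , δ<c , cong (_+ δ) eM , inj₁
              (v , X , R , I , prep v (↭-trans q (++⁺ʳ I Q↭)) , Clique-↭ Q↭ cQ , trans (sym (+-identityʳ _)) len ,
               trans (sym (length-++ X)) (trans (sym (↭-length Q↭)) lQ) ,
               subst (All _) eX (filterᵇ-true (v ~_) Q) , filterᵇ-false (v ~_) Q ,
               Isolated-∷ (Isolated-↭ (++⁺ʳ I Q↭) iso) vI))
        where
        Q↭ : Q ↭ X ++ R
        Q↭ = ↭-trans (filterᵇ-split (v ~_) Q) (++⁺ʳ R (Perm.↭-reflexive eX))
        vI : Avoids v I
        vI = deg≡0 I (trans (sym (length-nbrs v I)) (cong length eY))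
      ... | inj₂ refl = inj₁ (suc c , (λ e → n≮0 (subst (2 ≤_) (suc-injective e) 2≤c)) , cong (_+ c) eM ,
              v ∷ Q , I , prep v q , filterᵇ-full (v ~_) Q (≤-reflexive (trans lQ (trans (sym (trans (sym (+-identityʳ _)) len)) (cong length (sym eX))))) ∷ cQ ,
              cong suc lQ , Isolated-∷ iso vI)
        where
        vI : Avoids v I
        vI = deg≡0 I (trans (sym (length-nbrs v I)) (cong length eY))
      go (x ∷ X) (w ∷ Y) eX eY (px ∷ _) len =
        ⊥-elim (clash (All.lookup px (∈-++⁺ʳ X (here refl)))
          (All.lookup (++⁻ˡ Q (isoQ (inI eY))) x∈))
        where
        x∈ : x ∈ Q
        x∈ = ∈-resp-↭ (↭-sym (filterᵇ-split (v ~_) Q)) (subst (λ X → x ∈ X ++ filterᵇ (not ∘ (v ~_)) Q) (sym eX) (here refl))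
      go [] (w ∷ y ∷ Y) eX eY ((wy ∷ _) ∷ _) len =
        ⊥-elim (clash {y} {w} (trans (~-sym y w) wy) (All.lookup (++⁻ʳ Q (isoQ (inI eY))) y∈))
        where
        y∈ : y ∈ I
        y∈ = ∈-resp-↭ (↭-sym (filterᵇ-split (v ~_) I)) (subst (λ X → y ∈ X ++ filterᵇ (not ∘ (v ~_)) I) (sym eY) (there (here refl)))
      go [] (w ∷ []) eX eY c′ len = inj₂ (c , 1 , ≤-refl , 2≤c , trans (cong (_+ δ) eM) (cong (tri c +_) (sym len)) , inj₂ (refl ,
        v , w , Q , I′ , prep v (↭-trans q (↭-trans (++⁺ˡ Q I↭) (shift w Q I′))) ,
        All.head (subst (All _) eY (filterᵇ-true (v ~_) I)) , cQ , lQ ,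
        deg≡0 Q (trans (sym (length-nbrs v Q)) (cong length eX)) , ++⁻ˡ Q (All.head iso′) ,
        Isolated-∷ (Isolated-↭ (↭-trans (++⁺ˡ Q I↭) (shift w Q I′)) (All.tail iso′)) (filterᵇ-false (v ~_) I)))
        where
        I′ = filterᵇ (not ∘ (v ~_)) I
        I↭ : I ↭ w ∷ I′
        I↭ = ↭-trans (filterᵇ-split (v ~_) I) (++⁺ʳ I′ (Perm.↭-reflexive eY))
        iso′ : Isolated (w ∷ I′) (Q ++ I)
        iso′ = All-resp-↭ I↭ iso

    ColexLike-↭ : ∀ {L M} → L ↭ M → ColexLike M → ColexLike L
    ColexLike-↭ q (inj₁ (c , c≢ , e , Q , I , q′ , rest)) = inj₁ (c , c≢ , trans (#e-↭ q) e , Q , I , ↭-trans q q′ , rest)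
    ColexLike-↭ q (inj₂ (c , d , 1≤ , d< , e , inj₁ (v , P , Q , I , q′ , rest))) =
      inj₂ (c , d , 1≤ , d< , trans (#e-↭ q) e , inj₁ (v , P , Q , I , ↭-trans q q′ , rest))
    ColexLike-↭ q (inj₂ (c , d , 1≤ , d< , e , inj₂ (d1 , v , w , Q , I , q′ , rest))) =
      inj₂ (c , d , 1≤ , d< , trans (#e-↭ q) e , inj₂ (d1 , v , w , Q , I , ↭-trans q q′ , rest))

    -- The case c = 1 of `g-gain-tight`, where M has tri 1 = 0 edges; the result is K_2 with
    -- isolated vertices.
    single-edge : ∀ v M → #e M ≡ 0 → deg v M ≡ 1 → ColexLike (v ∷ M)
    single-edge v M eM δ≡1 with length-1 {L = nbrs v M} (trans (length-nbrs v M) δ≡1)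
    ... | w , eN = inj₁ (2 , (λ ()) , cong₂ _+_ eM δ≡1 , v ∷ w ∷ [] , I′ , prep v M↭ ,
            (All.head (subst (All _) eN (filterᵇ-true (v ~_) M)) ∷ []) ∷ [] ∷ [] , refl ,
            Isolated-∷ (All.tail (All-resp-↭ M↭ (Isolated-↭ M↭ (edgeless⇒Isolated M eM)))) (filterᵇ-false (v ~_) M))
      where
      I′ = filterᵇ (not ∘ (v ~_)) M
      M↭ : M ↭ w ∷ I′
      M↭ = ↭-trans (filterᵇ-split (v ~_) M) (++⁺ʳ I′ (Perm.↭-reflexive eN))

  -- Every inequality in `kruskal-katona` is tight: M is extremal again, the neighbourhood of v is a
  -- clique, and `g-gain-tight` tells how many edges M has.
  extremal⇒ColexLike : ∀ n L → #e L ≤ n → #κ L ≡ g (#e L) → ColexLike L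
  extremal⇒ColexLike n L le tight with min-view L
  ... | edgeless e≡0 = inj₁ (0 , (λ ()) , e≡0 , [] , L , ↭-refl , [] , refl , edgeless⇒Isolated L e≡0)
  extremal⇒ColexLike zero L le tight | minimum v M q 1≤ t≤ _ =
    ⊥-elim (1+n≰n (≤-trans (≤-trans 1≤ (≤-trans (m≤n+m _ (tri (deg v M))) t≤)) (≤-trans (≤-reflexive (sym (#e-↭ q))) le)))
  extremal⇒ColexLike (suc n) L le tight | minimum v M q 1≤ t≤ min =
    ColexLike-↭ q (cases (g-gain-tight δ (#e M) 1≤ triδ≤ (≤-antisym gain (≤-trans (≤-reflexive κ≡) (+-mono-≤ ih clN)))))
    where
    δ = deg v M
    triδ≤ : tri δ ≤ #e M
    triδ≤ = +-cancelʳ-≤ δ _ _ t≤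
    eM≤ : #e M ≤ n
    eM≤ = s≤s⁻¹ (≤-trans (≤-trans (≤-reflexive (+-comm 1 (#e M))) (+-monoʳ-≤ (#e M) 1≤)) (subst (_≤ suc n) (#e-↭ q) le))
    ih : #κ M ≤ g (#e M)
    ih = kruskal-katona n M eM≤
    clN : #cl (nbrs v M) ≤ 2 ^ δ
    clN = #cl≤ (nbrs v M) (≤-reflexive (length-nbrs v M))
    gain : g (#e M) + 2 ^ δ ≤ g (#e M + δ) + 1
    gain = g-gain δ (#e M) triδ≤
    κ≡ : g (#e M + δ) + 1 ≡ #κ M + #cl (nbrs v M)
    κ≡ = trans (cong (_+ 1) (trans (cong g (sym (#e-↭ q))) (trans (sym tight) (#κ-↭ q)))) (#κ-∷ v M)
    sum≤ : g (#e M) + 2 ^ δ ≤ #κ M + #cl (nbrs v M)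
    sum≤ = ≤-trans gain (≤-reflexive κ≡)
    κM : #κ M ≡ g (#e M)
    κM = ≤-antisym ih (+-cancelʳ-≤ (2 ^ δ) _ _ (≤-trans sum≤ (+-monoʳ-≤ (#κ M) clN)))
    cN : Clique (nbrs v M)
    cN = #cl-full⇒Clique (nbrs v M) (≤-trans (≤-reflexive (cong (2 ^_) (length-nbrs v M)))
           (+-cancelˡ-≤ (g (#e M)) _ _ (≤-trans sum≤ (+-monoˡ-≤ (#cl (nbrs v M)) ih))))
    complete : ∀ c → 2 ≤ c → #e M ≡ tri c → ColexLike M → Complete c M
    complete c 2≤c e (inj₁ (zero , c≢ , e′ , comp)) =
      ⊥-elim (<-irrefl (trans (sym e′) e) (2≤⇒1≤tri 2≤c))
    complete c 2≤c e (inj₁ (suc c′ , c≢ , e′ , comp)) =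
      subst (λ k → Complete k M) (tri-injective (s≤s z≤n) (<⇒≤ 2≤c) (trans (sym e′) e)) comp
    complete c 2≤c e (inj₂ (c′ , d , 1≤d , d<c′ , e′ , _)) =
      ⊥-elim (<-irrefl (sym (proj₂ (tri-unique d<c′ (<⇒≤ 2≤c) (trans (sym e′) (trans e (sym (+-identityʳ _))))))) 1≤d)
    cases : (∃[ c ] (#e M ≡ tri c × δ ≤ c × 1 ≤ c)) ⊎ (∃[ d ] (#e M ≡ tri δ + d × 1 ≤ d × d < δ)) → ColexLike (v ∷ M)
    cases (inj₂ (d , eM , 1≤d , d<δ)) = ⊥-elim (no-overflow v M d min cN 1≤d d<δ eM)
    cases (inj₁ (suc zero , eM , δ≤c , _)) = single-edge v M eM (≤-antisym δ≤c 1≤)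
    cases (inj₁ (suc (suc c) , eM , δ≤c , _)) =
      attach v M (2 + c) (s≤s (s≤s z≤n)) (complete (2 + c) (s≤s (s≤s z≤n)) eM (extremal⇒ColexLike n M eM≤ κM)) cN eM 1≤ δ≤c

  -- Cliques lost by deleting a maximum clique

  private
    AllPairs≤ : List ℕ → Set
    AllPairs≤ = AllPairs _≤_

    length≤sum : ∀ {os} → All (1 ≤_) os → length os ≤ sum os
    length≤sum [] = z≤n
    length≤sum (p ∷ ps) = +-mono-≤ p (length≤sum ps)

    -- Zeros come first in ascending order. Once the head is positive, all later entries are too, so
    -- their number is at most their sum and `pow-convex` applies.
    pow-sum-few : ∀ os → AllPairs≤ os → pow-sum os + 2 ≤ 2 ^ length os + 2 ^ sum os
    pow-sum-few [] [] = ≤-refl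
    pow-sum-few (zero ∷ os) (_ ∷ ap) rewrite +-identityʳ (length os) = by≤ 0 (pow-sum-few os ap)
      (lem (2 ^ length os) (pow-sum os) (2 ^ sum os))
      where
      lem : ∀ a b c → a + b + 2 + (a + c) + 0 ≡ 2 * a + c + (b + 2)
      lem = solve-∀
    pow-sum-few (suc o ∷ os) (all ∷ ap) = by≤ 0
      (+-mono-≤ (pow-sum-few os ap) (pow-convex (length os) (sum os) (suc o) (length≤sum (All.map (≤-trans (s≤s z≤n)) all))))
      (subst (λ i → 2 ^ (length os + suc o) + pow-sum os + 2 + (2 ^ length os + 2 ^ sum os + (2 ^ (sum os + suc o) + 2 ^ length os)) + 0
            ≡ 2 * 2 ^ length os + 2 ^ i + (pow-sum os + 2 + (2 ^ sum os + 2 ^ (length os + suc o))))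
         (+-comm (sum os) (suc o))
         (lem (2 ^ (length os + suc o)) (pow-sum os) (2 ^ length os) (2 ^ sum os) (2 ^ (sum os + suc o))))
      where
      lem : ∀ a b c d e → a + b + 2 + (c + d + (e + c)) + 0 ≡ 2 * c + e + (b + 2 + (d + a))
      lem = solve-∀

    pow-sum-≤ : ∀ k os → All (_≤ k) os → pow-sum os + 2 ^ k ≤ 2 ^ k * 2 ^ length os
    pow-sum-≤ k [] [] = ≤-reflexive (sym (*-identityʳ (2 ^ k)))
    pow-sum-≤ k (o ∷ os) (p ∷ ps) = by≤ 0
      (+-mono-≤ (pow-sum-≤ k os ps) (≤-trans (pow-mono (+-monoʳ-≤ (length os) p)) (≤-reflexive (^-distribˡ-+-* 2 (length os) k))))
      (lem (2 ^ (length os + o)) (pow-sum os) (2 ^ k) (2 ^ length os))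
      where
      lem : ∀ a b c d → a + b + c + (c * d + d * c) + 0 ≡ c * (2 * d) + (b + c + a)
      lem = solve-∀

    -- Such a list consists of ones followed by y twos, and the two geometric series are summed
    -- exactly.
    pow-sum-12 : ∀ os → AllPairs≤ os → All (1 ≤_) os → All (_≤ 2) os →
      ∃[ y ] (y ≤ length os × sum os ≡ length os + y × pow-sum os + 4 ≡ 2 * 2 ^ length os + 2 * 2 ^ y)
    pow-sum-12 [] [] [] [] = 0 , z≤n , refl , refl
    pow-sum-12 (zero ∷ os) _ (() ∷ _) _
    pow-sum-12 (suc (suc (suc o)) ∷ os) _ _ (s≤s (s≤s ()) ∷ _)
    pow-sum-12 (suc zero ∷ os) (_ ∷ ap) (_ ∷ l) (_ ∷ u) with pow-sum-12 os ap l u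
    ... | y , y≤ , s , p = y , m≤n⇒m≤1+n y≤ , cong suc s ,
      trans (lem₁ (2 ^ (length os + 1)) (pow-sum os)) (trans (cong (2 ^ (length os + 1) +_) p)
        (trans (cong (λ i → 2 ^ i + (2 * 2 ^ length os + 2 * 2 ^ y)) (+-comm (length os) 1)) (lem₂ (2 ^ length os) (2 ^ y))))
      where
      lem₁ : ∀ a b → a + b + 4 ≡ a + (b + 4)
      lem₁ = solve-∀
      lem₂ : ∀ a b → 2 * a + (2 * a + 2 * b) ≡ 2 * (2 * a) + 2 * b
      lem₂ = solve-∀
    pow-sum-12 (suc (suc zero) ∷ os) (all ∷ ap) (_ ∷ l) (_ ∷ u) = suc (length os) , ≤-refl ,
      trans (cong (2 +_) (sum-2 os all u)) (lem₃ (length os)) ,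
      trans (cong (λ i → 2 ^ i + pow-sum os + 4) (+-comm (length os) 2)) (trans (lem₁ (2 ^ (2 + length os)) (pow-sum os))
        (trans (cong (2 ^ (2 + length os) +_) (pow-2 os all u)) (lem₂ (2 ^ length os))))
      where
      sum-2 : ∀ os → All (2 ≤_) os → All (_≤ 2) os → sum os ≡ 2 * length os
      sum-2 [] [] [] = refl
      sum-2 (o ∷ os) (p ∷ ps) (p′ ∷ ps′) = trans (cong₂ _+_ (≤-antisym p′ p) (sum-2 os ps ps′)) (lem₄ (length os))
        where
        lem₄ : ∀ n → 2 + 2 * n ≡ 2 * suc n
        lem₄ = solve-∀
      pow-2 : ∀ os → All (2 ≤_) os → All (_≤ 2) os → pow-sum os + 4 ≡ 4 * 2 ^ length os
      pow-2 [] [] [] = refl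
      pow-2 (o ∷ os) (p ∷ ps) (p′ ∷ ps′) with ≤-antisym p′ p
      ... | refl = trans (cong (λ i → 2 ^ i + pow-sum os + 4) (+-comm (length os) 2)) (trans (lem₁ (2 ^ (2 + length os)) (pow-sum os))
          (trans (cong (2 ^ (2 + length os) +_) (pow-2 os ps ps′)) (lem₅ (2 ^ length os))))
        where
        lem₁ : ∀ a b → a + b + 4 ≡ a + (b + 4)
        lem₁ = solve-∀
        lem₅ : ∀ a → 2 * (2 * a) + 4 * a ≡ 4 * (2 * a)
        lem₅ = solve-∀
      lem₁ : ∀ a b → a + b + 4 ≡ a + (b + 4)
      lem₁ = solve-∀
      lem₂ : ∀ a → 2 * (2 * a) + 4 * a ≡ 2 * (2 * a) + 2 * (2 * a)
      lem₂ = solve-∀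
      lem₃ : ∀ n → 2 + 2 * n ≡ suc n + suc n
      lem₃ = solve-∀

    map-AllPairs : ∀ (f : V → ℕ) {Q} → AllPairs (λ u v → f u ≤ f v) Q → AllPairs≤ (map f Q)
    map-AllPairs f [] = []
    map-AllPairs f (p ∷ ap) = All.map⁺ p ∷ map-AllPairs f ap

    sum-outdegs : ∀ Q R → sum (outdegs Q R) ≡ degs Q R
    sum-outdegs []      R = refl
    sum-outdegs (v ∷ Q) R = cong (deg v R +_) (sum-outdegs Q R)

  -- For x ≤ q the position tri q + x belongs to row q, so `g-row` expresses its value by 2^q + 2^x,
  -- the bound of `pow-sum-few`.
  #κ-delete-few : ∀ {Q} R → Clique Q → Sorted Q R → 1 ≤ length Q → degs Q R ≤ length Q →
    #κ (Q ++ R) ≤ #κ R + g (tri (length Q) + degs Q R)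
  #κ-delete-few {Q} R cq asc 1≤q x≤q = by≤ 0
    (+-mono-≤ (+-mono-≤ (#κ-delete R cq) few) (≤-reflexive (sym (g-row q x 1≤q x≤q))))
    (lem (#κ (Q ++ R)) q (#κ R) (pow-sum os) (2 ^ q) (2 ^ x) (g (tri q + x)))
    where
    q = length Q
    x = degs Q R
    os = outdegs Q R
    few : pow-sum os + 2 ≤ 2 ^ q + 2 ^ x
    few = subst₂ (λ i j → pow-sum os + 2 ≤ 2 ^ i + 2 ^ j) (length-map (λ v → deg v R) Q) (sum-outdegs Q R)
            (pow-sum-few os (map-AllPairs _ asc))
    lem : ∀ k q r p a b g → k + (r + p + (a + b) + (g + (q + 2))) + 0 ≡ r + g + (k + q + (p + 2) + (a + b))
    lem = solve-∀

  -- The bound 2^degree is too weak for the vertices deleted first, whose neighbourhoods still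
  -- contain most of the clique. As the clique is maximum, `turán` applies to them; doing so for two
  -- vertices suffices.
  module TwoFront (v w : V) (Q R : List V) (cq : Clique (v ∷ w ∷ Q)) (ω≤ : ω (v ∷ w ∷ Q ++ R) ≤ suc (suc (length Q))) where
    private
      t = length Q
      adj-v : Joined v (w ∷ Q)
      adj-v = AllPairs.head cq
      adj-w : Joined w Q
      adj-w = AllPairs.head (AllPairs.tail cq)
      cQ : Clique Q
      cQ = AllPairs.tail (AllPairs.tail cq)
      N₁ N₂ : List V
      N₁ = nbrs v (w ∷ Q ++ R)
      N₂ = nbrs w (Q ++ R)
      len₁ : length N₁ ≡ suc t + deg v R
      len₁ = length-nbrs-clique R adj-v
      len₂ : length N₂ ≡ t + deg w R
      len₂ = length-nbrs-clique R adj-w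
      ω₁ : ω N₁ ≤ suc t
      ω₁ = s≤s⁻¹ (≤-trans (ω-nbrs v (w ∷ Q ++ R)) ω≤)
      ω₂ : ω N₂ ≤ suc t
      ω₂ = s≤s⁻¹ (≤-trans (ω-nbrs w (Q ++ R)) (≤-trans (ω-tail v (w ∷ Q ++ R)) ω≤))

    c₁ c₂ : ℕ
    c₁ = #cl N₁
    c₂ = #cl N₂

    bound₁ : ∀ j → deg v R ≤ j → 2 ^ j * c₁ ≤ 2 ^ suc t * 3 ^ j
    bound₁ j le = turán _ N₁ (suc t) j ≤-refl (≤-trans (≤-reflexive len₁) (+-monoʳ-≤ (suc t) le)) ω₁

    -- v is already gone when w is deleted, so the neighbourhood of w has one clique vertex less,
    -- and one outside neighbour comes free.
    bound₂ : ∀ j → deg w R ≤ suc j → 2 ^ j * c₂ ≤ 2 ^ suc t * 3 ^ j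
    bound₂ j le = turán _ N₂ (suc t) j ≤-refl
      (≤-trans (≤-reflexive len₂) (≤-trans (+-monoʳ-≤ t le) (≤-reflexive (+-suc t j)))) ω₂

    bound₂′ : deg w R ≡ 0 → c₂ ≤ 2 ^ t
    bound₂′ eq = #cl≤ N₂ (≤-reflexive (trans len₂ (trans (cong (t +_) eq) (+-identityʳ t))))

    #κ-front : #κ (v ∷ w ∷ Q ++ R) + suc (suc t) ≤ #κ R + (pow-sum (outdegs Q R) + c₂ + c₁)
    #κ-front = by≤ 0
      (+-mono-≤ (#κ-delete R cQ) (≤-reflexive (cong₂ _+_ (#κ-∷ v (w ∷ Q ++ R)) (#κ-∷ w (Q ++ R)))))
      (lem (#κ (v ∷ w ∷ Q ++ R)) (#κ (w ∷ Q ++ R)) (#κ (Q ++ R)) t (#κ R) (pow-sum (outdegs Q R)) c₁ c₂)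
      where
      lem : ∀ a b c t r p c₁ c₂ → a + suc (suc t) + (r + p + (b + c₁ + (c + c₂))) + 0
                               ≡ r + (p + c₂ + c₁) + (c + t + (a + 1 + (b + 1)))
      lem = solve-∀

  private
    combine : ∀ k A B Γ D E → A ≤ B + Γ → k * Γ + D ≤ E → k * A + D ≤ k * B + E
    combine k A B Γ D E h₁ h₂ = begin
      k * A + D ≤⟨ +-monoˡ-≤ D (*-monoʳ-≤ k h₁) ⟩
      k * (B + Γ) + D ≡⟨ lem k B Γ D ⟩
      k * B + (k * Γ + D) ≤⟨ +-monoʳ-≤ (k * B) h₂ ⟩
      k * B + E ∎
      where
      open ≤-Reasoning
      lem : ∀ k B Γ D → k * (B + Γ) + D ≡ k * B + (k * Γ + D)
      lem = solve-∀

  -- The colex value at tri (q+1) + y is 2^(q+1) + 2^y - (q + 3). With q + 4 here the deletion loses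
  -- strictly less, as `strict-two` concludes.
  #κ-delete-two : ∀ v w Q R y → let q = suc (suc (length Q)) in
    Clique (v ∷ w ∷ Q) → Sorted (v ∷ w ∷ Q) R → ω (v ∷ w ∷ Q ++ R) ≤ q →
    All (λ u → deg u R ≤ 2) (v ∷ w ∷ Q) → degs (v ∷ w ∷ Q) R ≡ q + y →
    #κ (v ∷ w ∷ Q ++ R) + q + 4 ≤ #κ R + (2 ^ suc q + 2 ^ y)
  #κ-delete-two v w Q R y cq ((vw ∷ av) ∷ aw ∷ asc) ω≤ (v≤ ∷ w≤ ∷ Q≤) x≡ = finish (cases (deg v R) (deg w R) refl refl vw v≤ w≤)
    where
    open TwoFront v w Q R cq ω≤
    t = length Q
    P = 2 ^ t
    os = outdegs Q R
    S = pow-sum os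
    X = degs Q R
    len-os : length os ≡ t
    len-os = length-map (λ v → deg v R) Q
    four : S + 4 ≤ 4 * P
    four = subst (λ i → S + 4 ≤ 4 * 2 ^ i) len-os (pow-sum-≤ 2 os (All.map⁺ Q≤))
    -- Ascending order fixes the outside degrees after w: ones and then twos if w has at least one,
    -- all two if w has two. This ties the remaining sums to y.
    onetwo : 1 ≤ deg w R → ∃[ y′ ] (y′ ≤ t × X ≡ t + y′ × S + 4 ≡ 2 * P + 2 * 2 ^ y′)
    onetwo 1≤ with pow-sum-12 os (map-AllPairs _ asc) (All.map⁺ (All.map (≤-trans 1≤) aw)) (All.map⁺ Q≤)
    ... | y′ , y′≤ , s , p rewrite len-os = y′ , y′≤ , trans (sym (sum-outdegs Q R)) s , p
    alltwo : deg w R ≡ 2 → X ≡ t + t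
    alltwo eq = go aw Q≤
      where
      go : ∀ {L} → All (λ u → deg w R ≤ deg u R) L → All (λ u → deg u R ≤ 2) L → degs L R ≡ length L + length L
      go [] [] = refl
      go {u ∷ L} (p ∷ ps) (p′ ∷ ps′) = trans (cong₂ _+_ (≤-antisym p′ (subst (_≤ deg u R) eq p)) (go ps ps′)) (lem (length L))
        where
        lem : ∀ n → 2 + (n + n) ≡ suc n + suc n
        lem = solve-∀
    finish : S + c₂ + c₁ + 4 ≤ 8 * P + 2 ^ y → #κ (v ∷ w ∷ Q ++ R) + suc (suc t) + 4 ≤ #κ R + (2 ^ suc (suc (suc t)) + 2 ^ y)
    finish h = by≤ 0 (+-mono-≤ #κ-front h) (lem (#κ (v ∷ w ∷ Q ++ R)) (suc (suc t)) (#κ R) (S + c₂ + c₁) P (2 ^ y))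
      where
      lem : ∀ a q r s p y → a + q + 4 + (r + s + (8 * p + y)) + 0 ≡ r + (2 * (2 * (2 * p)) + y) + (a + q + (s + 4))
      lem = solve-∀
    y-is : ∀ {o₁ o₂ s} → deg v R ≡ o₁ → deg w R ≡ o₂ → X ≡ s → o₁ + (o₂ + s) ≡ suc (suc t) + y
    y-is refl refl refl = x≡
    cases : ∀ o₁ o₂ → deg v R ≡ o₁ → deg w R ≡ o₂ → deg v R ≤ deg w R → deg v R ≤ 2 → deg w R ≤ 2 →
      S + c₂ + c₁ + 4 ≤ 8 * P + 2 ^ y
    cases 2 2 e₁ e₂ _ p₁ p₂ = subst (λ i → S + c₂ + c₁ + 4 ≤ 8 * P + 2 ^ i) y≡ (case-22 S c₁ c₂ P four (bound₁ 2 p₁) (bound₂ 1 p₂))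
      where
      y≡ : suc (suc t) ≡ y
      y≡ = +-cancelˡ-≡ (suc (suc t)) _ _ (trans (lem t) (y-is e₁ e₂ (alltwo e₂)))
        where
        lem : ∀ t → suc (suc t) + suc (suc t) ≡ 2 + (2 + (t + t))
        lem = solve-∀
    cases 1 2 e₁ e₂ _ _ p₂ =
      subst (λ i → S + c₂ + c₁ + 4 ≤ 8 * P + 2 ^ i) y≡ (case-12 S c₁ c₂ P four (bound₁ 1 (≤-reflexive e₁)) (bound₂ 1 p₂))
      where
      y≡ : suc t ≡ y
      y≡ = +-cancelˡ-≡ (suc (suc t)) _ _ (trans (lem t) (y-is e₁ e₂ (alltwo e₂)))
        where
        lem : ∀ t → suc (suc t) + suc t ≡ 1 + (2 + (t + t))
        lem = solve-∀
    cases 0 2 e₁ e₂ _ _ p₂ =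
      subst (λ i → S + c₂ + c₁ + 4 ≤ 8 * P + 2 ^ i) y≡ (case-02 S c₁ c₂ P four (bound₁ 0 (≤-reflexive e₁)) (bound₂ 1 p₂))
      where
      y≡ : t ≡ y
      y≡ = +-cancelˡ-≡ (suc (suc t)) _ _ (y-is e₁ e₂ (alltwo e₂))
    cases 1 1 e₁ e₂ _ _ _ with onetwo (≤-reflexive (sym e₂))
    ... | y′ , y′≤ , X≡ , S≡ =
      subst (λ i → S + c₂ + c₁ + 4 ≤ 8 * P + 2 ^ i) y≡
        (case-11 S c₁ c₂ P (2 ^ y′) S≡ (pow-mono y′≤) (bound₁ 1 (≤-reflexive e₁)) (bound₂ 0 (≤-reflexive e₂)))
      where
      y≡ : y′ ≡ y
      y≡ = +-cancelˡ-≡ (suc (suc t)) _ _ (y-is e₁ e₂ X≡)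
    cases 0 1 e₁ e₂ _ _ _ with onetwo (≤-reflexive (sym e₂))
    ... | y′ , y′≤ , X≡ , S≡ = case-01 S c₁ c₂ P (2 ^ y) (trans S≡ (cong (λ i → 2 * P + 2 * 2 ^ i) y≡)) (pow-mono (subst (_≤ t) y≡ y′≤))
                                 (bound₁ 0 (≤-reflexive e₁)) (bound₂ 0 (≤-reflexive e₂))
      where
      y≡ : y′ ≡ suc y
      y≡ = +-cancelˡ-≡ (suc t) _ _ (trans (y-is e₁ e₂ X≡) (sym (+-suc (suc t) y)))
    cases 0 0 e₁ e₂ _ _ _ = case-00 S c₁ c₂ P (2 ^ y) four (bound₁ 0 (≤-reflexive e₁)) (bound₂′ e₂)
    cases 1 0 e₁ e₂ le _ _ = ⊥-elim (1+n≰n (subst₂ _≤_ e₁ e₂ le))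
    cases 2 0 e₁ e₂ le _ _ = ⊥-elim (n≮0 (subst₂ _≤_ e₁ e₂ le))
    cases 2 1 e₁ e₂ le _ _ = ⊥-elim (1+n≰n (subst₂ _≤_ e₁ e₂ le))
    cases (suc (suc (suc o))) _ e₁ _ _ p₁ _ with subst (_≤ 2) e₁ p₁
    ... | s≤s (s≤s ())
    cases _ (suc (suc (suc o))) _ e₂ _ _ p₂ with subst (_≤ 2) e₂ p₂
    ... | s≤s (s≤s ())

  -- 68/4 = 8 + 9/2 + 9/2: the geometric series for Q, and Turán bounds for v and w.
  #κ-delete-three : ∀ v w Q R → Clique (v ∷ w ∷ Q) → ω (v ∷ w ∷ Q ++ R) ≤ suc (suc (length Q)) →
    deg v R ≤ 2 → deg w R ≤ 3 → All (λ u → deg u R ≤ 3) Q →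
    4 * (#κ (v ∷ w ∷ Q ++ R) + suc (suc (length Q))) + 32 ≤ 4 * #κ R + 68 * 2 ^ length Q
  #κ-delete-three v w Q R cq ω≤ v≤ w≤ Q≤ = combine 4 _ (#κ R) S′ 32 (68 * P) #κ-front (case-3 (pow-sum (outdegs Q R)) c₁ c₂ P eight (bound₁ 2 v≤) (bound₂ 2 w≤))
    where
    open TwoFront v w Q R cq ω≤
    P = 2 ^ length Q
    S′ = pow-sum (outdegs Q R) + c₂ + c₁
    eight : pow-sum (outdegs Q R) + 8 ≤ 8 * 2 ^ length Q
    eight = subst (λ i → pow-sum (outdegs Q R) + 8 ≤ 8 * 2 ^ i) (length-map (λ v → deg v R) Q) (pow-sum-≤ 3 (outdegs Q R) (All.map⁺ Q≤))

  -- 154/8 = 8 + 27/4 + 9/2, the second term for v with three outside neighbours.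
  #κ-delete-allthree : ∀ v w Q R → Clique (v ∷ w ∷ Q) → ω (v ∷ w ∷ Q ++ R) ≤ suc (suc (length Q)) →
    All (λ u → deg u R ≤ 3) (v ∷ w ∷ Q) →
    8 * (#κ (v ∷ w ∷ Q ++ R) + suc (suc (length Q))) + 64 ≤ 8 * #κ R + 154 * 2 ^ length Q
  #κ-delete-allthree v w Q R cq ω≤ (v≤ ∷ w≤ ∷ Q≤) = combine 8 _ (#κ R) S′ 64 (154 * P) #κ-front (case-33 (pow-sum (outdegs Q R)) c₁ c₂ P eight (bound₁ 3 v≤) (bound₂ 2 w≤))
    where
    open TwoFront v w Q R cq ω≤
    P = 2 ^ length Q
    S′ = pow-sum (outdegs Q R) + c₂ + c₁
    eight : pow-sum (outdegs Q R) + 8 ≤ 8 * 2 ^ length Q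
    eight = subst (λ i → pow-sum (outdegs Q R) + 8 ≤ 8 * 2 ^ i) (length-map (λ v → deg v R) Q) (pow-sum-≤ 3 (outdegs Q R) (All.map⁺ Q≤))

  -- Averaging over the orders of deletion

  MaxDeg : ℕ → List V → Set
  MaxDeg r L = All (λ v → deg v L ≤ r) L

  MaxDeg-↭ : ∀ {r L M} → L ↭ M → MaxDeg r L → MaxDeg r M
  MaxDeg-↭ q all = All.map (λ {v} → subst (_≤ _) (deg-↭ v q)) (All-resp-↭ q all)

  MaxDeg-++ʳ : ∀ {r} Q R → MaxDeg r (Q ++ R) → MaxDeg r R
  MaxDeg-++ʳ Q R all = All.map (λ {v} le → ≤-trans (m≤n+m (deg v R) (deg v Q)) (≤-trans (≤-reflexive (sym (deg-++ v Q R))) le)) (++⁻ʳ Q all)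

  -- Deleting the vertices in a suitable order achieves the average, over all orders, of the sum of ε (degree at deletion).
  module Averaging (r : ℕ) (ε : ℕ → ℕ) (ε-0 : ε 0 ≡ 0) (ε-ratio : ∀ i → suc i ≤ r → suc i * ε i ≤ i * ε (suc i))
    (Γ p : ℕ) (few : ∀ v L → ω (v ∷ L) ≤ suc p → deg v L ≤ r → Γ * #cl (nbrs v L) ≤ Γ + ε (deg v L)) where
    open Potential r ε ε-0 ε-ratio

    private
      -- Summed over all v, both sides agree by `key` and an exchange of summation. The right side
      -- is how far the total potential falls when v is deleted, so some vertex costs no more than
      -- it releases.
      cheap-vertex : ∀ x L → MaxDeg r (x ∷ L) → let X = x ∷ L in
        ∃[ v ] (v ∈ X × M * ε (deg v X) ≤ ψ (deg v X) + ∑ (λ u → b2n (v ~ u) * ∇ (deg u X)) X)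
      cheap-vertex x L max = pigeonhole _ _ x L (≤-reflexive (begin
        ∑ (λ v → M * ε (D v)) X ≡⟨ ∑-congᴬ (All.map (λ {v} le → trans (key (D v) le)
                                                              (cong (λ s → ψ (D v) + s * ∇ (D v)) (∑-cong X (λ u → cong b2n (~-sym v u))))) max) ⟩
        ∑ (λ v → ψ (D v) + ∑ (λ u → b2n (u ~ v)) X * ∇ (D v)) X
                                                         ≡⟨ ∑-cong X (λ v → cong (ψ (D v) +_) (∑-*ʳ (∇ (D v)) (λ u → b2n (u ~ v)) X)) ⟩
        ∑ (λ v → ψ (D v) + ∑ (λ u → b2n (u ~ v) * ∇ (D v)) X) X
                                                         ≡⟨ ∑-+ (λ v → ψ (D v)) (λ v → ∑ (λ u → b2n (u ~ v) * ∇ (D v)) X) X ⟩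
        ∑ (λ v → ψ (D v)) X + ∑ (λ v → ∑ (λ u → b2n (u ~ v) * ∇ (D v)) X) X
                                                         ≡⟨ cong (∑ (λ v → ψ (D v)) X +_) (∑-exchange (λ v u → b2n (u ~ v) * ∇ (D v)) X X) ⟩
        ∑ (λ v → ψ (D v)) X + ∑ (λ v → ∑ (λ u → b2n (v ~ u) * ∇ (D u)) X) X
                                                         ≡⟨ ∑-+ (λ v → ψ (D v)) (λ v → ∑ (λ u → b2n (v ~ u) * ∇ (D u)) X) X ⟨
        ∑ (λ v → ψ (D v) + ∑ (λ u → b2n (v ~ u) * ∇ (D u)) X) X ∎))
        where
        open ≡-Reasoning
        X = x ∷ L
        D : V → ℕ
        D v = deg v X
        ∑-congᴬ : ∀ {f h : V → ℕ} {L} → All (λ v → f v ≡ h v) L → ∑ f L ≡ ∑ h L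
        ∑-congᴬ [] = refl
        ∑-congᴬ (e ∷ es) = cong₂ _+_ e (∑-congᴬ es)
        ∑-*ʳ : ∀ k (f : V → ℕ) L → ∑ f L * k ≡ ∑ (λ v → f v * k) L
        ∑-*ʳ k f [] = refl
        ∑-*ʳ k f (v ∷ L) = trans (*-distribʳ-+ k (f v) (∑ f L)) (cong (f v * k +_) (∑-*ʳ k f L))

      -- A neighbour of v loses one from its degree and so releases `∇`; the other vertices keep
      -- their potential.
      relax : ∀ v L {S} → All (λ u → deg u (v ∷ L) ≤ r) S →
        ∑ (λ u → ψ (deg u L)) S + ∑ (λ u → b2n (v ~ u) * ∇ (deg u (v ∷ L))) S ≤ ∑ (λ u → ψ (deg u (v ∷ L))) S
      relax v L {S} all = ≤-trans (≤-reflexive (sym (∑-+ (λ u → ψ (deg u L)) (λ u → b2n (v ~ u) * ∇ (deg u (v ∷ L))) S)))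
                            (∑-mono S (All.map (λ {u} → point u) all))
        where
        point : ∀ u → deg u (v ∷ L) ≤ r → ψ (deg u L) + b2n (v ~ u) * ∇ (deg u (v ∷ L)) ≤ ψ (deg u (v ∷ L))
        point u le rewrite ~-sym u v with v ~ u
        ... | true  = ≤-reflexive (trans (cong (ψ (deg u L) +_) (+-identityʳ _)) (sym (ψ-suc (deg u L) le)))
        ... | false = ≤-reflexive (+-identityʳ _)

    potential : ∀ n L → length L ≤ n → ω L ≤ suc p → MaxDeg r L → M * (Γ * #κ L) ≤ ∑ (λ v → ψ (deg v L)) L
    potential n [] _ _ _ = ≤-reflexive (trans (cong (M *_) (*-zeroʳ Γ)) (*-zeroʳ M))
    potential (suc n) (x ∷ L₀) len ω≤ max with cheap-vertex x L₀ max
    ... | v , v∈ , cheap with ∈-split v∈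
    ...   | L , q = begin
      M * (Γ * #κ X) ≡⟨ cong (λ k → M * (Γ * k)) (#κ-↭ q) ⟩
      M * (Γ * #κ (v ∷ L)) ≤⟨ scale M κ≤ ⟩
      M * (Γ * #κ L + ε δ) ≡⟨ *-distribˡ-+ M (Γ * #κ L) (ε δ) ⟩
      M * (Γ * #κ L) + M * ε δ ≤⟨ +-mono-≤ ih cheap′ ⟩
      ∑ (λ u → ψ (deg u L)) L + (ψ δ + ∑ (λ u → b2n (v ~ u) * ∇ (deg u (v ∷ L))) L)
                                        ≡⟨ lem (∑ (λ u → ψ (deg u L)) L) (ψ δ) _ ⟩
      ψ δ + (∑ (λ u → ψ (deg u L)) L + ∑ (λ u → b2n (v ~ u) * ∇ (deg u (v ∷ L))) L)
                                        ≤⟨ +-monoʳ-≤ (ψ δ) (relax v L (All.tail max′)) ⟩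
      ψ δ + ∑ (λ u → ψ (deg u (v ∷ L))) L ≡⟨ cong (λ s → ψ s + ∑ (λ u → ψ (deg u (v ∷ L))) L) (sym (deg-self v L)) ⟩
      ∑ (λ u → ψ (deg u (v ∷ L))) (v ∷ L) ≡⟨ ∑-↭ _ q ⟨
      ∑ (λ u → ψ (deg u (v ∷ L))) X ≡⟨ ∑-cong X (λ u → cong ψ (deg-↭ u q)) ⟨
      ∑ (λ u → ψ (deg u X)) X ∎
      where
      open ≤-Reasoning
      X = x ∷ L₀
      δ = deg v L
      max′ : MaxDeg r (v ∷ L)
      max′ = MaxDeg-↭ q max
      ω′ : ω (v ∷ L) ≤ suc p
      ω′ = subst (_≤ suc p) (ω-↭ q) ω≤
      ih : M * (Γ * #κ L) ≤ ∑ (λ u → ψ (deg u L)) L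
      ih = potential n L (s≤s⁻¹ (subst (_≤ suc n) (↭-length q) len)) (≤-trans (ω-tail v L) ω′) (MaxDeg-++ʳ (v ∷ []) L max′)
      κ≤ : Γ * #κ (v ∷ L) ≤ Γ * #κ L + ε δ
      κ≤ = by≤ 0 (few v L ω′ (subst (_≤ r) (deg-self v L) (All.head max′)) ⊞ ≤-reflexive (cong (Γ *_) (#κ-∷ v L)))
             (lem₀ Γ (#κ (v ∷ L)) (#κ L) (#cl (nbrs v L)) (ε δ))
        where
        lem₀ : ∀ Γ a b c e → Γ * a + (Γ + e + Γ * (b + c)) + 0 ≡ Γ * b + e + (Γ * c + Γ * (a + 1))
        lem₀ = solve-∀
      cheap′ : M * ε δ ≤ ψ δ + ∑ (λ u → b2n (v ~ u) * ∇ (deg u (v ∷ L))) L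
      cheap′ = subst₂ _≤_ (cong (λ d → M * ε d) dv)
        (cong₂ (λ d s → ψ d + s) dv (trans (∑-cong X (λ u → cong (λ d → b2n (v ~ u) * ∇ d) (deg-↭ u q)))
          (trans (∑-↭ _ q) (cong (λ b → b2n b * ∇ (deg v (v ∷ L)) + ∑ (λ u → b2n (v ~ u) * ∇ (deg u (v ∷ L))) L) (~-irr v))))) cheap
        where
        dv : deg v X ≡ δ
        dv = trans (deg-↭ v q) (deg-self v L)
      lem : ∀ a b c → a + (b + c) ≡ b + (a + c)
      lem = solve-∀

    -- `ψ-linear` bounds the potential of a vertex by a fixed multiple of its degree, and the
    -- degrees sum to twice the number of edges.
    average : ∀ L → ω L ≤ suc p → MaxDeg r L → tri (suc r) * (Γ * #κ L) ≤ #e L * E r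
    average L ω≤ max = *-cancelˡ-≤ 2 (*-cancelˡ-≤ M {{>-nonZero 1≤M}} (begin
      M * (2 * (tri (suc r) * (Γ * #κ L))) ≡⟨ lem₁ M (tri (suc r)) (Γ * #κ L) ⟩
      (tri (suc r) + tri (suc r)) * (M * (Γ * #κ L)) ≡⟨ cong (_* (M * (Γ * #κ L))) (tri-double r) ⟩
      (suc r * r) * (M * (Γ * #κ L)) ≤⟨ scale (suc r * r) (potential _ L ≤-refl ω≤ max) ⟩
      (suc r * r) * ∑ (λ v → ψ (deg v L)) L ≡⟨ ∑-*ˡ (suc r * r) (λ v → ψ (deg v L)) L ⟨
      ∑ (λ v → (suc r * r) * ψ (deg v L)) L ≤⟨ ∑-mono L (All.map (λ {v} → ψ-linear (deg v L)) max) ⟩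
      ∑ (λ v → deg v L * (M * E r)) L ≡⟨ ∑-cong L (λ v → *-comm (deg v L) (M * E r)) ⟩
      ∑ (λ v → (M * E r) * deg v L) L ≡⟨ ∑-*ˡ (M * E r) (λ v → deg v L) L ⟩
      (M * E r) * ∑ (λ v → deg v L) L ≡⟨ cong (M * E r *_) (handshake L) ⟩
      (M * E r) * (#e L + #e L) ≡⟨ lem₂ M (E r) (#e L) ⟩
      M * (2 * (#e L * E r)) ∎))
      where
      open ≤-Reasoning
      lem₁ : ∀ m t k → m * (2 * (t * k)) ≡ (t + t) * (m * k)
      lem₁ = solve-∀
      lem₂ : ∀ m e x → (m * e) * (x + x) ≡ m * (2 * (x * e))
      lem₂ = solve-∀

  -- A clique in a neighbourhood extends by its centre, so ω ≤ p + 1 leaves clique number at most p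
  -- there, on at most p + j vertices.
  turán-average : ∀ p j (1≤p : 1 ≤ p) L → ω L ≤ suc p → MaxDeg (j + p) L →
    tri (suc (j + p)) * (2 ^ j * #κ L) ≤ #e L * TuránScale.E p j 1≤p (j + p)
  turán-average p j 1≤p = Averaging.average (j + p) ε ε-0 ε-ratio Γ p few
    where
    open TuránScale p j 1≤p
    few : ∀ v L → ω (v ∷ L) ≤ suc p → deg v L ≤ j + p → Γ * #cl (nbrs v L) ≤ Γ + ε (deg v L)
    few v L ω≤ le = ≤-trans bound (≤-reflexive (trans (sym (ε+Γ (deg v L) le)) (+-comm (ε (deg v L)) Γ)))
      where
      N = nbrs v L
      bound : Γ * #cl N ≤ σ (deg v L)
      bound with deg v L ≤? p
      ... | yes d≤p = ≤-trans (scale Γ (#cl≤ N (≤-reflexive (length-nbrs v L)))) (≤-reflexive (sym (σ-low (deg v L) d≤p)))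
      -- Turán's bound for degree p + s is at scale 2^s; the factor 2^j′ with s + j′ = j brings it
      -- to the common scale Γ.
      ... | no  d≰p = subst (λ d → Γ * #cl N ≤ σ d) s+p (begin
        Γ * #cl N ≡⟨ cong (λ k → 2 ^ k * #cl N) s+j ⟨
        2 ^ (s + j′) * #cl N ≡⟨ cong (_* #cl N) (^-distribˡ-+-* 2 s j′) ⟩
        2 ^ s * 2 ^ j′ * #cl N ≡⟨ lem₁ (2 ^ s) (2 ^ j′) (#cl N) ⟩
        2 ^ j′ * (2 ^ s * #cl N) ≤⟨ scale (2 ^ j′) (turán _ N p s ≤-refl len (s≤s⁻¹ (≤-trans (ω-nbrs v L) ω≤))) ⟩
        2 ^ j′ * (2 ^ p * 3 ^ s) ≡⟨ lem₂ (2 ^ j′) (2 ^ p) (3 ^ s) ⟩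
        2 ^ p * (2 ^ j′ * 3 ^ s) ≡⟨ σ-high s j′ s+j ⟨
        σ (s + p) ∎)
        where
        open ≤-Reasoning
        s = deg v L ∸ p
        s+p : s + p ≡ deg v L
        s+p = m∸n+n≡m (<⇒≤ (≰⇒> d≰p))
        j′ = j ∸ s
        s+j : s + j′ ≡ j
        s+j = m+[n∸m]≡n (+-cancelʳ-≤ p s j (subst (_≤ j + p) (sym s+p) le))
        len : length N ≤ p + s
        len = ≤-reflexive (trans (length-nbrs v L) (trans (sym s+p) (+-comm s p)))
        lem₁ : ∀ a b c → a * b * c ≡ b * (a * c)
        lem₁ = solve-∀
        lem₂ : ∀ a b c → a * (b * c) ≡ b * (a * c)
        lem₂ = solve-∀

  -- The strict bound when no clique has more than r vertices

  2≤ω : ∀ L → 1 ≤ #e L → 2 ≤ ω L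
  2≤ω (v ∷ L) 1≤ with nbrs v L in eq
  ... | []    = ≤-trans (2≤ω L (subst (1 ≤_) (trans (cong (#e L +_) (trans (sym (length-nbrs v L)) (cong length eq))) (+-identityʳ _)) 1≤)) (ω-tail v L)
  ... | u ∷ N = ≤-trans (s≤s (≤-trans (s≤s z≤n) (ω-nbrs u N))) (subst (λ M → suc (ω M) ≤ ω (v ∷ L)) eq (ω-nbrs v L))

  ω-++ʳ : ∀ Q R → ω R ≤ ω (Q ++ R)
  ω-++ʳ [] R = ≤-refl
  ω-++ʳ (v ∷ Q) R = ≤-trans (ω-++ʳ Q R) (ω-tail v (Q ++ R))

  sorted-max-clique : ∀ L → ∃[ Q ] ∃[ R ] (L ↭ Q ++ R × Clique Q × length Q ≡ ω L × Sorted Q R)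
  sorted-max-clique L with max-clique _ L ≤-refl
  ... | Q , R , q , cq , lq with sort (λ v → deg v R) Q
  ...   | Q′ , s , asc = Q′ , R , ↭-trans q (++⁺ʳ R s) , Clique-↭ s cq , trans (sym (↭-length s)) lq , asc

  clique-deg : ∀ {Q} → Clique Q → All (λ v → suc (deg v Q) ≡ length Q) Q
  clique-deg [] = []
  clique-deg {v ∷ Q} (pv ∷ cq) = cong suc (trans (deg-self v Q) (deg-clique pv)) ∷
    All.zipWith (λ {u} (e , d) → trans (cong (λ b → suc (b2n b + deg u Q)) (trans (~-sym u v) e)) (cong suc d)) (pv , clique-deg cq)

  outdeg≤ : ∀ {r Q} R → Clique Q → MaxDeg r (Q ++ R) → All (λ v → deg v R + length Q ≤ suc r) Q
  outdeg≤ {r} {Q} R cq max = All.zipWith (λ {v} (d , le) → begin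
      deg v R + length Q ≡⟨ cong (deg v R +_) (sym d) ⟩
      deg v R + suc (deg v Q) ≡⟨ lem (deg v R) (deg v Q) ⟩
      suc (deg v Q + deg v R) ≡⟨ cong suc (deg-++ v Q R) ⟨
      suc (deg v (Q ++ R)) ≤⟨ s≤s le ⟩
      suc r ∎) (clique-deg cq , ++⁻ˡ Q max)
    where
    open ≤-Reasoning
    lem : ∀ a b → a + suc b ≡ suc (b + a)
    lem = solve-∀

  degs≤ : ∀ {k} Q R → All (λ v → deg v R ≤ k) Q → degs Q R ≤ length Q * k
  degs≤ {k} Q R all = ≤-trans (∑-mono Q all) (≤-reflexive (∑-const k Q))

  #e-delete : ∀ {Q} R → Clique Q → #e (Q ++ R) ≡ tri (length Q) + degs Q R + #e R
  #e-delete {Q} R cq = trans (#e-++ Q R) (cong (λ k → k + degs Q R + #e R) (#e-clique cq))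

  module Deletion (r : ℕ) where
    private
      N : ℕ
      N = tri (suc r)

    Bounded : List V → Set
    Bounded R = ∀ a b → #e R ≡ a * N + b → b < N → #κ R ≤ a * g N + g b

    -- Restricted to a ≥ 1, because at a = 0 the colex graphs attain the bound.
    StrictlyBounded : List V → Set
    StrictlyBounded R = ∀ a b → #e R ≡ a * N + b → b < N → 1 ≤ a → #κ R < a * g N + g b

    strict⇒bounded : ∀ {R} → StrictlyBounded R → Bounded R
    strict⇒bounded {R} ih zero b e b<N = subst (λ k → #κ R ≤ g k) e (kruskal-katona _ R ≤-refl)
    strict⇒bounded ih (suc a) b e b<N = <⇒≤ (ih (suc a) b e b<N (s≤s z≤n))

    residual : ∀ Q R {s m} → Clique Q → #e R ≡ s → #e (Q ++ R) ≡ m → s + (tri (length Q) + degs Q R) ≡ m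
    residual Q R cq refl e≡ = trans (+-comm (#e R) _) (trans (sym (#e-delete R cq)) e≡)

    -- The deletion itself is strict, so a weak bound on R is enough.
    strict-deletion : ∀ Q R → Bounded R → tri (length Q) + degs Q R ≤ N → Clique Q →
      #κ (Q ++ R) < #κ R + g (tri (length Q) + degs Q R) → StrictlyBounded (Q ++ R)
    strict-deletion Q R ih e≤N cq κ< a b e≡ b<N _ with divide N (≤-trans (s≤s z≤n) b<N) (#e R)
    ... | a′ , b′ , eR , b′<N = ≤-trans κ< (≤-trans (+-monoˡ-≤ _ (ih a′ b′ eR b′<N))
            (extremal-super r a b a′ b′ _ b<N b′<N e≤N (residual Q R cq eR e≡)))

    -- The deletion bound can be an equality here. Strictness comes from R if R has at least N
    -- edges, and otherwise from `extremal-super<`.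
    few-deletion : ∀ Q R → StrictlyBounded R → tri (length Q) + degs Q R < N → Clique Q → Sorted Q R →
      1 ≤ length Q → degs Q R ≤ length Q → StrictlyBounded (Q ++ R)
    few-deletion Q R ih e<N cq asc 1≤q x≤q a b e≡ b<N 1≤a with divide N (≤-trans (s≤s z≤n) b<N) (#e R)
    ... | zero , b′ , eR , b′<N = ≤-trans (s≤s (≤-trans (#κ-delete-few R cq asc 1≤q x≤q)
            (+-monoˡ-≤ _ (subst (λ k → #κ R ≤ g k) eR (kruskal-katona _ R ≤-refl)))))
            (extremal-super< r a b b′ _ b<N b′<N e<N 1≤a (residual Q R cq eR e≡))
    ... | suc a′ , b′ , eR , b′<N = ≤-trans (s≤s (#κ-delete-few R cq asc 1≤q x≤q))
            (≤-trans (+-monoˡ-≤ _ (ih (suc a′) b′ eR b′<N (s≤s z≤n)))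
              (extremal-super r a b (suc a′) b′ _ b<N b′<N (<⇒≤ e<N)
                (residual Q R cq eR e≡)))

    -- Each vertex of Q has at most o = r + 1 - q neighbours outside. Completing Q to K_{r+1} by o
    -- new vertices takes q o edges, and the edges among the new vertices besides.
    deleted≤N : ∀ {Q} R → Clique Q → MaxDeg r (Q ++ R) → length Q ≤ suc r → tri (length Q) + degs Q R ≤ N
    deleted≤N {Q} R cq max q≤ = begin
      tri q + degs Q R ≤⟨ +-monoʳ-≤ (tri q) (degs≤ Q R (All.map (λ {v} le → +-cancelʳ-≤ q _ _ (≤-trans le (≤-reflexive (sym (trans (+-comm o q) q+o))))) (outdeg≤ R cq max))) ⟩
      tri q + q * o ≤⟨ m≤m+n _ (tri o) ⟩
      tri q + q * o + tri o ≡⟨ tri-+ q o ⟨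
      tri (q + o) ≡⟨ cong tri q+o ⟩
      N ∎
      where
      open ≤-Reasoning
      q = length Q
      o = suc r ∸ q
      q+o : q + o ≡ suc r
      q+o = m+[n∸m]≡n q≤

    -- Since q ≤ x ≤ 2q, the position tri q + x lies in row q + 1 at y = x - q, where
    -- `#κ-delete-two` makes the comparison.
    two-deletion : ∀ Q R → Clique Q → Sorted Q R → ω (Q ++ R) ≤ length Q → 2 ≤ length Q →
      All (λ v → deg v R ≤ 2) Q → length Q ≤ degs Q R → #κ (Q ++ R) < #κ R + g (tri (length Q) + degs Q R)
    two-deletion (v ∷ w ∷ Q) R cq asc ω≤ _ out q≤x =
      strict-two (#κ (v ∷ w ∷ Q ++ R)) q (#κ R) (2 ^ suc q + 2 ^ y) (g (tri q + x))
        (#κ-delete-two v w Q R y cq asc ω≤ out (sym x≡))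
        (sym (trans (cong (λ i → g i + (suc q + 2)) e≡) (g-row (suc q) y (s≤s z≤n) (≤-trans y≤q (n≤1+n q)))))
      where
      q = suc (suc (length Q))
      x = degs (v ∷ w ∷ Q) R
      y = x ∸ q
      x≡ : q + y ≡ x
      x≡ = m+[n∸m]≡n q≤x
      e≡ : tri q + x ≡ tri (suc q) + y
      e≡ = trans (cong (tri q +_) (sym x≡)) (sym (+-assoc (tri q) q y))
      y≤q : y ≤ q
      y≤q = +-cancelˡ-≤ q _ _ (≤-trans (≤-reflexive x≡) (≤-trans (degs≤ (v ∷ w ∷ Q) R out) (≤-reflexive (lem q))))
        where
        lem : ∀ q → q * 2 ≡ q + q
        lem = solve-∀
    two-deletion [] R _ _ _ () _ _
    two-deletion (_ ∷ []) R _ _ _ (s≤s ()) _ _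

  -- Here r = 4 + t, q = r - 2 and a = 1, with a remainder too small for averaging. If the least
  -- outside degree is at most 2, the Turán bound for v saves enough; if all are 3, so many edges
  -- leave with Q that R is small.
  three-deletion : ∀ t Q R b → length Q ≡ 2 + t → Clique Q → Sorted Q R → ω (Q ++ R) ≤ length Q →
    All (λ v → deg v R ≤ 3) Q → 3 + t ≤ degs Q R → #e (Q ++ R) ≡ tri (5 + t) + b → b < tri (3 + t) →
    #κ (Q ++ R) < g (tri (5 + t)) + g b
  three-deletion .(length Q) (v ∷ w ∷ Q) R b refl cq asc@((vw ∷ av) ∷ _) ω≤ out x> e≡ b< with deg v R ≤? 2
  ... | yes v≤ = three-lt (#κ (v ∷ w ∷ Q ++ R)) (#κ R) (g (#e R)) (g (tri (5 + t))) (g b) t (2 ^ t)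
          (#κ-delete-three v w Q R cq ω≤ v≤ (All.head (All.tail out)) (All.tail (All.tail out)))
          (kruskal-katona _ R ≤-refl) (colex-growth t b (#e R) b< eR≤)
          (trans (lem (2 ^ t)) (sym (g-tri (5 + t))))
    where
    t = length Q
    x = degs (v ∷ w ∷ Q) R
    lem : ∀ P → 32 * P ≡ 2 * (2 * (2 * (2 * (2 * P))))
    lem = solve-∀
    eR≤ : #e R ≤ b + (2 * t + 6)
    eR≤ = by≤ 0 (x> ⊞ ≤-reflexive (trans (sym (#e-delete R cq)) e≡)) (lem′ (#e R) b t x (tri (2 + t)))
      where
      lem′ : ∀ e b t x s → e + (x + (s + (2 + t) + (3 + t) + (4 + t) + b)) + 0 ≡ b + (2 * t + 6) + (3 + t + (s + x + e))
      lem′ = solve-∀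
  ... | no v≰ = allthree-lt (#κ (v ∷ w ∷ Q ++ R)) (#κ R) (g (tri (3 + t) + 2)) (g (tri (5 + t))) (g b) t (2 ^ t)
          (#κ-delete-allthree v w Q R cq ω≤ out)
          (≤-trans (kruskal-katona _ R ≤-refl) (g-mono eR≤))
          (trans (g-row (3 + t) 2 (s≤s z≤n) (s≤s (s≤s z≤n))) (lem₀ (2 ^ t)))
          (trans (lem (2 ^ t)) (sym (g-tri (5 + t))))
    where
    t = length Q
    x = degs (v ∷ w ∷ Q) R
    lem : ∀ P → 32 * P ≡ 2 * (2 * (2 * (2 * (2 * P))))
    lem = solve-∀
    lem₀ : ∀ P → 2 * (2 * (2 * P)) + 4 ≡ 8 * P + 4
    lem₀ = solve-∀
    3≤v : 3 ≤ deg v R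
    3≤v = ≰⇒> v≰
    x≥ : (2 + t) * 3 ≤ x
    x≥ = ∑-All≥ (λ u → deg u R) 3 (v ∷ w ∷ Q) (3≤v ∷ ≤-trans 3≤v vw ∷ All.map (≤-trans 3≤v) av)
    eR≤ : #e R ≤ tri (3 + t) + 2
    eR≤ = by≤ 0 (x≥ ⊞ b< ⊞ ≤-reflexive (trans (sym (#e-delete R cq)) e≡)) (lem′ (#e R) b t x (tri (2 + t)))
      where
      lem′ : ∀ e b t x s → e + (x + (s + (2 + t) + (s + (2 + t) + (3 + t) + (4 + t) + b))) + 0
                         ≡ s + (2 + t) + 2 + ((2 + t) * 3 + (suc b + (s + x + e)))
      lem′ = solve-∀

  private
    triple : ∀ a → 2 ≤ a → 2 * suc a ≤ 3 * a
    triple a 2≤a = by≤ 0 2≤a (lem a)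
      where
      lem : ∀ a → 2 * suc a + a + 0 ≡ 3 * a + 2
      lem = solve-∀

    double : ∀ a → 1 ≤ a → suc a ≤ 2 * a
    double a 1≤a = by≤ 0 1≤a (lem a)
      where
      lem : ∀ a → suc a + a + 0 ≡ 2 * a + 1
      lem = solve-∀

  -- Up to linear terms, (a+1)·(73/8)·2^p has to stay below a·16·2^p + g b. This holds for a ≥ 2,
  -- and for a = 1 once g b reaches about 4·2^p.
  average-8 : ∀ p L a b → 1 ≤ p → ω L ≤ suc p → MaxDeg (3 + p) L → #e L ≡ a * tri (4 + p) + b → b < tri (4 + p) →
    2 ≤ a ⊎ (a ≡ 1 × tri (2 + p) ≤ b) → #κ L < a * g (tri (4 + p)) + g b
  average-8 p L a b 1≤p ω≤ max e≡ b<N big = go big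
    where
    E = TuránScale.E p 3 1≤p (3 + p)
    A = g (tri (4 + p))
    P = 2 ^ p
    A≡ : 16 * P ≡ A + (4 + p + 1)
    A≡ = trans (lem P) (sym (g-tri (4 + p)))
      where
      lem : ∀ P → 16 * P ≡ 2 * (2 * (2 * (2 * P)))
      lem = solve-∀
    h : 8 * #κ L ≤ suc a * E
    h = average-cancel (tri (4 + p)) a b (8 * #κ L) E (≤-trans (s≤s z≤n) b<N) b<N
          (≤-trans (turán-average p 3 1≤p L ω≤ max) (≤-reflexive (cong (_* E) e≡)))
    go : 2 ≤ a ⊎ (a ≡ 1 × tri (2 + p) ≤ b) → #κ L < a * A + g b
    go (inj₁ 2≤a) = average-finish 16 (#κ L) a A (g b) (3 * E) (<⇒≤ 2≤a) (begin
        16 * #κ L ≡⟨ *-assoc 2 8 (#κ L) ⟩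
        2 * (8 * #κ L) ≤⟨ scale 2 h ⟩
        2 * (suc a * E) ≡⟨ *-assoc 2 (suc a) E ⟨
        2 * suc a * E ≤⟨ *-monoˡ-≤ E (triple a 2≤a) ⟩
        3 * a * E ≡⟨ lem a E ⟩
        a * (3 * E) ∎) (eight-many E A p P (E₃ p 1≤p) A≡) (s≤s z≤n)
      where
      open ≤-Reasoning
      lem : ∀ a e → 3 * a * e ≡ a * (3 * e)
      lem = solve-∀
    go (inj₂ (refl , b≥)) = *-cancelˡ-≤ 8 (begin
        8 * suc (#κ L) ≡⟨ *-suc 8 (#κ L) ⟩
        8 + 8 * #κ L ≤⟨ +-monoʳ-≤ 8 h ⟩
        8 + 2 * E ≡⟨ +-comm 8 (2 * E) ⟩
        2 * E + 8 ≤⟨ eight-one E A (g b) p P (E₃ p 1≤p) A≡ (≤-trans (≤-reflexive (trans (lem P) (sym (g-tri (2 + p))))) (+-monoˡ-≤ (2 + p + 1) (g-mono b≥))) ⟩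
        8 * A + 8 * g b ≡⟨ lem′ A (g b) ⟩
        8 * (1 * A + g b) ∎)
      where
      open ≤-Reasoning
      lem : ∀ P → 4 * P ≡ 2 * (2 * P)
      lem = solve-∀
      lem′ : ∀ a b → 8 * a + 8 * b ≡ 8 * (1 * a + b)
      lem′ = solve-∀

  -- Here (a+1)·(227/16)·2^p is compared with a·32·2^p; a + 1 ≤ 2a is enough.
  average-16 : ∀ p L a b → 1 ≤ p → ω L ≤ suc p → MaxDeg (4 + p) L → #e L ≡ a * tri (5 + p) + b → b < tri (5 + p) →
    1 ≤ a → #κ L < a * g (tri (5 + p)) + g b
  average-16 p L a b 1≤p ω≤ max e≡ b<N 1≤a = average-finish 16 (#κ L) a A (g b) (2 * E) 1≤a (begin
      16 * #κ L ≤⟨ average-cancel (tri (5 + p)) a b (16 * #κ L) E (≤-trans (s≤s z≤n) b<N) b<N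
                          (≤-trans (turán-average p 4 1≤p L ω≤ max) (≤-reflexive (cong (_* E) e≡))) ⟩
      suc a * E ≤⟨ *-monoˡ-≤ E (double a 1≤a) ⟩
      2 * a * E ≡⟨ lem a E ⟩
      a * (2 * E) ∎) (sixteen E A p P (E₄ p 1≤p) A≡) (s≤s z≤n)
    where
    open ≤-Reasoning
    E = TuránScale.E p 4 1≤p (4 + p)
    A = g (tri (5 + p))
    P = 2 ^ p
    lem : ∀ a e → 2 * a * e ≡ a * (2 * e)
    lem = solve-∀
    A≡ : 32 * P ≡ A + (5 + p + 1)
    A≡ = trans (lem′ P) (sym (g-tri (5 + p)))
      where
      lem′ : ∀ P → 32 * P ≡ 2 * (2 * (2 * (2 * (2 * P))))
      lem′ = solve-∀

  open Deletion

  private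
    out≤ : ∀ {r} k Q R → Clique Q → MaxDeg r (Q ++ R) → suc r ≤ k + length Q → All (λ v → deg v R ≤ k) Q
    out≤ k Q R cq max le = All.map (λ h → +-cancelʳ-≤ (length Q) _ _ (≤-trans h le)) (outdeg≤ R cq max)

    large-clique : ∀ r Q R → StrictlyBounded r R → Clique Q → Sorted Q R → ω (Q ++ R) ≤ length Q →
      MaxDeg r (Q ++ R) → 2 ≤ length Q → length Q ≤ r → r ≤ suc (length Q) → StrictlyBounded r (Q ++ R)
    large-clique r Q R ih cq asc ω≤ max 2≤q q≤r r≤ with degs Q R <? length Q
    ... | yes x<q = few-deletion r Q R ih
            (≤-trans (+-monoʳ-< (tri (length Q)) x<q) (tri-mono (s≤s q≤r))) cq asc (<⇒≤ 2≤q) (<⇒≤ x<q)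
    ... | no  x≮q = strict-deletion r Q R (strict⇒bounded r {R} ih) (deleted≤N r R cq max (≤-trans q≤r (n≤1+n r))) cq
            (two-deletion r Q R cq asc ω≤ 2≤q (out≤ 2 Q R cq max (s≤s r≤)) (≮⇒≥ x≮q))

    medium-clique : ∀ r t Q R → r ≡ 4 + t → length Q ≡ 2 + t → StrictlyBounded r R → Clique Q →
      Sorted Q R → ω (Q ++ R) ≤ length Q → MaxDeg r (Q ++ R) → StrictlyBounded r (Q ++ R)
    medium-clique .(4 + t) t Q R refl lq ih cq asc ω≤ max a b e≡ b<N 1≤a with 2 ≤? a
    ... | yes 2≤a = average-8 (suc t) (Q ++ R) a b (s≤s z≤n) (≤-trans ω≤ (≤-reflexive lq)) max e≡ b<N (inj₁ 2≤a)
    ... | no 2≰a with ≤-antisym (s≤s⁻¹ (≰⇒> 2≰a)) 1≤a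
    ... | refl with tri (3 + t) ≤? b
    ...   | yes b≥ = average-8 (suc t) (Q ++ R) 1 b (s≤s z≤n) (≤-trans ω≤ (≤-reflexive lq)) max e≡ b<N (inj₂ (refl , b≥))
    -- What remains is N ≤ m < N + tri (3 + t), which `average-8` does not cover.
    ...   | no b≱ with degs Q R ≤? length Q
    ...     | yes x≤q = few-deletion (4 + t) Q R ih e<N cq asc (≤-trans (s≤s z≤n) (≤-reflexive (sym lq))) x≤q 1 b e≡ b<N 1≤a
      where
      e<N : tri (length Q) + degs Q R < tri (5 + t)
      e<N = begin-strict
        tri (length Q) + degs Q R ≤⟨ +-monoʳ-≤ (tri (length Q)) x≤q ⟩
        tri (suc (length Q)) ≡⟨ cong (λ k → tri (suc k)) lq ⟩
        tri (3 + t) <⟨ m<m+n (tri (3 + t)) (s≤s z≤n) ⟩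
        tri (4 + t) ≤⟨ m≤m+n (tri (4 + t)) (4 + t) ⟩
        tri (5 + t) ∎
        where open ≤-Reasoning
    ...     | no x≰q = subst (λ A → #κ (Q ++ R) < A + g b) (sym (+-identityʳ _))
              (three-deletion t Q R b lq cq asc ω≤ (out≤ 3 Q R cq max (≤-reflexive (cong (3 +_) (sym lq))))
                (subst (λ k → suc k ≤ degs Q R) lq (≰⇒> x≰q)) (trans e≡ (cong (_+ b) (+-identityʳ _))) (≰⇒> b≱))

    small-clique : ∀ r p L → r ≡ 4 + p → ω L ≤ suc p → 2 ≤ ω L → MaxDeg r L → StrictlyBounded r L
    small-clique .(4 + p) p L refl ω≤ 2≤ω max a b e≡ b<N 1≤a = average-16 p L a b (s≤s⁻¹ (≤-trans 2≤ω ω≤)) ω≤ max e≡ b<N 1≤a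

  strictly-bounded : ∀ r n L → #e L ≤ n → ω L ≤ r → MaxDeg r L → StrictlyBounded r L
  strictly-bounded r n L e≤n ω≤r max a b e≡ b<N 1≤a with sorted-max-clique L
  ... | Q , R , q↭ , cq , lq , asc = subst (_< a * g (tri (suc r)) + g b) (sym (#κ-↭ q↭)) (go n e≤n a b e≡′ b<N 1≤a)
    where
    N = tri (suc r)
    1≤e : 1 ≤ #e L
    1≤e = begin
      1 ≤⟨ ≤-trans (s≤s z≤n) b<N ⟩
      N ≤⟨ m≤n*m N a {{>-nonZero 1≤a}} ⟩
      a * N ≤⟨ m≤m+n _ b ⟩
      a * N + b ≡⟨ e≡ ⟨
      #e L ∎
      where open ≤-Reasoning
    2≤q : 2 ≤ length Q
    2≤q = ≤-trans (2≤ω L 1≤e) (≤-reflexive (sym lq))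
    e≡′ : #e (Q ++ R) ≡ a * N + b
    e≡′ = trans (sym (#e-↭ q↭)) e≡
    max′ : MaxDeg r (Q ++ R)
    max′ = MaxDeg-↭ q↭ max
    ω≤q : ω (Q ++ R) ≤ length Q
    ω≤q = ≤-reflexive (trans (sym (ω-↭ q↭)) (sym lq))
    go : ∀ n → #e L ≤ n → StrictlyBounded r (Q ++ R)
    go zero e≤ = ⊥-elim (1+n≰n (≤-trans 1≤e e≤))
    go (suc n) e≤ = cases
      where
      eR≤ : #e R ≤ n
      eR≤ = s≤s⁻¹ (begin
        suc (#e R) ≤⟨ +-monoˡ-≤ (#e R) (≤-trans (2≤⇒1≤tri 2≤q) (m≤m+n _ (degs Q R))) ⟩
        tri (length Q) + degs Q R + #e R ≡⟨ #e-delete R cq ⟨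
        #e (Q ++ R) ≡⟨ #e-↭ q↭ ⟨
        #e L ≤⟨ e≤ ⟩
        suc n ∎)
        where open ≤-Reasoning
      ih : StrictlyBounded r R
      ih = strictly-bounded r n R eR≤ (≤-trans (ω-++ʳ Q R) (≤-trans (≤-reflexive (sym (ω-↭ q↭))) ω≤r)) (MaxDeg-++ʳ Q R max′)
      cases : StrictlyBounded r (Q ++ R)
      cases with r ≤? suc (length Q)
      ... | yes r≤ = large-clique r Q R ih cq asc ω≤q max′ 2≤q (≤-trans (≤-reflexive lq) ω≤r) r≤
      ... | no r≰ with r ≟ suc (suc (length Q))
      ...   | yes r≡ = medium-clique r (length Q ∸ 2) Q R (trans r≡ (cong (2 +_) (sym 2+t))) (sym 2+t) ih cq asc ω≤q max′
        where
        2+t : 2 + (length Q ∸ 2) ≡ length Q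
        2+t = m+[n∸m]≡n 2≤q
      ...   | no r≢ = small-clique r (r ∸ 4) (Q ++ R) (sym 4+p) (≤-trans ω≤q (s≤s⁻¹ (s≤s⁻¹ (s≤s⁻¹ (≤-trans big (≤-reflexive (sym 4+p)))))))
                        (≤-trans 2≤q (≤-trans (≤-reflexive lq) (≤-reflexive (ω-↭ q↭)))) max′
        where
        big : 3 + length Q ≤ r
        big = ≤∧≢⇒< (≰⇒> r≰) (r≢ ∘ sym)
        4+p : 4 + (r ∸ 4) ≡ r
        4+p = m+[n∸m]≡n (≤-trans (s≤s (s≤s (s≤s (≤-trans (s≤s z≤n) 2≤q)))) big)

  -- Splitting off complete components

  data Component (r : ℕ) (L : List V) : Set where
    component : ∀ Q R → L ↭ Q ++ R → Clique Q → length Q ≡ suc r → Isolated Q R → Component r L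

  -- A vertex of a clique on more than r vertices already has r neighbours inside it. So the clique
  -- has exactly r + 1 vertices and no edge leaves it.
  find-component : ∀ r L → MaxDeg r L → ω L ≤ r ⊎ Component r L
  find-component r L max with ω L ≤? r
  ... | yes p = inj₁ p
  ... | no ¬p with max-clique _ L ≤-refl
  ... | Q , R , q , cq , lq = inj₂ (component Q R q cq (≤-antisym (head-bound Q isolated (≤-trans (s≤s z≤n) q>)) q>) (All.map (λ {v} h →
          deg≡0 R (n≤0⇒n≡0 (+-cancelʳ-≤ (length Q) _ _ (≤-trans h q>)))) isolated))
    where
    q> : suc r ≤ length Q
    q> = ≤-trans (≰⇒> ¬p) (≤-reflexive (sym lq))
    isolated : All (λ v → deg v R + length Q ≤ suc r) Q
    isolated = outdeg≤ R cq (MaxDeg-↭ q max)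
    head-bound : ∀ {k} S → All (λ v → deg v R + k ≤ suc r) S → 1 ≤ length S → k ≤ suc r
    head-bound (v ∷ S) (h ∷ _) _ = ≤-trans (m≤n+m _ (deg v R)) h

  degs-none : ∀ {Q R} → Isolated Q R → degs Q R ≡ 0
  degs-none none = ∑-All≡0 (All.map deg-none none)

  #κ-disjoint : ∀ Q R → Isolated Q R → #κ (Q ++ R) ≡ #κ Q + #κ R
  #κ-disjoint [] R [] = refl
  #κ-disjoint (v ∷ Q) R (none ∷ nones) = trans (cong₂ (λ k M → k + (#cl M ∸ 1)) (#κ-disjoint Q R nones)
    (trans (filterᵇ-++ (v ~_) Q R) (trans (cong (nbrs v Q ++_) (filterᵇ-none (v ~_) none)) (++-identityʳ _))))
    (lem (#κ Q) (#κ R) (#cl (nbrs v Q) ∸ 1))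
    where
    lem : ∀ a b c → a + b + c ≡ a + c + b
    lem = solve-∀

  #e-component : ∀ {r} Q R → Clique Q → length Q ≡ suc r → Isolated Q R →
    #e (Q ++ R) ≡ tri (suc r) + #e R
  #e-component Q R cq lq none = trans (#e-delete R cq) (cong (_+ #e R)
    (trans (cong (tri (length Q) +_) (degs-none none)) (trans (+-identityʳ _) (cong tri lq))))

  #κ-component : ∀ {r} Q R → Clique Q → length Q ≡ suc r → Isolated Q R →
    #κ (Q ++ R) ≡ g (tri (suc r)) + #κ R
  #κ-component Q R cq lq none = trans (#κ-disjoint Q R none) (cong (_+ #κ R) (trans (#κ-clique cq) (cong (g ∘ tri) lq)))

  bounded : ∀ r a L b → MaxDeg r L → #e L ≡ a * tri (suc r) + b → b < tri (suc r) → #κ L ≤ a * g (tri (suc r)) + g b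
  bounded r zero L b max e≡ b<N = subst (λ k → #κ L ≤ g k) e≡ (kruskal-katona _ L ≤-refl)
  bounded r (suc a) L b max e≡ b<N with find-component r L max
  ... | inj₁ ω≤r = <⇒≤ (strictly-bounded r _ L ≤-refl ω≤r max (suc a) b e≡ b<N (s≤s z≤n))
  ... | inj₂ (component Q R q cq lq none) = begin
    #κ L ≡⟨ trans (#κ-↭ q) (#κ-component Q R cq lq none) ⟩
    A + #κ R ≤⟨ +-monoʳ-≤ A (bounded r a R b (MaxDeg-++ʳ Q R (MaxDeg-↭ q max)) eR b<N) ⟩
    A + (a * A + g b) ≡⟨ +-assoc A (a * A) (g b) ⟨
    suc a * A + g b ∎
    where
    open ≤-Reasoning
    A = g (tri (suc r))
    eR : #e R ≡ a * tri (suc r) + b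
    eR = +-cancelˡ-≡ (tri (suc r)) _ _ (trans (sym (#e-component Q R cq lq none)) (trans (sym (#e-↭ q)) (trans e≡ (+-assoc (tri (suc r)) _ b))))

  -- The removed components are recorded one by one, so that `match-peeled` can pair those of two
  -- graphs in step.
  data Peeled (r : ℕ) : ℕ → List V → List V → Set where
    done : ∀ {L} → Peeled r 0 L L
    peel : ∀ {a L R} Q M → L ↭ Q ++ M → Clique Q → length Q ≡ suc r → Isolated Q M →
           Peeled r a M R → Peeled r (suc a) L R

  -- As long as a ≥ 1 the bound is strict without a component K_{r+1}, so equality supplies one at
  -- each step.
  extremal⇒Peeled : ∀ r a L b → MaxDeg r L → #e L ≡ a * tri (suc r) + b → b < tri (suc r) →
    #κ L ≡ a * g (tri (suc r)) + g b → ∃[ R ] (Peeled r a L R × #e R ≡ b × #κ R ≡ g b)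
  extremal⇒Peeled r zero L b max e≡ b<N κ≡ = L , done , e≡ , κ≡
  extremal⇒Peeled r (suc a) L b max e≡ b<N κ≡ with find-component r L max
  ... | inj₁ ω≤r = ⊥-elim (<-irrefl κ≡ (strictly-bounded r _ L ≤-refl ω≤r max (suc a) b e≡ b<N (s≤s z≤n)))
  ... | inj₂ (component Q M q cq lq none) with extremal⇒Peeled r a M b (MaxDeg-++ʳ Q M (MaxDeg-↭ q max)) eM b<N κM
    where
    eM : #e M ≡ a * tri (suc r) + b
    eM = +-cancelˡ-≡ (tri (suc r)) _ _ (trans (sym (#e-component Q M cq lq none)) (trans (sym (#e-↭ q)) (trans e≡ (+-assoc (tri (suc r)) _ b))))
    κM : #κ M ≡ a * g (tri (suc r)) + g b
    κM = +-cancelˡ-≡ (g (tri (suc r))) _ _ (trans (sym (#κ-component Q M cq lq none)) (trans (sym (#κ-↭ q)) (trans κ≡ (+-assoc (g (tri (suc r))) _ (g b)))))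
  ... | R , peeled , eR , κR = R , peel Q M q cq lq none peeled , eR , κR

-- Counting the cliques of a Graph

true-ext : ∀ {a b : Bool} → (a ≡ true → b ≡ true) → (b ≡ true → a ≡ true) → a ≡ b
true-ext {true}  {b}     f h = sym (f refl)
true-ext {false} {false} f h = refl
true-ext {false} {true}  f h = h refl

∧-true : ∀ {a b} → a ∧ b ≡ true → a ≡ true × b ≡ true
∧-true {true} {true} _ = refl , refl

and-tabulate⁻ : ∀ {A : Set} {n} (h : A → Bool) (f : Fin n → A) → and (map h (tabulate f)) ≡ true → ∀ i → h (f i) ≡ true
and-tabulate⁻ h f eq zero    = proj₁ (∧-true eq)
and-tabulate⁻ h f eq (suc i) = and-tabulate⁻ h (f ∘ suc) (proj₂ (∧-true {h (f zero)} eq)) i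

and-tabulate⁺ : ∀ {A : Set} {n} (h : A → Bool) (f : Fin n → A) → (∀ i → h (f i) ≡ true) → and (map h (tabulate f)) ≡ true
and-tabulate⁺ {n = zero}  h f all = refl
and-tabulate⁺ {n = suc n} h f all = cong₂ _∧_ (all zero) (and-tabulate⁺ h (f ∘ suc) (all ∘ suc))

≡ᵇ-refl : ∀ n → (n ≡ᵇ n) ≡ true
≡ᵇ-refl zero    = refl
≡ᵇ-refl (suc n) = ≡ᵇ-refl n

≡ᵇ-true : ∀ m n → (m ≡ᵇ n) ≡ true → m ≡ n
≡ᵇ-true zero    zero    _  = refl
≡ᵇ-true (suc m) (suc n) eq = cong suc (≡ᵇ-true m n eq)

==-distinct : ∀ {n} {i j : Fin n} → i ≢ j → (i == j) ≡ false
==-distinct {i = i} {j} i≢j with toℕ i ≡ᵇ toℕ j in eq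
... | true  = ⊥-elim (i≢j (toℕ-injective (≡ᵇ-true _ _ eq)))
... | false = refl

==-refl : ∀ {n} (i : Fin n) → (i == i) ≡ true
==-refl i = ≡ᵇ-refl (toℕ i)

module _ {A : Set} where
  length-filterᵇ-cong : ∀ {p q : A → Bool} → (∀ s → p s ≡ q s) → ∀ L → length (filterᵇ p L) ≡ length (filterᵇ q L)
  length-filterᵇ-cong eq [] = refl
  length-filterᵇ-cong {p} {q} eq (s ∷ L) rewrite eq s with q s
  ... | true  = cong suc (length-filterᵇ-cong eq L)
  ... | false = length-filterᵇ-cong eq L

  length-filterᵇ-map : ∀ {B : Set} (p : A → Bool) (h : B → A) L → length (filterᵇ p (map h L)) ≡ length (filterᵇ (p ∘ h) L)
  length-filterᵇ-map p h [] = refl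
  length-filterᵇ-map p h (s ∷ L) with p (h s)
  ... | true  = cong suc (length-filterᵇ-map p h L)
  ... | false = length-filterᵇ-map p h L

  length-filterᵇ-false : ∀ (L : List A) → length (filterᵇ (λ _ → false) L) ≡ 0
  length-filterᵇ-false []      = refl
  length-filterᵇ-false (s ∷ L) = length-filterᵇ-false L

module Counting {V : Set} (𝒢 : Adjacency V) where
  open Adjacency 𝒢
  open ListGraph 𝒢

  -- Choosing a vertex turns the size test `P` into `P ∘ suc`. In this way one induction serves both
  -- `edges` and `κ`.
  #sized : (ℕ → Bool) → (V → Bool) → List V → ℕ
  #sized P p []      = b2n (P 0)
  #sized P p (v ∷ L) = #sized P p L + (if p v then #sized (P ∘ suc) (λ u → p u ∧ v ~ u) L else 0)

  -- The clique test as a recursion over the bits of a subset, parallel to `#sized`.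
  good : ∀ {n} → (V → Bool) → (Fin n → V) → Subset n → Bool
  good p f []          = true
  good p f (false ∷ s) = good p (f ∘ suc) s
  good p f (true ∷ s)  = p (f zero) ∧ good (λ u → p u ∧ f zero ~ u) (f ∘ suc) s

  count-good : ∀ P p n (f : Fin n → V) → length (filterᵇ (λ s → good p f s ∧ P ∣ s ∣) (subsets n)) ≡ #sized P p (tabulate f)
  count-good P p zero f with P 0
  ... | true  = refl
  ... | false = refl
  count-good P p (suc n) f = begin
    length (filterᵇ T′ (map (false ∷_) (subsets n) ++ map (true ∷_) (subsets n)))
      ≡⟨ trans (cong length (filterᵇ-++ T′ (map (false ∷_) (subsets n)) _)) (length-++ (filterᵇ T′ (map (false ∷_) (subsets n)))) ⟩
    length (filterᵇ T′ (map (false ∷_) (subsets n))) + length (filterᵇ T′ (map (true ∷_) (subsets n)))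
      ≡⟨ cong₂ _+_ (length-filterᵇ-map T′ (false ∷_) (subsets n)) (length-filterᵇ-map T′ (true ∷_) (subsets n)) ⟩
    length (filterᵇ (T′ ∘ (false ∷_)) (subsets n)) + length (filterᵇ (T′ ∘ (true ∷_)) (subsets n))
      ≡⟨ cong₂ _+_ (count-good P p n (f ∘ suc)) with-zero ⟩
    #sized P p (tabulate f) ∎
    where
    open ≡-Reasoning
    T′ : Subset (suc n) → Bool
    T′ s = good p f s ∧ P ∣ s ∣
    with-zero : length (filterᵇ (T′ ∘ (true ∷_)) (subsets n))
              ≡ (if p (f zero) then #sized (P ∘ suc) (λ u → p u ∧ f zero ~ u) (tabulate (f ∘ suc)) else 0)
    with-zero with p (f zero)
    ... | true  = count-good (P ∘ suc) _ n (f ∘ suc)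
    ... | false = length-filterᵇ-false (subsets n)

  good-sound : ∀ {n} p (f : Fin n → V) s → good p f s ≡ true →
    (∀ i → lookup s i ≡ true → p (f i) ≡ true) × (∀ i j → lookup s i ≡ true → lookup s j ≡ true → i ≢ j → f i ~ f j ≡ true)
  good-sound p f [] eq = (λ ()) , (λ ())
  good-sound p f (false ∷ s) eq with good-sound p (f ∘ suc) s eq
  ... | a , b = (λ { (suc i) e → a i e }) , λ { (suc i) (suc j) e e′ ne → b i j e e′ (ne ∘ cong suc) }
  good-sound p f (true ∷ s) eq with ∧-true {p (f zero)} eq
  ... | p₀ , rest with good-sound (λ u → p u ∧ f zero ~ u) (f ∘ suc) s rest
  ... | a , b = (λ { zero _ → p₀ ; (suc i) e → proj₁ (∧-true (a i e)) }) ,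
        λ { zero zero _ _ ne → ⊥-elim (ne refl)
          ; zero (suc j) _ e _ → proj₂ (∧-true {p (f (suc j))} (a j e))
          ; (suc i) zero e _ _ → trans (~-sym (f (suc i)) (f zero)) (proj₂ (∧-true {p (f (suc i))} (a i e)))
          ; (suc i) (suc j) e e′ ne → b i j e e′ (ne ∘ cong suc) }

  good-complete : ∀ {n} p (f : Fin n → V) s → (∀ i → lookup s i ≡ true → p (f i) ≡ true) →
    (∀ i j → lookup s i ≡ true → lookup s j ≡ true → i ≢ j → f i ~ f j ≡ true) → good p f s ≡ true
  good-complete p f [] a b = refl
  good-complete p f (false ∷ s) a b = good-complete p (f ∘ suc) s (a ∘ suc) (λ i j e e′ ne → b (suc i) (suc j) e e′ (ne ∘ Fin-suc-injective))
  good-complete p f (true ∷ s) a b = cong₂ _∧_ (a zero refl) (good-complete _ (f ∘ suc) s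
      (λ i e → cong₂ _∧_ (a (suc i) e) (b zero (suc i) refl e (λ ())))
      (λ i j e e′ ne → b (suc i) (suc j) e e′ (ne ∘ Fin-suc-injective)))

  #sized-true : ∀ p L → #sized (λ _ → true) p L ≡ #cl-in p L
  #sized-true p [] = refl
  #sized-true p (v ∷ L) = cong₂ (λ a b → a + (if p v then b else 0)) (#sized-true p L) (#sized-true _ L)

  #sized-nonempty : ∀ p L → #sized (0 <ᵇ_) p L + 1 ≡ #cl-in p L
  #sized-nonempty p [] = refl
  #sized-nonempty p (v ∷ L) = trans (lem (#sized (0 <ᵇ_) p L) _)
      (cong₂ (λ a b → a + (if p v then b else 0)) (#sized-nonempty p L) (#sized-true _ L))
    where
    lem : ∀ a b → a + b + 1 ≡ a + 1 + b
    lem = solve-∀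

  #sized-κ : ∀ L → #sized (1 <ᵇ_) (λ _ → true) L ≡ #κ L
  #sized-κ [] = refl
  #sized-κ (v ∷ L) = cong₂ _+_ (#sized-κ L) (+-cancelʳ-≡ 1 _ _ (trans (#sized-nonempty (v ~_) L)
    (trans (#cl-in≡ (v ~_) L) (sym (m∸n+n≡m (1≤#cl (nbrs v L)))))))

  #sized-false : ∀ p L → #sized (λ _ → false) p L ≡ 0
  #sized-false p [] = refl
  #sized-false p (v ∷ L) = trans (cong₂ (λ a b → a + (if p v then b else 0)) (#sized-false p L) (#sized-false _ L)) (if-same (p v))
    where
    if-same : ∀ b → (if b then 0 else 0) ≡ 0
    if-same true  = refl
    if-same false = refl

  #sized-0 : ∀ p L → #sized (_≡ᵇ 0) p L ≡ 1
  #sized-0 p [] = refl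
  #sized-0 p (v ∷ L) = trans (cong₂ (λ a b → a + (if p v then b else 0)) (#sized-0 p L) (#sized-false _ L)) (if-same (p v))
    where
    if-same : ∀ b → 1 + (if b then 0 else 0) ≡ 1
    if-same true  = refl
    if-same false = refl

  #sized-1 : ∀ p L → #sized (_≡ᵇ 1) p L ≡ ∑ (λ u → b2n (p u)) L
  #sized-1 p [] = refl
  #sized-1 p (v ∷ L) = trans (cong₂ (λ a b → a + (if p v then b else 0)) (#sized-1 p L) (#sized-0 _ L))
    (trans (+-comm (∑ (λ u → b2n (p u)) L) _) (cong (_+ ∑ (λ u → b2n (p u)) L) (if-b2n (p v))))
    where
    if-b2n : ∀ b → (if b then 1 else 0) ≡ b2n b
    if-b2n true  = refl
    if-b2n false = refl

  #sized-e : ∀ L → #sized (_≡ᵇ 2) (λ _ → true) L ≡ #e L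
  #sized-e [] = refl
  #sized-e (v ∷ L) = cong₂ _+_ (#sized-e L) (#sized-1 (v ~_) L)

of : ∀ {G} → IsSimple G → Adjacency (Fin (size G))
of {G} s = record { _~_ = adj G ; ~-sym = IsSimple.symmetric s ; ~-irr = IsSimple.irreflexive s }

module _ {G : Graph} (simple : IsSimple G) where
  open ListGraph (of simple)
  open Counting (of simple)

  private
    n = size G

  isClique≡good : ∀ s → isClique G s ≡ good (λ _ → true) id s
  isClique≡good s = true-ext to from
    where
    bit : Fin n → Fin n → Bool
    bit i j = not (lookup s i ∧ lookup s j ∧ not (i == j)) ∨ adj G i j
    to : isClique G s ≡ true → good (λ _ → true) id s ≡ true
    to eq = good-complete _ id s (λ _ _ → refl) λ i j ei ej ne →
      pick i j ei ej ne (and-tabulate⁻ (bit i) id (and-tabulate⁻ (λ i → and (map (bit i) (allFin n))) id eq i) j)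
      where
      pick : ∀ i j → lookup s i ≡ true → lookup s j ≡ true → i ≢ j → bit i j ≡ true → adj G i j ≡ true
      pick i j ei ej ne h rewrite ei | ej | ==-distinct ne = h
    from : good (λ _ → true) id s ≡ true → isClique G s ≡ true
    from eq = and-tabulate⁺ (λ i → and (map (bit i) (allFin n))) id λ i → and-tabulate⁺ (bit i) id (put i)
      where
      put : ∀ i j → bit i j ≡ true
      put i j with lookup s i in ei | lookup s j in ej | i == j in eij
      ... | false | _     | _     = refl
      ... | true  | false | _     = refl
      ... | true  | true  | true  = refl
      ... | true  | true  | false = proj₂ (good-sound _ id s eq) i j ei ej
              (λ i≡j → case trans (sym eij) (trans (cong (_== j) i≡j) (==-refl j)) of λ ())

  private
    count : ∀ P → length (filterᵇ (λ s → isClique G s ∧ P ∣ s ∣) (subsets n)) ≡ #sized P (λ _ → true) (allFin n)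
    count P = trans (length-filterᵇ-cong (λ s → cong (_∧ P ∣ s ∣) (isClique≡good s)) (subsets n)) (count-good P _ n id)

  κ≡ : κ G ≡ #κ (allFin n)
  κ≡ = trans (count (1 <ᵇ_)) (#sized-κ (allFin n))

  edges≡ : edges G ≡ #e (allFin n)
  edges≡ = trans (count (_≡ᵇ 2)) (#sized-e (allFin n))

  degree≡ : ∀ v → degree G v ≡ deg v (allFin n)
  degree≡ v = length-nbrs v (allFin n)

-- Disjoint unions, complete graphs and isomorphic graphs

∪-inl : ∀ G H x y → adj (G ∪ H) (x ↑ˡ size H) (y ↑ˡ size H) ≡ adj G x y
∪-inl G H x y rewrite splitAt-↑ˡ (size G) x (size H) | splitAt-↑ˡ (size G) y (size H) = refl

∪-inr : ∀ G H x y → adj (G ∪ H) (size G ↑ʳ x) (size G ↑ʳ y) ≡ adj H x y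
∪-inr G H x y rewrite splitAt-↑ʳ (size G) (size H) x | splitAt-↑ʳ (size G) (size H) y = refl

∪-cross : ∀ G H x y → adj (G ∪ H) (x ↑ˡ size H) (size G ↑ʳ y) ≡ false
∪-cross G H x y rewrite splitAt-↑ˡ (size G) x (size H) | splitAt-↑ʳ (size G) (size H) y = refl

emptyGraph-simple : ∀ p → IsSimple (emptyGraph p)
emptyGraph-simple p = record { symmetric = λ _ _ → refl ; irreflexive = λ _ → refl }

≡ᵇ-sym : ∀ m n → (m ≡ᵇ n) ≡ (n ≡ᵇ m)
≡ᵇ-sym zero    zero    = refl
≡ᵇ-sym zero    (suc n) = refl
≡ᵇ-sym (suc m) zero    = refl
≡ᵇ-sym (suc m) (suc n) = ≡ᵇ-sym m n

K-simple : ∀ n → IsSimple (K n)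
K-simple n = record { symmetric = λ i j → cong not (≡ᵇ-sym (toℕ i) (toℕ j)) ; irreflexive = λ i → cong not (==-refl i) }

∪-simple : ∀ {G H} → IsSimple G → IsSimple H → IsSimple (G ∪ H)
∪-simple {G} {H} sG sH = record { symmetric = sym′ ; irreflexive = irr }
  where
  sym′ : ∀ i j → adj (G ∪ H) i j ≡ adj (G ∪ H) j i
  sym′ i j with splitAt (size G) i | splitAt (size G) j
  ... | inj₁ x | inj₁ y = IsSimple.symmetric sG x y
  ... | inj₁ x | inj₂ y = refl
  ... | inj₂ x | inj₁ y = refl
  ... | inj₂ x | inj₂ y = IsSimple.symmetric sH x y
  irr : ∀ i → adj (G ∪ H) i i ≡ false
  irr i with splitAt (size G) i
  ... | inj₁ x = IsSimple.irreflexive sG x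
  ... | inj₂ x = IsSimple.irreflexive sH x

copies-simple : ∀ a {H} → IsSimple H → IsSimple (copies a H)
copies-simple zero    sH = emptyGraph-simple 0
copies-simple (suc a) sH = ∪-simple sH (copies-simple a sH)

tabulate-+ : ∀ {A : Set} m {n} (f : Fin (m + n) → A) → tabulate f ≡ tabulate (f ∘ (_↑ˡ n)) ++ tabulate (f ∘ (m ↑ʳ_))
tabulate-+ zero    f = refl
tabulate-+ (suc m) f = cong (f zero ∷_) (tabulate-+ m (f ∘ suc))

allFin-+ : ∀ m n → allFin (m + n) ≡ map (_↑ˡ n) (allFin m) ++ map (m ↑ʳ_) (allFin n)
allFin-+ m n = trans (tabulate-+ m id) (cong₂ _++_ (sym (map-tabulate id (_↑ˡ n))) (sym (map-tabulate id (m ↑ʳ_))))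

All-map⁺ : ∀ {A B : Set} {P : B → Set} (f : A → B) {L} → (∀ x → P (f x)) → All P (map f L)
All-map⁺ f {[]}    h = []
All-map⁺ f {x ∷ L} h = h x ∷ All-map⁺ f h

-- `φ` need not be onto: the same lemma serves isomorphisms and the two sides of a disjoint union.
module Embedding {V W : Set} (𝒢 : Adjacency V) (ℋ : Adjacency W) (φ : V → W)
  (φ-adj : ∀ u v → Adjacency._~_ ℋ (φ u) (φ v) ≡ Adjacency._~_ 𝒢 u v) where
  open Adjacency 𝒢
  open Adjacency ℋ renaming (_~_ to _≈_; ~-sym to ≈-sym)
  private
    module A = ListGraph 𝒢
    module B = ListGraph ℋ

  #cl-in-map : ∀ p L → B.#cl-in p (map φ L) ≡ A.#cl-in (p ∘ φ) L
  #cl-in-map p [] = refl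
  #cl-in-map p (v ∷ L) = cong₂ (λ a b → a + (if p (φ v) then b else 0)) (#cl-in-map p L)
    (trans (#cl-in-map (λ u → p u ∧ φ v ≈ u) L) (A.#cl-in-cong L (λ u → cong (p (φ u) ∧_) (φ-adj v u))))

  #κ-map : ∀ L → B.#κ (map φ L) ≡ A.#κ L
  #κ-map L = +-cancelʳ-≡ (length L + 1) _ _ (begin
    B.#κ (map φ L) + (length L + 1) ≡⟨ cong (λ k → B.#κ (map φ L) + (k + 1)) (length-map φ L) ⟨
    B.#κ (map φ L) + (length (map φ L) + 1) ≡⟨ +-assoc (B.#κ (map φ L)) _ 1 ⟨
    B.#κ (map φ L) + length (map φ L) + 1 ≡⟨ B.#cl-#κ (map φ L) ⟨
    B.#cl (map φ L) ≡⟨ #cl-in-map (λ _ → true) L ⟩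
    A.#cl L ≡⟨ A.#cl-#κ L ⟩
    A.#κ L + length L + 1 ≡⟨ +-assoc (A.#κ L) _ 1 ⟩
    A.#κ L + (length L + 1) ∎)
    where open ≡-Reasoning

module _ {G H : Graph} (sG : IsSimple G) (sH : IsSimple H) where
  private
    module G = IsSimple sG
    module H = IsSimple sH
    module L = ListGraph (of (∪-simple sG sH))

  κ-∪ : κ (G ∪ H) ≡ κ G + κ H
  κ-∪ = begin
    κ (G ∪ H) ≡⟨ κ≡ (∪-simple sG sH) ⟩
    L.#κ (allFin (size G + size H)) ≡⟨ cong L.#κ (allFin-+ (size G) (size H)) ⟩
    L.#κ (inl ++ inr) ≡⟨ L.#κ-disjoint inl inr (All-map⁺ (_↑ˡ size H) (λ x → All-map⁺ (size G ↑ʳ_) (∪-cross G H x))) ⟩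
    L.#κ inl + L.#κ inr ≡⟨ cong₂ _+_
         (Embedding.#κ-map (of sG) (of (∪-simple sG sH)) (_↑ˡ size H) (∪-inl G H) (allFin (size G)))
         (Embedding.#κ-map (of sH) (of (∪-simple sG sH)) (size G ↑ʳ_) (∪-inr G H) (allFin (size H))) ⟩
    ListGraph.#κ (of sG) (allFin (size G)) + ListGraph.#κ (of sH) (allFin (size H))
                                                    ≡⟨ cong₂ _+_ (κ≡ sG) (κ≡ sH) ⟨
    κ G + κ H ∎
    where
    open ≡-Reasoning
    inl = map (_↑ˡ size H) (allFin (size G))
    inr = map (size G ↑ʳ_) (allFin (size H))

κ-emptyGraph : ∀ p → κ (emptyGraph p) ≡ 0
κ-emptyGraph p = trans (κ≡ (emptyGraph-simple p)) (none (allFin p))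
  where
  module S = ListGraph (of (emptyGraph-simple p))
  none : ∀ L → S.#κ L ≡ 0
  none [] = refl
  none (v ∷ L) = cong₂ (λ a M → a + (S.#cl M ∸ 1)) (none L) (filterᵇ-none (λ _ → false) (All-true L))
    where
    All-true : ∀ L → All (λ _ → false ≡ false) L
    All-true []      = []
    All-true (_ ∷ L) = refl ∷ All-true L

allFin-K : ∀ n → AllPairs (λ i j → adj (K n) i j ≡ true) (allFin n)
allFin-K n = AllPairs.map (λ ne → cong not (==-distinct ne)) (allFin⁺ n)

κ-K : ∀ n → κ (K n) ≡ g (tri n)
κ-K n = trans (κ≡ (K-simple n))
  (trans (ListGraph.#κ-clique (of (K-simple n)) (allFin-K n))
    (cong (λ k → g (tri k)) (length-tabulate {n = n} id)))

κ-copies : ∀ a {H} → IsSimple H → κ (copies a H) ≡ a * κ H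
κ-copies zero {H} sH = κ-emptyGraph 0
κ-copies (suc a) {H} sH = trans (κ-∪ sH (copies-simple a sH)) (cong (κ H +_) (κ-copies a sH))

≅-κ : ∀ {G H} → IsSimple G → IsSimple H → G ≅ H → κ G ≡ κ H
≅-κ {G} {H} sG sH (f , f-adj) = begin
  κ G ≡⟨ κ≡ sG ⟩
  A.#κ (allFin (size G)) ≡⟨ Embedding.#κ-map (of sG) (of sH) to (λ u v → sym (f-adj u v)) (allFin (size G)) ⟨
  B.#κ (map to (allFin (size G))) ≡⟨ B.#κ-↭ perm ⟩
  B.#κ (allFin (size H)) ≡⟨ κ≡ sH ⟨
  κ H ∎
  where
  open ≡-Reasoning
  open Inverse f using (to; from; strictlyInverseˡ; strictlyInverseʳ)
  module G = IsSimple sG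
  module H = IsSimple sH
  module A = ListGraph (of sG)
  module B = ListGraph (of sH)
  perm : map to (allFin (size G)) ↭ allFin (size H)
  perm = ∼bag⇒↭ (unique∧set⇒bag
    (Unique.map⁺ (λ {x} {y} e → trans (sym (strictlyInverseʳ x)) (trans (cong from e) (strictlyInverseʳ y))) (allFin⁺ (size G)))
    (allFin⁺ (size H))
    (λ {j} → mk⇔ (λ _ → ∈-allFin j) (λ _ → subst (_∈ map to (allFin (size G))) (strictlyInverseˡ j) (∈-map⁺ to (∈-allFin (from j))))))

≅*-κ : ∀ {G H} → IsSimple G → IsSimple H → G ≅* H → κ G ≡ κ H
≅*-κ {G} {H} sG sH (p , q , iso) = begin
  κ G ≡⟨ +-identityʳ (κ G) ⟨
  κ G + 0 ≡⟨ cong (κ G +_) (κ-emptyGraph p) ⟨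
  κ G + κ (emptyGraph p) ≡⟨ κ-∪ sG (emptyGraph-simple p) ⟨
  κ (G ∪ emptyGraph p) ≡⟨ ≅-κ (∪-simple sG (emptyGraph-simple p)) (∪-simple sH (emptyGraph-simple q)) iso ⟩
  κ (H ∪ emptyGraph q) ≡⟨ κ-∪ sH (emptyGraph-simple q) ⟩
  κ H + κ (emptyGraph q) ≡⟨ cong (κ H +_) (κ-emptyGraph q) ⟩
  κ H + 0 ≡⟨ +-identityʳ (κ H) ⟩
  κ H ∎
  where open ≡-Reasoning

-- Colex graphs

C2≡tri : ∀ n → n C 2 ≡ tri n
C2≡tri zero    = refl
C2≡tri (suc n) = trans (sym (nCk+nC[k+1]≡[n+1]C[k+1] n 1)) (trans (cong₂ _+_ (nC1≡n n) (C2≡tri n)) (+-comm n (tri n)))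

<ᵇ-true : ∀ {m n} → m < n → (m <ᵇ n) ≡ true
<ᵇ-true {zero}  {suc n} _        = refl
<ᵇ-true {suc m} {suc n} (s≤s lt) = <ᵇ-true lt

<ᵇ-false : ∀ {m n} → n ≤ m → (m <ᵇ n) ≡ false
<ᵇ-false {m}     {zero}  _        = refl
<ᵇ-false {suc m} {suc n} (s≤s le) = <ᵇ-false le

<ᵇ-true⁻ : ∀ {m n} → (m <ᵇ n) ≡ true → m < n
<ᵇ-true⁻ {m} {n} eq = ≰⇒> λ le → case trans (sym eq) (<ᵇ-false le) of λ ()

<ᵇ-false⁻ : ∀ {m n} → (m <ᵇ n) ≡ false → n ≤ m
<ᵇ-false⁻ {m} {n} eq = ≮⇒≥ λ lt → case trans (sym eq) (<ᵇ-true lt) of λ ()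

colexAdj-< : ∀ b {i j} → i < j → colexAdj b i j ≡ (tri j + i <ᵇ b)
colexAdj-< b {i} {j} lt rewrite <ᵇ-true lt | C2≡tri j = refl

colexAdj-irr : ∀ b i → colexAdj b i i ≡ false
colexAdj-irr b i rewrite <ᵇ-false (≤-refl {i}) = refl

colexAdj-sym : ∀ b i j → colexAdj b i j ≡ colexAdj b j i
colexAdj-sym b i j with <-cmp i j
... | tri< lt _ _ rewrite <ᵇ-true lt | <ᵇ-false (<⇒≤ lt) = refl
... | tri≈ _ refl _ = refl
... | tri> _ _ gt rewrite <ᵇ-true gt | <ᵇ-false (<⇒≤ gt) = refl

colex-simple : ∀ b → IsSimple (colex b)
colex-simple b = record { symmetric = λ i j → colexAdj-sym b (toℕ i) (toℕ j) ; irreflexive = λ i → colexAdj-irr b (toℕ i) }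

colexAdj-outside : ∀ b {i} → b ≤ tri i → ∀ j → colexAdj b i j ≡ false
colexAdj-outside b {i} b≤ j with <-cmp i j
... | tri< lt _ _ = trans (colexAdj-< b lt) (<ᵇ-false (≤-trans (≤-trans b≤ (tri-mono (<⇒≤ lt))) (m≤m+n _ i)))
... | tri≈ _ refl _ = colexAdj-irr b i
... | tri> _ _ gt = trans (colexAdj-sym b i j) (trans (colexAdj-< b gt) (<ᵇ-false (≤-trans b≤ (m≤m+n _ j))))

colexAdj-inside : ∀ b {c i j} → tri c ≤ b → i < c → j < c → i ≢ j → colexAdj b i j ≡ true
colexAdj-inside b {c} {i} {j} c≤ i<c j<c i≢j with <-cmp i j
... | tri< lt _ _ = trans (colexAdj-< b lt) (<ᵇ-true (≤-trans (+-monoʳ-< (tri j) lt) (≤-trans (tri-mono j<c) c≤)))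
... | tri≈ _ eq _ = ⊥-elim (i≢j eq)
... | tri> _ _ gt = trans (colexAdj-sym b i j) (trans (colexAdj-< b gt)
                      (<ᵇ-true (≤-trans (+-monoʳ-< (tri i) gt) (≤-trans (tri-mono i<c) c≤))))

length-below : ∀ k n → k ≤ n → length (filterᵇ (λ i → toℕ i <ᵇ k) (allFin n)) ≡ k
length-below zero n le = length-filterᵇ-false (allFin n)
length-below (suc k) (suc n) (s≤s le) = cong suc (trans
  (cong (λ L → length (filterᵇ (λ i → toℕ i <ᵇ suc k) L)) (sym (map-tabulate {n = n} id suc)))
  (trans (length-filterᵇ-map (λ i → toℕ i <ᵇ suc k) suc (allFin n)) (length-below k n le)))

module _ {A : Set} where
  AllPairs-zipAll : ∀ {R S : A → A → Set} {P : A → Set} {L} → (∀ {x y} → P x → P y → R x y → S x y) →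
    All P L → AllPairs R L → AllPairs S L
  AllPairs-zipAll f [] [] = []
  AllPairs-zipAll f (p ∷ ps) (r ∷ rs) = All.zipWith (λ (py , rxy) → f p py rxy) (ps , r) ∷ AllPairs-zipAll f ps rs

  Unique-↭ : ∀ {L M : List A} → L ↭ M → Unique L → Unique M
  Unique-↭ = AllPairs-↭ (λ ne → ne ∘ sym)

module Shapes {V : Set} (𝒢 : Adjacency V) where
  open Adjacency 𝒢
  open ListGraph 𝒢

  #κ-isolated : ∀ L I → Isolated I (L ++ I) → #κ (L ++ I) ≡ #κ L
  #κ-isolated L I iso = trans (#κ-disjoint L I (flip I (All.map (++⁻ˡ L) iso)))
    (trans (cong (#κ L +_) (none I (All.map (++⁻ʳ L) iso))) (+-identityʳ _))
    where
    flip : ∀ {L} I → Isolated I L → Isolated L I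
    flip {[]} I h = []
    flip {x ∷ L} I h = All.map (λ {v} p → trans (~-sym x v) (All.head p)) h ∷ flip I (All.map All.tail h)
    none : ∀ I → Isolated I I → #κ I ≡ 0
    none [] _ = refl
    none (v ∷ I) ((_ ∷ h) ∷ hs) = cong₂ (λ a M → a + (#cl M ∸ 1)) (none I (All.map All.tail hs)) (filterᵇ-none (v ~_) h)

  Complete-κ : ∀ {c L} → Complete c L → #κ L ≡ g (tri c)
  Complete-κ (Q , I , q , cq , refl , iso) = trans (#κ-↭ q) (trans (#κ-isolated Q I iso) (#κ-clique cq))

  Pendant-κ : ∀ {c d L} → d ≤ c → Pendant c d L → #κ L ≡ g (tri c + d)
  Pendant-κ {c} {d} {L} d≤c (v , P , Q , I , q , cq , lP , lPQ , vP , vQ , iso) = +-cancelʳ-≡ 1 _ _ (begin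
    #κ L + 1 ≡⟨ cong (_+ 1) (trans (#κ-↭ q) (#κ-isolated (v ∷ P ++ Q) I iso)) ⟩
    #κ (v ∷ P ++ Q) + 1 ≡⟨ #κ-∷ v (P ++ Q) ⟩
    #κ (P ++ Q) + #cl (nbrs v (P ++ Q)) ≡⟨ cong₂ _+_ (#κ-clique cq) (cong #cl (trans (nbrs-clique Q vP)
                                             (trans (cong (P ++_) (filterᵇ-none (v ~_) vQ)) (++-identityʳ P)))) ⟩
    g (tri (length (P ++ Q))) + #cl P ≡⟨ cong₂ (λ a b → g (tri a) + b) (trans (length-++ P) lPQ)
                                             (trans (#cl-clique (proj₁ (AllPairs-++⁻ P cq))) (cong (2 ^_) lP)) ⟩
    g (tri c) + 2 ^ d ≡⟨ g-tri+ c d d≤c ⟨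
    g (tri c + d) + 1 ∎)
    where open ≡-Reasoning

module Colex (b : ℕ) where
  open ListGraph (of (colex-simple b))

  private
    L = allFin (suc b)

    below : ℕ → Fin (suc b) → Bool
    below k i = toℕ i <ᵇ k

  private
    all-false : ∀ {i M} → b ≤ tri (toℕ i) → Avoids i M
    all-false {M = []}    le = []
    all-false {M = u ∷ M} le = colexAdj-outside b le (toℕ u) ∷ all-false le

  module _ (c : ℕ) (c≤ : tri c ≤ b) where
    Q₀ I₀ : List (Fin (suc b))
    Q₀ = filterᵇ (below c) L
    I₀ = filterᵇ (not ∘ below c) L

    L↭ : L ↭ Q₀ ++ I₀
    L↭ = filterᵇ-split (below c) L

    Q₀-below : All (λ i → below c i ≡ true) Q₀
    Q₀-below = filterᵇ-true (below c) L

    I₀-above : All (λ i → below c i ≡ false) I₀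
    I₀-above = filterᵇ-false (below c) L

    Q₀-clique : Clique Q₀
    Q₀-clique = AllPairs-zipAll
      (λ p q ne → colexAdj-inside b {c} c≤ (<ᵇ-true⁻ p) (<ᵇ-true⁻ q) (ne ∘ toℕ-injective))
      Q₀-below (filter⁺ (T? ∘ below c) (allFin⁺ (suc b)))

    Q₀-length : length Q₀ ≡ c
    Q₀-length = length-below c (suc b) (≤-trans (n≤tri c) (s≤s c≤))

  complete : ∀ c → b ≡ tri c → Complete c L
  complete c refl = Q₀ c ≤-refl , I₀ c ≤-refl , L↭ c ≤-refl , Q₀-clique c ≤-refl , Q₀-length c ≤-refl ,
    All.map (λ {i} p → all-false (tri-mono {c} {toℕ i} (<ᵇ-false⁻ p))) (I₀-above c ≤-refl)

  -- The vertex of index c is attached last: its edge to u has number tri c + u, counted from 0, so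
  -- it is joined exactly to the indices below d.
  pendant : ∀ c d → 1 ≤ d → d < c → b ≡ tri c + d → Pendant c d L
  pendant c d 1≤d d<c refl = v , P , Q , I ,
      ↭-trans (L↭ c c≤) (↭-trans (++⁺ˡ (Q₀ c c≤) I↭) (↭-trans (shift v (Q₀ c c≤) I) (prep v (++⁺ʳ I Q↭)))) ,
      Clique-↭ Q↭ (Q₀-clique c c≤) , lP , trans (sym (length-++ P)) (trans (sym (↭-length Q↭)) (Q₀-length c c≤)) ,
      All.zipWith (λ {u} (p , q) → trans (v-adj u (<ᵇ-true⁻ q)) (<ᵇ-true (+-monoʳ-< (tri c) (<ᵇ-true⁻ p))))
        (filterᵇ-true (below d) (Q₀ c c≤) , All-filterᵇ (below d) (Q₀-below c c≤)) ,
      All.zipWith (λ {u} (p , q) → trans (v-adj u (<ᵇ-true⁻ q)) (<ᵇ-false (+-monoʳ-≤ (tri c) (<ᵇ-false⁻ p))))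
        (filterᵇ-false (below d) (Q₀ c c≤) , All-filterᵇ (not ∘ below d) (Q₀-below c c≤)) ,
      All.zipWith (λ {i} (ne , p) → all-false (≤-trans (+-monoʳ-≤ (tri c) (<⇒≤ d<c)) (tri-mono {suc c} {toℕ i} (above i ne (<ᵇ-false⁻ p)))))
        (AllPairs.head uniq , All.tail (All-resp-↭ I↭ (I₀-above c c≤)))
    where
    c≤ : tri c ≤ b
    c≤ = m≤m+n (tri c) d
    c<b : c < suc b
    c<b = s≤s (≤-trans (n≤tri c) (≤-trans (≤-reflexive (+-comm 1 (tri c))) (+-monoʳ-≤ (tri c) 1≤d)))
    v : Fin (suc b)
    v = fromℕ< c<b
    v≡ : toℕ v ≡ c
    v≡ = toℕ-fromℕ< c<b
    v∈ : v ∈ I₀ c c≤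
    v∈ = ∈-filter⁺ (T? ∘ (not ∘ below c)) (∈-allFin v)
           (subst T (sym (cong not (<ᵇ-false (≤-reflexive (sym v≡))))) tt)
    I = proj₁ (∈-split v∈)
    I↭ : I₀ c c≤ ↭ v ∷ I
    I↭ = proj₂ (∈-split v∈)
    uniq : Unique (v ∷ I)
    uniq = Unique-↭ I↭ (filter⁺ (T? ∘ (not ∘ below c)) (allFin⁺ (suc b)))
    P = filterᵇ (below d) (Q₀ c c≤)
    Q = filterᵇ (not ∘ below d) (Q₀ c c≤)
    Q↭ : Q₀ c c≤ ↭ P ++ Q
    Q↭ = filterᵇ-split (below d) (Q₀ c c≤)
    lP : length P ≡ d
    lP = trans (cong length (filterᵇ-filterᵇ (below d) (below c) L)) (trans (length-filterᵇ-cong small L)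
           (length-below d (suc b) (≤-trans (<⇒≤ d<c) (<⇒≤ c<b))))
      where
      small : ∀ i → below c i ∧ below d i ≡ below d i
      small i with toℕ i <ᵇ d in eq
      ... | true  = trans (cong (_∧ true) (<ᵇ-true (≤-trans (<ᵇ-true⁻ eq) (<⇒≤ d<c)))) refl
      ... | false = ∧-zeroʳ _
    v-adj : ∀ u → toℕ u < c → adj (colex b) v u ≡ (tri c + toℕ u <ᵇ b)
    v-adj u u<c = trans (colexAdj-sym b (toℕ v) (toℕ u)) (trans (cong (colexAdj b (toℕ u)) v≡) (colexAdj-< b u<c))
    above : ∀ i → v ≢ i → c ≤ toℕ i → c < toℕ i
    above i ne le = ≤∧≢⇒< le λ eq → ne (toℕ-injective (trans v≡ eq))

-- Only here is the formula for `g` tied to the colex graph of the theorem, through its shape as a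
-- complete graph or a complete graph with one more vertex.
κ-colex : ∀ b → κ (colex b) ≡ g b
κ-colex b = trans (κ≡ (colex-simple b)) (shape (decompose b))
  where
  open ListGraph (of (colex-simple b))
  open Shapes (of (colex-simple b))
  shape : ∃[ c ] ∃[ d ] (d < c × b ≡ tri c + d) → #κ (allFin (suc b)) ≡ g b
  shape (c , zero , d<c , eq) = trans (Complete-κ (Colex.complete b c eq′)) (cong g (sym eq′))
    where
    eq′ : b ≡ tri c
    eq′ = trans eq (+-identityʳ _)
  shape (c , suc d , d<c , eq) = trans (Pendant-κ (<⇒≤ d<c) (Colex.pendant b c (suc d) (s≤s z≤n) d<c eq)) (cong g (sym eq))

-- Isomorphisms up to isolated vertices

zip-equal : ∀ {A B : Set} (L : List A) (M : List B) → length L ≡ length M →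
  ∃[ ps ] (map proj₁ ps ≡ L × map proj₂ ps ≡ M)
zip-equal [] [] _ = [] , refl , refl
zip-equal (x ∷ L) (y ∷ M) eq with zip-equal L M (suc-injective eq)
... | ps , refl , refl = (x , y) ∷ ps , refl , refl

module MatchingOf {V W : Set} (𝒢 : Adjacency V) (ℋ : Adjacency W) where
  open Adjacency 𝒢
  open Adjacency ℋ renaming (_~_ to _≈_; ~-sym to ≈-sym)
  private
    module A = ListGraph 𝒢
    module B = ListGraph ℋ

  Agree : V × W → V × W → Set
  Agree (u , u′) (v , v′) = u ~ v ≡ u′ ≈ v′

  -- An isomorphism of the two graphs up to isolated vertices, as a list of corresponding vertices.
  record Matching (L : List V) (M : List W) : Set where
    constructor matching
    field
      pairs     : List (V × W)
      restˡ     : List V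
      restʳ     : List W
      permˡ     : L ↭ map proj₁ pairs ++ restˡ
      permʳ     : M ↭ map proj₂ pairs ++ restʳ
      agree     : AllPairs Agree pairs
      isolatedˡ : A.Isolated restˡ (map proj₁ pairs ++ restˡ)
      isolatedʳ : B.Isolated restʳ (map proj₂ pairs ++ restʳ)

  All-agree : ∀ {v w} b ps → All (λ u → v ~ u ≡ b) (map proj₁ ps) → All (λ u → w ≈ u ≡ b) (map proj₂ ps) →
    All (Agree (v , w)) ps
  All-agree b [] [] [] = []
  All-agree b (_ ∷ ps) (e ∷ es) (e′ ∷ es′) = trans e (sym e′) ∷ All-agree b ps es es′

  clique-agree : ∀ ps → A.Clique (map proj₁ ps) → B.Clique (map proj₂ ps) → AllPairs Agree ps
  clique-agree [] [] [] = []
  clique-agree (_ ∷ ps) (p ∷ c) (p′ ∷ c′) = All-agree true ps p p′ ∷ clique-agree ps c c′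

  match-complete : ∀ {c L M} → A.Complete c L → B.Complete c M → Matching L M
  match-complete (Q , I , q , cq , lq , iso) (Q′ , I′ , q′ , cq′ , lq′ , iso′) with zip-equal Q Q′ (trans lq (sym lq′))
  ... | ps , refl , refl = matching ps I I′ q q′ (clique-agree ps cq cq′) iso iso′

  match-pendant : ∀ {c d L M} → A.Pendant c d L → B.Pendant c d M → Matching L M
  match-pendant {c} {d} {L} {M} (v , P , Q , I , q , cq , lP , lPQ , vP , vQ , iso) (v′ , P′ , Q′ , I′ , q′ , cq′ , lP′ , lPQ′ , vP′ , vQ′ , iso′)
    with zip-equal P P′ (trans lP (sym lP′))
       | zip-equal Q Q′ (+-cancelˡ-≡ (length P) _ _ (trans lPQ (trans (sym lPQ′) (cong (_+ length Q′) (trans lP′ (sym lP))))))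
  ... | ps , refl , refl | qs , refl , refl = matching ((v , v′) ∷ ps ++ qs) I I′
        (subst (λ X → L ↭ v ∷ X ++ I) (sym eq₁) q) (subst (λ X → M ↭ v′ ∷ X ++ I′) (sym eq₂) q′)
        (++⁺ (All-agree true ps vP vP′) (All-agree false qs vQ vQ′) ∷
          clique-agree (ps ++ qs) (subst A.Clique (sym eq₁) cq) (subst B.Clique (sym eq₂) cq′))
        (subst (λ X → A.Isolated I (v ∷ X ++ I)) (sym eq₁) iso) (subst (λ X → B.Isolated I′ (v′ ∷ X ++ I′)) (sym eq₂) iso′)
    where
    eq₁ = map-++ proj₁ ps qs
    eq₂ = map-++ proj₂ ps qs

  match-split : ∀ {c L M} → A.Split c L → B.Split c M → Matching L M
  match-split (v , w , Q , I , q , vw , cq , lq , vQ , wQ , iso) (v′ , w′ , Q′ , I′ , q′ , vw′ , cq′ , lq′ , vQ′ , wQ′ , iso′)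
    with zip-equal Q Q′ (trans lq (sym lq′))
  ... | ps , refl , refl = matching ((v , v′) ∷ (w , w′) ∷ ps) I I′ q q′
        ((trans vw (sym vw′) ∷ All-agree false ps vQ vQ′) ∷ All-agree false ps wQ wQ′ ∷ clique-agree ps cq cq′) iso iso′

  -- Any bijection between two cliques of equal size preserves adjacency, and pairs from different
  -- components agree because both sides are non-adjacent.
  match-peeled : ∀ {r a L M R S} → A.Peeled r a L R → B.Peeled r a M S → Matching R S → Matching L M
  match-peeled A.done B.done m = m
  match-peeled {L = L} {M} (A.peel Q N q cq lq none p) (B.peel Q′ N′ q′ cq′ lq′ none′ p′) m
    with match-peeled p p′ m | zip-equal Q Q′ (trans lq (sym lq′))
  ... | matching qs I I′ π π′ agr iso iso′ | ps , refl , refl = matching (ps ++ qs) I I′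
        (↭-trans q (↭-trans (++⁺ˡ _ π) (Perm.↭-reflexive eq₁)))
        (↭-trans q′ (↭-trans (++⁺ˡ _ π′) (Perm.↭-reflexive eq₂)))
        (AllPairs-++⁺ (clique-agree ps cq cq′) agr (cross ps (All.map (All-resp-↭ π) none) (All.map (All-resp-↭ π′) none′)))
        (subst (A.Isolated I) eq₁ (extend ~-sym (All.map (λ h → ++⁻ʳ (map proj₁ qs) (All-resp-↭ π h)) none) iso))
        (subst (B.Isolated I′) eq₂ (extend ≈-sym (All.map (λ h → ++⁻ʳ (map proj₂ qs) (All-resp-↭ π′ h)) none′) iso′))
    where
    eq₁ : map proj₁ ps ++ (map proj₁ qs ++ I) ≡ map proj₁ (ps ++ qs) ++ I
    eq₁ = trans (sym (++-assoc (map proj₁ ps) (map proj₁ qs) I)) (cong (_++ I) (sym (map-++ proj₁ ps qs)))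
    eq₂ : map proj₂ ps ++ (map proj₂ qs ++ I′) ≡ map proj₂ (ps ++ qs) ++ I′
    eq₂ = trans (sym (++-assoc (map proj₂ ps) (map proj₂ qs) I′)) (cong (_++ I′) (sym (map-++ proj₂ ps qs)))
    cross : ∀ ps → All (λ v → All (λ u → v ~ u ≡ false) (map proj₁ qs ++ I)) (map proj₁ ps) →
      All (λ v → All (λ u → v ≈ u ≡ false) (map proj₂ qs ++ I′)) (map proj₂ ps) → All (λ x → All (Agree x) qs) ps
    cross [] [] [] = []
    cross (_ ∷ ps) (h ∷ hs) (h′ ∷ hs′) = All-agree false qs (++⁻ˡ _ h) (++⁻ˡ _ h′) ∷ cross ps hs hs′
    extend : ∀ {X : Set} {_∼_ : X → X → Bool} (s : ∀ u v → u ∼ v ≡ v ∼ u) {Q N I} →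
      All (λ v → All (λ u → v ∼ u ≡ false) I) Q → All (λ v → All (λ u → v ∼ u ≡ false) N) I →
      All (λ v → All (λ u → v ∼ u ≡ false) (Q ++ N)) I
    extend s [] h = h
    extend {_∼_ = _∼_} s {Q = x ∷ Q} (e ∷ es) h = All.zipWith (λ {v} (p , ps) → trans (s v x) p ∷ ps) (e , extend s es h)

module _ {V W X : Set} (𝒢 : Adjacency V) (ℋ : Adjacency W) (𝒦 : Adjacency X) (φ : W → X)
  (φ-adj : ∀ u v → Adjacency._~_ 𝒦 (φ u) (φ v) ≡ Adjacency._~_ ℋ u v) where
  open Adjacency 𝒢
  open Adjacency 𝒦 using () renaming (_~_ to _≋_)
  private
    module M = MatchingOf 𝒢 ℋ
    module M′ = MatchingOf 𝒢 𝒦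

  -- Used to carry a matching with `colex b` into the disjoint union containing it.
  match-map : ∀ {L N} → M.Matching L N → M′.Matching L (map φ N)
  match-map {L} {N} (M.matching ps I I′ π π′ agr iso iso′) = M′.matching (map φ₂ ps) I (map φ I′)
      (subst (λ Y → L ↭ Y ++ I) (sym (proj₁-φ₂ ps)) π)
      (↭-trans (map⁺ φ π′) (Perm.↭-reflexive eq))
      (agree-map agr)
      (subst (λ Y → All (λ v → All (λ u → v ~ u ≡ false) (Y ++ I)) I) (sym (proj₁-φ₂ ps)) iso)
      (subst (λ Y → All (λ v → All (λ u → v ≋ u ≡ false) Y) (map φ I′)) eq
        (All.map⁺ (All.map (λ {v} h → All.map⁺ (All.map (λ {u} e → trans (φ-adj v u) e) h)) iso′)))
    where
    φ₂ : V × W → V × X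
    φ₂ (v , w) = v , φ w
    proj₁-φ₂ : ∀ ps → map proj₁ (map φ₂ ps) ≡ map proj₁ ps
    proj₁-φ₂ []       = refl
    proj₁-φ₂ (p ∷ ps) = cong (proj₁ p ∷_) (proj₁-φ₂ ps)
    proj₂-φ₂ : ∀ ps → map proj₂ (map φ₂ ps) ≡ map φ (map proj₂ ps)
    proj₂-φ₂ []       = refl
    proj₂-φ₂ (p ∷ ps) = cong (φ (proj₂ p) ∷_) (proj₂-φ₂ ps)
    eq : map φ (map proj₂ ps ++ I′) ≡ map proj₂ (map φ₂ ps) ++ map φ I′
    eq = trans (map-++ φ (map proj₂ ps) I′) (cong (_++ map φ I′) (sym (proj₂-φ₂ ps)))
    agree-map : ∀ {ps} → AllPairs M.Agree ps → AllPairs M′.Agree (map φ₂ ps)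
    agree-map [] = []
    agree-map (p ∷ ap) = All.map⁺ (All.map (λ e → trans e (sym (φ-adj _ _))) p) ∷ agree-map ap

module _ {A B : Set} where
  Unique-map-injective : ∀ (f : A → B) {L x y} → Unique (map f L) → x ∈ L → y ∈ L → f x ≡ f y → x ≡ y
  Unique-map-injective f u (here refl) (here refl) e = refl
  Unique-map-injective f (p ∷ u) (here refl) (there y∈) e = ⊥-elim (All.lookup p (∈-map⁺ f y∈) e)
  Unique-map-injective f (p ∷ u) (there x∈) (here refl) e = ⊥-elim (All.lookup p (∈-map⁺ f x∈) (sym e))
  Unique-map-injective f (p ∷ u) (there x∈) (there y∈) e = Unique-map-injective f u x∈ y∈ e

AllPairs-∈ : ∀ {A : Set} {R : A → A → Set} {L x y} → (∀ {x} → R x x) → (∀ {x y} → R x y → R y x) →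
  AllPairs R L → x ∈ L → y ∈ L → R x y
AllPairs-∈ r s (p ∷ ap) (here refl) (here refl) = r
AllPairs-∈ r s (p ∷ ap) (here refl) (there y∈) = All.lookup p y∈
AllPairs-∈ r s (p ∷ ap) (there x∈) (here refl) = s (All.lookup p x∈)
AllPairs-∈ r s (p ∷ ap) (there x∈) (there y∈) = AllPairs-∈ r s ap x∈ y∈

module _ {G H : Graph} (sG : IsSimple G) (sH : IsSimple H) where
  private
    module G = IsSimple sG
    module H = IsSimple sH
    n = size G
    m = size H
    PairAgree : Fin n × Fin m → Fin n × Fin m → Set
    PairAgree (u , u′) (v , v′) = adj G u v ≡ adj H u′ v′

  -- `allFin` has no repetitions, so each vertex occurs in exactly one pair and the list is the
  -- graph of a bijection.
  pairs⇒≅ : (ps : List (Fin n × Fin m)) → allFin n ↭ map proj₁ ps → allFin m ↭ map proj₂ ps → AllPairs PairAgree ps → G ≅ H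
  pairs⇒≅ ps π π′ agr = mk↔ₛ′ to from to-from from-to , λ i j →
      AllPairs-∈ {x = i , to i} {y = j , to j} (λ {x} → trans (G.irreflexive (proj₁ x)) (sym (H.irreflexive (proj₂ x))))
        (λ {x} {y} e → trans (G.symmetric (proj₁ y) (proj₁ x)) (trans e (H.symmetric (proj₂ x) (proj₂ y)))) agr (to∈ i) (to∈ j)
    where
    right : ∀ i → ∃[ j ] ((i , j) ∈ ps)
    right i with ∈-map⁻ proj₁ (∈-resp-↭ π (∈-allFin i))
    ... | (_ , j) , p∈ , refl = j , p∈
    left : ∀ j → ∃[ i ] ((i , j) ∈ ps)
    left j with ∈-map⁻ proj₂ (∈-resp-↭ π′ (∈-allFin j))
    ... | (i , _) , p∈ , refl = i , p∈
    to = proj₁ ∘ right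
    from = proj₁ ∘ left
    to∈ : ∀ i → (i , to i) ∈ ps
    to∈ i = proj₂ (right i)
    to-from : ∀ j → to (from j) ≡ j
    to-from j = cong proj₂ (Unique-map-injective proj₁ (Unique-↭ π (allFin⁺ n)) (to∈ (from j)) (proj₂ (left j)) refl)
    from-to : ∀ i → from (to i) ≡ i
    from-to i = cong proj₁ (Unique-map-injective proj₂ (Unique-↭ π′ (allFin⁺ m)) (proj₂ (left (to i))) (to∈ i) refl)

∪-empty-inl : ∀ G p i → (∀ j → adj G i j ≡ false) → ∀ u → adj (G ∪ emptyGraph p) (i ↑ˡ p) u ≡ false
∪-empty-inl G p i h u rewrite splitAt-↑ˡ (size G) i p with splitAt (size G) u
... | inj₁ j = h j
... | inj₂ _ = refl

∪-empty-inr : ∀ G p i u → adj (G ∪ emptyGraph p) (size G ↑ʳ i) u ≡ false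
∪-empty-inr G p i u rewrite splitAt-↑ʳ (size G) p i with splitAt (size G) u
... | inj₁ _ = refl
... | inj₂ _ = refl

module _ {G H : Graph} (sG : IsSimple G) (sH : IsSimple H) where
  private
    module G = IsSimple sG
    module H = IsSimple sH
    n = size G
    m = size H
    G⁺ = G ∪ emptyGraph m
    H⁺ = H ∪ emptyGraph n
    sG⁺ = ∪-simple sG (emptyGraph-simple m)
    sH⁺ = ∪-simple sH (emptyGraph-simple n)
    open MatchingOf (of sG) (of sH)

  -- The unmatched vertices of each graph are paired with the isolated vertices added to the other one.
  match⇒≅* : Matching (allFin n) (allFin m) → G ≅* H
  match⇒≅* (matching ps I I′ π π′ agr iso iso′) with zip-equal E F len
    where
    E = map (_↑ˡ m) I ++ map (n ↑ʳ_) (allFin m)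
    F = map (_↑ˡ n) I′ ++ map (m ↑ʳ_) (allFin n)
    len₁ : length ps + length I ≡ n
    len₁ = trans (cong (_+ length I) (sym (length-map proj₁ ps))) (trans (sym (length-++ (map proj₁ ps)))
             (trans (sym (↭-length π)) (length-tabulate id)))
    len₂ : length ps + length I′ ≡ m
    len₂ = trans (cong (_+ length I′) (sym (length-map proj₂ ps))) (trans (sym (length-++ (map proj₂ ps)))
             (trans (sym (↭-length π′)) (length-tabulate id)))
    length-parts : ∀ {A B C : Set} (f : A → C) (h : B → C) L M → length (map f L ++ map h M) ≡ length L + length M
    length-parts f h L M = trans (length-++ (map f L)) (cong₂ _+_ (length-map f L) (length-map h M))
    len : length E ≡ length F
    len = trans (length-parts (_↑ˡ m) (n ↑ʳ_) I (allFin m)) (trans (cong (length I +_) (length-tabulate {n = m} id))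
      (trans (trans (cong (length I +_) (sym len₂)) (trans (lem (length I) (length ps) (length I′)) (cong (length I′ +_) len₁)))
      (sym (trans (length-parts (_↑ˡ n) (m ↑ʳ_) I′ (allFin n)) (cong (length I′ +_) (length-tabulate {n = n} id))))))
      where
      lem : ∀ a b c → a + (b + c) ≡ c + (b + a)
      lem = solve-∀
  ... | qs , eqE , eqF = m , n , pairs⇒≅ sG⁺ sH⁺ (map inj ps ++ qs) perm₁ perm₂
        (AllPairs-++⁺ (agree-inj agr) (all-agree qs falseE falseF) (cross ps))
    where
    inj : Fin n × Fin m → Fin (n + m) × Fin (m + n)
    inj (u , v) = u ↑ˡ m , v ↑ˡ n
    Agree⁺ : Fin (n + m) × Fin (m + n) → Fin (n + m) × Fin (m + n) → Set
    Agree⁺ (u , u′) (v , v′) = adj G⁺ u v ≡ adj H⁺ u′ v′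
    E = map (_↑ˡ m) I ++ map (n ↑ʳ_) (allFin m)
    F = map (_↑ˡ n) I′ ++ map (m ↑ʳ_) (allFin n)
    map-inj : ∀ {B C : Set} (f : Fin n × Fin m → B) (h : Fin (n + m) × Fin (m + n) → C) (k : B → C) →
      (∀ x → h (inj x) ≡ k (f x)) → ∀ ps → map h (map inj ps) ≡ map k (map f ps)
    map-inj f h k eq []       = refl
    map-inj f h k eq (x ∷ ps) = cong₂ _∷_ (eq x) (map-inj f h k eq ps)
    perm₁ : allFin (n + m) ↭ map proj₁ (map inj ps ++ qs)
    perm₁ = ↭-trans (Perm.↭-reflexive (allFin-+ n m)) (↭-trans (++⁺ʳ _ (map⁺ (_↑ˡ m) π)) (Perm.↭-reflexive (begin
      map (_↑ˡ m) (map proj₁ ps ++ I) ++ map (n ↑ʳ_) (allFin m) ≡⟨ cong (_++ _) (map-++ (_↑ˡ m) (map proj₁ ps) I) ⟩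
      (map (_↑ˡ m) (map proj₁ ps) ++ map (_↑ˡ m) I) ++ map (n ↑ʳ_) (allFin m) ≡⟨ ++-assoc (map (_↑ˡ m) (map proj₁ ps)) _ _ ⟩
      map (_↑ˡ m) (map proj₁ ps) ++ E ≡⟨ cong₂ _++_ (map-inj proj₁ proj₁ (_↑ˡ m) (λ _ → refl) ps) eqE ⟨
      map proj₁ (map inj ps) ++ map proj₁ qs ≡⟨ map-++ proj₁ (map inj ps) qs ⟨
      map proj₁ (map inj ps ++ qs) ∎)))
      where open ≡-Reasoning
    perm₂ : allFin (m + n) ↭ map proj₂ (map inj ps ++ qs)
    perm₂ = ↭-trans (Perm.↭-reflexive (allFin-+ m n)) (↭-trans (++⁺ʳ _ (map⁺ (_↑ˡ n) π′)) (Perm.↭-reflexive (begin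
      map (_↑ˡ n) (map proj₂ ps ++ I′) ++ map (m ↑ʳ_) (allFin n) ≡⟨ cong (_++ _) (map-++ (_↑ˡ n) (map proj₂ ps) I′) ⟩
      (map (_↑ˡ n) (map proj₂ ps) ++ map (_↑ˡ n) I′) ++ map (m ↑ʳ_) (allFin n) ≡⟨ ++-assoc (map (_↑ˡ n) (map proj₂ ps)) _ _ ⟩
      map (_↑ˡ n) (map proj₂ ps) ++ F ≡⟨ cong₂ _++_ (map-inj proj₂ proj₂ (_↑ˡ n) (λ _ → refl) ps) eqF ⟨
      map proj₂ (map inj ps) ++ map proj₂ qs ≡⟨ map-++ proj₂ (map inj ps) qs ⟨
      map proj₂ (map inj ps ++ qs) ∎)))
      where open ≡-Reasoning
    agree-inj : ∀ {ps} → AllPairs Agree ps → AllPairs Agree⁺ (map inj ps)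
    agree-inj [] = []
    agree-inj (p ∷ ap) = All.map⁺ (All.map (λ {y} e → trans (∪-inl G (emptyGraph m) _ _) (trans e (sym (∪-inl H (emptyGraph n) _ _)))) p)
                         ∷ agree-inj ap
    falseE : All (λ e → ∀ u → adj G⁺ e u ≡ false) (map proj₁ qs)
    falseE = subst (All _) (sym eqE) (++⁺ (All.map⁺ (All.map (λ {i} h → ∪-empty-inl G m i (λ j → All.lookup h (∈-resp-↭ π (∈-allFin j)))) iso))
               (All-map⁺ (n ↑ʳ_) (∪-empty-inr G m)))
    falseF : All (λ e → ∀ u → adj H⁺ e u ≡ false) (map proj₂ qs)
    falseF = subst (All _) (sym eqF) (++⁺ (All.map⁺ (All.map (λ {i} h → ∪-empty-inl H n i (λ j → All.lookup h (∈-resp-↭ π′ (∈-allFin j)))) iso′))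
               (All-map⁺ (m ↑ʳ_) (∪-empty-inr H n)))
    agree-with : ∀ x qs → All (λ e → ∀ u → adj G⁺ e u ≡ false) (map proj₁ qs) → All (λ e → ∀ u → adj H⁺ e u ≡ false) (map proj₂ qs) →
      All (Agree⁺ x) qs
    agree-with x [] [] [] = []
    agree-with x (y ∷ qs) (e ∷ es) (f ∷ fs) = trans (IsSimple.symmetric sG⁺ (proj₁ x) (proj₁ y)) (trans (e (proj₁ x))
      (sym (trans (IsSimple.symmetric sH⁺ (proj₂ x) (proj₂ y)) (f (proj₂ x))))) ∷ agree-with x qs es fs
    all-agree : ∀ qs → All (λ e → ∀ u → adj G⁺ e u ≡ false) (map proj₁ qs) → All (λ e → ∀ u → adj H⁺ e u ≡ false) (map proj₂ qs) →
      AllPairs Agree⁺ qs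
    all-agree [] [] [] = []
    all-agree (x ∷ qs) (_ ∷ es) (_ ∷ fs) = agree-with x qs es fs ∷ all-agree qs es fs
    cross : ∀ ps → All (λ x → All (Agree⁺ x) qs) (map inj ps)
    cross []       = []
    cross (x ∷ ps) = agree-with (inj x) qs falseE falseF ∷ cross ps

module _ {V : Set} (𝒢 : Adjacency V) where
  open Adjacency 𝒢
  open ListGraph 𝒢

  -- General `φ` and `S` let the recursion pass to the later copies inside one ambient graph. The
  -- equation for `s` bridges r + 1 in the theorem and `suc r` here.
  peel-copies : ∀ {r s} → s ≡ suc r → ∀ a (φ : Fin (size (copies a (K s))) → V) →
    (∀ i j → φ i ~ φ j ≡ adj (copies a (K s)) i j) → ∀ S → (∀ i → All (λ u → φ i ~ u ≡ false) S) →
    Peeled r a (map φ (allFin (size (copies a (K s)))) ++ S) S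
  peel-copies s≡ zero φ φ-adj S out = done
  peel-copies {r} {s} s≡ (suc a) φ φ-adj S out = peel (map φˡ (allFin s)) (map φʳ (allFin c) ++ S)
      (Perm.↭-reflexive split)
      (clique (allFin-K s))
      (trans (length-map φˡ (allFin s)) (trans (length-tabulate {n = s} id) s≡))
      (All-map⁺ φˡ (λ x → ++⁺ (All-map⁺ φʳ (λ y → trans (φ-adj _ _) (∪-cross (K s) (copies a (K s)) x y))) (out (x ↑ˡ c))))
      (peel-copies s≡ a φʳ (λ i j → trans (φ-adj _ _) (∪-inr (K s) (copies a (K s)) i j)) S (λ i → out (s ↑ʳ i)))
    where
    c = size (copies a (K s))
    φˡ : Fin s → V
    φˡ i = φ (i ↑ˡ c)
    φʳ : Fin c → V
    φʳ i = φ (s ↑ʳ i)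
    split : map φ (allFin (s + c)) ++ S ≡ map φˡ (allFin s) ++ (map φʳ (allFin c) ++ S)
    split = begin
      map φ (allFin (s + c)) ++ S ≡⟨ cong (λ L → map φ L ++ S) (allFin-+ s c) ⟩
      map φ (map (_↑ˡ c) (allFin s) ++ map (s ↑ʳ_) (allFin c)) ++ S ≡⟨ cong (_++ S) (map-++ φ (map (_↑ˡ c) (allFin s)) _) ⟩
      (map φ (map (_↑ˡ c) (allFin s)) ++ map φ (map (s ↑ʳ_) (allFin c))) ++ S
        ≡⟨ cong₂ (λ X Y → (X ++ Y) ++ S) (map-∘ (allFin s)) (map-∘ (allFin c)) ⟨
      (map φˡ (allFin s) ++ map φʳ (allFin c)) ++ S ≡⟨ ++-assoc (map φˡ (allFin s)) _ S ⟩
      map φˡ (allFin s) ++ (map φʳ (allFin c) ++ S) ∎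
      where open ≡-Reasoning
    clique : ∀ {L} → AllPairs (λ i j → adj (K s) i j ≡ true) L → Clique (map φˡ L)
    clique [] = []
    clique (p ∷ ap) = All.map⁺ (All.map (λ {j} e → trans (φ-adj _ _) (trans (∪-inl (K s) (copies a (K s)) _ j) e)) p) ∷ clique ap

-- Comparison with the extremal graphs of the theorem

module Assembly (r a : ℕ) (G : Graph) (sG : IsSimple G) where
  private
    s = r + 1
    Ks = copies a (K s)
    sKs = copies-simple a (K-simple s)
    module G = IsSimple sG
  open ListGraph (of sG)

  private
    s≡ : s ≡ suc r
    s≡ = +-comm r 1

  module _ (b : ℕ) where
    private
      H = Ks ∪ colex b
      sH = ∪-simple sKs (colex-simple b)
      module H = IsSimple sH
      inr : Fin (suc b) → Fin (size H)
      inr = size Ks ↑ʳ_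

    κ-colex-target : κ H ≡ a * g (tri (suc r)) + g b
    κ-colex-target = trans (κ-∪ sKs (colex-simple b)) (cong₂ _+_
      (trans (κ-copies a (K-simple s)) (cong (a *_) (trans (κ-K s) (cong (λ k → g (tri k)) s≡)))) (κ-colex b))

    ≅*-colex : ∀ {R} → Peeled r a (allFin (size G)) R →
      MatchingOf.Matching (of sG) (of (colex-simple b)) R (allFin (suc b)) → G ≅* H
    ≅*-colex {R} peeled m = match⇒≅* sG sH (M.match-peeled peeled target
        (match-map (of sG) (of (colex-simple b))
          (of sH) inr (∪-inr Ks (colex b)) m))
      where
      module M = MatchingOf (of sG) (of sH)
      module T = ListGraph (of sH)
      target : T.Peeled r a (allFin (size H)) (map inr (allFin (suc b)))
      target = subst (λ L → T.Peeled r a L (map inr (allFin (suc b)))) (sym (allFin-+ (size Ks) (suc b)))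
        (peel-copies (of sH) s≡ a (_↑ˡ suc b) (∪-inl Ks (colex b)) (map inr (allFin (suc b)))
          (λ i → All-map⁺ inr (∪-cross Ks (colex b) i)))

  module _ (c : ℕ) where
    private
      KsKc = Ks ∪ K c
      sKsKc = ∪-simple sKs (K-simple c)
      H = KsKc ∪ K 2
      sH = ∪-simple sKsKc (K-simple 2)
      module H = IsSimple sH
      φ : Fin (size Ks) → Fin (size H)
      φ i = (i ↑ˡ c) ↑ˡ 2
      φc : Fin c → Fin (size H)
      φc i = (size Ks ↑ʳ i) ↑ˡ 2
      φ2 : Fin 2 → Fin (size H)
      φ2 = size KsKc ↑ʳ_
      φ-adj : ∀ i j → adj H (φ i) (φ j) ≡ adj Ks i j
      φ-adj i j = trans (∪-inl KsKc (K 2) _ _) (∪-inl Ks (K c) i j)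
      φc-adj : ∀ i j → adj H (φc i) (φc j) ≡ adj (K c) i j
      φc-adj i j = trans (∪-inl KsKc (K 2) _ _) (∪-inr Ks (K c) i j)

    -- An edge to a single vertex of K_c and a separate K_2 both contribute one clique, so the value
    -- is that at tri c + 1.
    κ-split-target : 2 ≤ c → κ H ≡ a * g (tri (suc r)) + g (tri c + 1)
    κ-split-target 2≤c = +-cancelʳ-≡ 1 _ _ (begin
      κ H + 1 ≡⟨ cong (_+ 1) (κ-∪ sKsKc (K-simple 2)) ⟩
      κ KsKc + κ (K 2) + 1 ≡⟨ cong₂ (λ x y → x + y + 1) (κ-∪ sKs (K-simple c)) κ-K2 ⟩
      κ Ks + κ (K c) + 1 + 1 ≡⟨ cong₂ (λ x y → x + y + 1 + 1)
                                                       (trans (κ-copies a (K-simple s)) (cong (a *_) (trans (κ-K s) (cong (λ k → g (tri k)) s≡)))) (κ-K c) ⟩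
      a * g (tri (suc r)) + g (tri c) + 1 + 1 ≡⟨ lem (a * g (tri (suc r))) (g (tri c)) ⟩
      a * g (tri (suc r)) + (g (tri c) + 2) ≡⟨ cong (a * g (tri (suc r)) +_) (g-tri+ c 1 (<⇒≤ 2≤c)) ⟨
      a * g (tri (suc r)) + (g (tri c + 1) + 1) ≡⟨ +-assoc (a * g (tri (suc r))) _ 1 ⟨
      a * g (tri (suc r)) + g (tri c + 1) + 1 ∎)
      where
      open ≡-Reasoning
      lem : ∀ x y → x + y + 1 + 1 ≡ x + (y + 2)
      lem = solve-∀
      κ-K2 : κ (K 2) ≡ 1
      κ-K2 = trans (κ-K 2) (+-cancelʳ-≡ 3 _ _ (g-tri 2))

    ≅*-split : ∀ {R} → Peeled r a (allFin (size G)) R → Split c R → G ≅* H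
    ≅*-split {R} peeled sp = match⇒≅* sG sH (M.match-peeled peeled target (M.match-split sp shape))
      where
      module M = MatchingOf (of sG) (of sH)
      module T = ListGraph (of sH)
      Q = map φc (allFin c)
      v = φ2 zero
      w = φ2 (suc zero)
      S = Q ++ v ∷ w ∷ []
      split : allFin (size H) ≡ map φ (allFin (size Ks)) ++ S
      split = begin
        allFin (size KsKc + 2) ≡⟨ allFin-+ (size KsKc) 2 ⟩
        map (_↑ˡ 2) (allFin (size Ks + c)) ++ v ∷ w ∷ [] ≡⟨ cong (λ L → map (_↑ˡ 2) L ++ v ∷ w ∷ []) (allFin-+ (size Ks) c) ⟩
        map (_↑ˡ 2) (map (_↑ˡ c) (allFin (size Ks)) ++ map (size Ks ↑ʳ_) (allFin c)) ++ v ∷ w ∷ []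
          ≡⟨ cong (_++ v ∷ w ∷ []) (map-++ (_↑ˡ 2) (map (_↑ˡ c) (allFin (size Ks))) _) ⟩
        (map (_↑ˡ 2) (map (_↑ˡ c) (allFin (size Ks))) ++ map (_↑ˡ 2) (map (size Ks ↑ʳ_) (allFin c))) ++ v ∷ w ∷ []
          ≡⟨ cong₂ (λ X Y → (X ++ Y) ++ v ∷ w ∷ []) (map-∘ (allFin (size Ks))) (map-∘ (allFin c)) ⟨
        (map φ (allFin (size Ks)) ++ Q) ++ v ∷ w ∷ [] ≡⟨ ++-assoc (map φ (allFin (size Ks))) Q _ ⟩
        map φ (allFin (size Ks)) ++ S ∎
        where open ≡-Reasoning
      target : T.Peeled r a (allFin (size H)) S
      target = subst (λ L → T.Peeled r a L S) (sym split) (peel-copies (of sH) s≡ a φ φ-adj S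
        (λ i → ++⁺ (All-map⁺ φc (λ j → trans (∪-inl KsKc (K 2) _ _) (∪-cross Ks (K c) i j)))
                   (∪-cross KsKc (K 2) (i ↑ˡ c) zero ∷ ∪-cross KsKc (K 2) (i ↑ˡ c) (suc zero) ∷ [])))
      clique : ∀ {L} → AllPairs (λ i j → adj (K c) i j ≡ true) L → T.Clique (map φc L)
      clique [] = []
      clique (p ∷ ap) = All.map⁺ (All.map (λ e → trans (φc-adj _ _) e) p) ∷ clique ap
      shape : T.Split c S
      shape = v , w , Q , [] , ↭-trans (++-comm Q (v ∷ w ∷ [])) (Perm.↭-reflexive (cong (λ X → v ∷ w ∷ X) (sym (++-identityʳ Q)))) ,
        ∪-inr KsKc (K 2) zero (suc zero) , clique (allFin-K c) , trans (length-map φc (allFin c)) (length-tabulate {n = c} id) ,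
        All-map⁺ φc (λ i → trans (H.symmetric v (φc i)) (∪-cross KsKc (K 2) (size Ks ↑ʳ i) zero)) ,
        All-map⁺ φc (λ i → trans (H.symmetric w (φc i)) (∪-cross KsKc (K 2) (size Ks ↑ʳ i) (suc zero))) , []

mainTheorem1 : (m r a b : ℕ) → 1 ≤ r → m ≡ a * ((r + 1) C 2) + b → b < (r + 1) C 2 →
    (G : Graph) → IsSimple G → edges G ≡ m → MaxDegree≤ G r →
    (κ G ≤ κ (copies a (K (r + 1)) ∪ colex b))
    × ((κ G ≡ κ (copies a (K (r + 1)) ∪ colex b))
    ⇔ ((G ≅* (copies a (K (r + 1)) ∪ colex b))
    ⊎ (∃[ c ] (2 ≤ c × b ≡ c C 2 + 1 × (G ≅* (copies a (K (r + 1)) ∪ K c ∪ K 2))))))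
mainTheorem1 m r a b 1≤r m≡ b< G sG e≡ max =
    subst₂ _≤_ (sym κG) (sym κH) (bounded r a L b maxL eL b<N) , mk⇔ forward backward
  where
  module G = IsSimple sG
  open ListGraph (of sG)
  open Assembly r a G sG
  L = allFin (size G)
  N≡ : (r + 1) C 2 ≡ tri (suc r)
  N≡ = trans (C2≡tri (r + 1)) (cong tri (+-comm r 1))
  b<N : b < tri (suc r)
  b<N = subst (b <_) N≡ b<
  κG : κ G ≡ #κ L
  κG = κ≡ sG
  κH : κ (copies a (K (r + 1)) ∪ colex b) ≡ a * g (tri (suc r)) + g b
  κH = κ-colex-target b
  eL : #e L ≡ a * tri (suc r) + b
  eL = trans (sym (edges≡ sG)) (trans e≡ (trans m≡ (cong (λ N → a * N + b) N≡)))
  maxL : MaxDeg r L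
  maxL = All.tabulate (λ {v} _ → subst (_≤ r) (degree≡ sG v) (max v))
  open MatchingOf (of sG) (of (colex-simple b)) using (match-complete; match-pendant)
  forward : κ G ≡ κ (copies a (K (r + 1)) ∪ colex b) → (G ≅* (copies a (K (r + 1)) ∪ colex b))
    ⊎ (∃[ c ] (2 ≤ c × b ≡ c C 2 + 1 × (G ≅* (copies a (K (r + 1)) ∪ K c ∪ K 2))))
  forward eq with extremal⇒Peeled r a L b maxL eL b<N (trans (sym κG) (trans eq κH))
  ... | R , peeled , eR , κR with extremal⇒ColexLike _ R ≤-refl (trans κR (cong g (sym eR)))
  ...   | inj₁ (c , _ , eR′ , shape) =
          inj₁ (≅*-colex b peeled (match-complete shape (Colex.complete b c (trans (sym eR) eR′))))
  ...   | inj₂ (c , d , 1≤d , d<c , eR′ , inj₁ shape) =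
          inj₁ (≅*-colex b peeled (match-pendant shape (Colex.pendant b c d 1≤d d<c (trans (sym eR) eR′))))
  -- At d = 1 the bound `d<c` is the required 2 ≤ c.
  ...   | inj₂ (c , .1 , 1≤d , d<c , eR′ , inj₂ (refl , shape)) =
          inj₂ (c , d<c , trans (sym eR) (trans eR′ (cong (_+ 1) (sym (C2≡tri c)))) , ≅*-split c peeled shape)
  backward : (G ≅* (copies a (K (r + 1)) ∪ colex b)) ⊎ (∃[ c ] (2 ≤ c × b ≡ c C 2 + 1 × (G ≅* (copies a (K (r + 1)) ∪ K c ∪ K 2)))) →
    κ G ≡ κ (copies a (K (r + 1)) ∪ colex b)
  backward (inj₁ iso) = ≅*-κ sG (∪-simple (copies-simple a (K-simple (r + 1))) (colex-simple b)) iso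
  backward (inj₂ (c , 2≤c , b≡ , iso)) = trans
    (≅*-κ sG (∪-simple (∪-simple (copies-simple a (K-simple (r + 1))) (K-simple c)) (K-simple 2)) iso)
    (trans (κ-split-target c 2≤c) (trans (cong (λ k → a * g (tri (suc r)) + g k) (sym (trans b≡ (cong (_+ 1) (C2≡tri c))))) (sym κH)))
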